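{- $U$ and $SU^i$ are the same rank: for every complete type $p$, $U(p)=SU^i(p)$.
   Context: $T$ is a complete first-order theory with a monster model $\mathfrak C$ that is $\bar\kappa$-saturated and strongly $\bar\kappa$-homogeneous for a sufficiently large cardinal $\bar\kappa$ (e.g. strongly inaccessible). All parameter sets are small subsets of $\mathfrak C$ (cardinality $<\bar\kappa$), and cardinals quantified over in the definitions below are small. Complete types are finitary. A global type is a complete type over $\mathfrak C$. $U$-rank: for $p(x)\in S(A)$: $U(p)\ge 0$; $U(p)\ge\alpha+1$ iff for each cardinal $\kappa$ there are a set $B\supseteq A$ and at least $\kappa$ many types $q(x)\in S(B)$ extending $p$ with $U(q)\ge\alpha$; for limit $\alpha$, $U(p)\ge\alpha$ iff $U(p)\ge\beta$ for all $\beta<\alpha$. $U(p)$ is the supremum of all $\alpha$ with $U(p)\ge\alpha$, or $\infty$ if there is no supremum. Lascar-splitting: $Autf(\mathfrak C/A)$ is the subgroup of $Aut(\mathfrak C/A)$ generated by the automorphisms fixing pointwise some model containing $A$. Write $a\stackrel{Ls}{\equiv}_A b$ if $a,b$ are in the same orbit under $Autf(\mathfrak C/A)$. A complete type $p(x)$ over $B\supseteq A$ (possibly $B=\mathfrak C$) Lascar-splits over $A$ if for some formula $\varphi(x,y)\in L$ there are tuples $a,b\in B$ with $a\stackrel{Ls}{\equiv}_A b$, $\varphi(x,a)\in p$ and $\neg\varphi(x,b)\in p$. $SU^i$ is the foundation rank of the relation $R_i$: for $p(x)\in S(A)$ and $q(x)\in S(B)$, $p\,R_i\,q$ iff $p\subseteq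 q$ and every global extension of $q$ Lascar-splits over $A$. Explicitly: $SU^i(p)\ge 0$; $SU^i(p)\ge\alpha+1$ iff there is $q$ with $p\,R_i\,q$ and $SU^i(q)\ge\alpha$; for limit $\alpha$, $SU^i(p)\ge\alpha$ iff $SU^i(p)\ge\beta$ for all $\beta<\alpha$; $SU^i(p)$ is the supremum of such $\alpha$, or $\infty$ if there is no supremum. -}

module Defs where

open import Level using (Level; _⊔_) renaming (suc to lsuc)
open import Data.Bool.Base using (Bool)
open import Data.Empty.Polymorphic using (⊥)
open import Data.Fin.Base using (Fin)
open import Data.List.Base using (List)
open import Data.List.Relation.Unary.All using () renaming (All to Allᴸ)
open import Data.Nat.Base using (ℕ; suc; _+_)
open import Data.Product.Base using (Σ; ∃; ∃-syntax; Σ-syntax; _×_)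
open import Data.Sum.Base using (_⊎_)
open import Data.Unit.Polymorphic using (⊤)
open import Data.Vec.Base using (Vec; []; _∷_; _++_; lookup; map)
open import Data.Vec.Properties using (map-id; map-∘; map-cong)
open import Data.Vec.Relation.Unary.All using (All)
open import Function.Base using (_∘_)
open import Function.Bundles using (_⇔_; _↔_; _↣_; module Inverse)
open import Function.Construct.Composition using (_↔-∘_; _⇔-∘_)
open import Function.Construct.Identity using (↔-id; ⇔-id)
open import Function.Construct.Symmetry using (↔-sym; ⇔-sym)
open import Function.Definitions using (Injective)
open import Relation.Binary.PropositionalEquality
  using (_≡_; sym; trans; cong; subst; module ≡-Reasoning)
open import Relation.Nullary.Negation.Core using (¬_)
open import Relation.Unary using (Pred; _∈_; _⊆_; _≐_)

-- A cardinal is represented by a type of that cardinality; only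
-- comparisons of cardinalities are ever used.
infix 4 _≺_

_≺_ : ∀ {a b} → Set a → Set b → Set (a ⊔ b)
X ≺ Y = (X ↣ Y) × ¬ (Y ↣ X)

record StronglyInaccessible {ℓ} (κ : Set ℓ) : Set (lsuc ℓ) where
  field
    uncountable : ℕ ≺ κ
    regular     : (I : Set ℓ) (X : I → Set ℓ) → I ≺ κ → (∀ i → X i ≺ κ) → Σ I X ≺ κ
    strongLimit : (X : Set ℓ) → X ≺ κ → (X → Bool) ≺ κ

-- lim f is the supremum of f, which need not be a limit ordinal.  The ranks
-- below are monotone, so "rank ≥ lim f iff rank ≥ f i for all i" is also
-- correct when the supremum is attained or the family is empty.
data Ord (o : Level) : Set (lsuc o) where
  zero : Ord o
  suc  : Ord o → Ord o
  lim  : (I : Set o) → (I → Ord o) → Ord o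

-- Different trees may denote the same ordinal; ≤ compares what they denote.
module _ {o : Level} where

  infix 4 _≤_ _<_

  _≤_ : Ord o → Ord o → Set o
  _<_ : Ord o → Ord o → Set o

  zero    ≤ β = ⊤
  suc α   ≤ β = α < β
  lim I f ≤ β = ∀ i → f i ≤ β

  α < zero    = ⊥
  α < suc β   = α ≤ β
  α < lim I f = ∃[ i ] α < f i

  IsSupremum : Pred (Ord o) o → Pred (Ord o) (lsuc o)
  IsSupremum P α = (∀ β → β ∈ P → β ≤ α) × (∀ γ → (∀ β → β ∈ P → β ≤ γ) → α ≤ γ)

data Ord∞ (o : Level) : Set (lsuc o) where
  ord : Ord o → Ord∞ o
  ∞   : Ord∞ o

-- For P α = "the rank is ≥ α": the rank has value v.
HasValue : ∀ {o} → Pred (Ord o) o → Pred (Ord∞ o) (lsuc o)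
HasValue P (ord α) = IsSupremum P α
HasValue P ∞       = ¬ ∃ (IsSupremum P)

record Language (ℓ : Level) : Set (lsuc ℓ) where
  field
    Fun : ℕ → Set ℓ
    Rel : ℕ → Set ℓ

module _ {ℓ : Level} (L : Language ℓ) where

  open Language L

  data Term (n : ℕ) : Set ℓ where
    var : Fin n → Term n
    fun : ∀ {k} → Fun k → Vec (Term n) k → Term n

  infix 6 _≗_
  infixr 5 _∧_

  -- Formulas with free variables in Fin n; ∃' binds variable 0.
  data Formula (n : ℕ) : Set ℓ where
    _≗_ : Term n → Term n → Formula n
    rel : ∀ {k} → Rel k → Vec (Term n) k → Formula n
    ¬'_ : Formula n → Formula n
    _∧_ : Formula n → Formula n → Formula n
    ∃'_ : Formula (suc n) → Formula n

  Sentence : Set ℓ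
  Sentence = Formula 0

  Theory : Set (lsuc ℓ)
  Theory = Pred Sentence ℓ

  record Structure : Set (lsuc ℓ) where
    field
      Carrier  : Set ℓ
      nonempty : Carrier
      ⟦_⟧ᶠ     : ∀ {k} → Fun k → Vec Carrier k → Carrier
      ⟦_⟧ʳ     : ∀ {k} → Rel k → Vec Carrier k → Set ℓ

module _ {ℓ : Level} {L : Language ℓ} where

  module _ (M : Structure L) where

    open Structure M

    eval  : ∀ {n} → Vec Carrier n → Term L n → Carrier
    evals : ∀ {n k} → Vec Carrier n → Vec (Term L n) k → Vec Carrier k

    eval v (var i)    = lookup v i
    eval v (fun f ts) = ⟦ f ⟧ᶠ (evals v ts)

    evals v []       = []
    evals v (t ∷ ts) = eval v t ∷ evals v ts

    infix 3 _⊨_[_]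

    _⊨_[_] : ∀ {n} → Formula L n → Vec Carrier n → Set ℓ
    _⊨_[_] (s ≗ t)    v = eval v s ≡ eval v t
    _⊨_[_] (rel r ts) v = ⟦ r ⟧ʳ (evals v ts)
    _⊨_[_] (¬' φ)     v = ¬ (_⊨_[_] φ v)
    _⊨_[_] (φ ∧ ψ)    v = _⊨_[_] φ v × _⊨_[_] ψ v
    _⊨_[_] (∃' φ)     v = ∃[ c ] _⊨_[_] φ (c ∷ v)

  Models : Structure L → Theory L → Set ℓ
  Models M T = ∀ σ → σ ∈ T → M ⊨ σ [ [] ]

  infix 3 _⊫_

  _⊫_ : Theory L → Sentence L → Set (lsuc ℓ)
  T ⊫ σ = ∀ M → Models M T → M ⊨ σ [ [] ]

  Complete : Theory L → Set (lsuc ℓ)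
  Complete T = (∃[ M ] Models M T) × (∀ σ → (T ⊫ σ) ⊎ (T ⊫ ¬' σ))

  record ElementaryEmbedding (N M : Structure L) : Set ℓ where
    private
      module N = Structure N
      module M = Structure M
    field
      to         : N.Carrier → M.Carrier
      elementary : ∀ {n} (φ : Formula L n) v → (N ⊨ φ [ v ]) ⇔ (M ⊨ φ [ map to v ])

  record Automorphism (M : Structure L) : Set ℓ where
    open Structure M
    field
      bijection : Carrier ↔ Carrier
    open Inverse bijection public using (to; from)
    field
      fun-hom : ∀ {k} (f : Language.Fun L k) v → to (⟦ f ⟧ᶠ v) ≡ ⟦ f ⟧ᶠ (map to v)
      rel-hom : ∀ {k} (r : Language.Rel L k) v → ⟦ r ⟧ʳ v ⇔ ⟦ r ⟧ʳ (map to v)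

  open Automorphism using (to)

  module _ {M : Structure L} where

    open Structure M

    idᵃ : Automorphism M
    idᵃ = record
      { bijection = ↔-id Carrier
      ; fun-hom   = λ f v → cong ⟦ f ⟧ᶠ (sym (map-id v))
      ; rel-hom   = λ r v → subst (λ w → ⟦ r ⟧ʳ v ⇔ ⟦ r ⟧ʳ w) (sym (map-id v)) (⇔-id _)
      }

    infixr 9 _∘ᵃ_

    _∘ᵃ_ : Automorphism M → Automorphism M → Automorphism M
    τ ∘ᵃ σ = record
      { bijection = τ.bijection ↔-∘ σ.bijection
      ; fun-hom   = λ f v → trans (cong τ.to (σ.fun-hom f v))
                           (trans (τ.fun-hom f (map σ.to v))
                                  (cong ⟦ f ⟧ᶠ (sym (map-∘ τ.to σ.to v))))
      ; rel-hom   = λ r v → subst (λ w → ⟦ r ⟧ʳ v ⇔ ⟦ r ⟧ʳ w) (sym (map-∘ τ.to σ.to v))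
                                  (τ.rel-hom r (map σ.to v) ⇔-∘ σ.rel-hom r v)
      }
      where
      module τ = Automorphism τ
      module σ = Automorphism σ

    infix 10 _⁻¹

    _⁻¹ : Automorphism M → Automorphism M
    σ ⁻¹ = record
      { bijection = ↔-sym σ.bijection
      ; fun-hom   = λ f v → begin
          σ.from (⟦ f ⟧ᶠ v)                             ≡⟨ cong (σ.from ∘ ⟦ f ⟧ᶠ) (to-from v) ⟨
          σ.from (⟦ f ⟧ᶠ (map σ.to (map σ.from v)))     ≡⟨ cong σ.from (σ.fun-hom f _) ⟨
          σ.from (σ.to (⟦ f ⟧ᶠ (map σ.from v)))         ≡⟨ Inverse.strictlyInverseʳ σ.bijection _ ⟩
          ⟦ f ⟧ᶠ (map σ.from v)                         ∎
      ; rel-hom   = λ r v → subst (λ w → ⟦ r ⟧ʳ w ⇔ ⟦ r ⟧ʳ (map σ.from v)) (to-from v)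
                                  (⇔-sym (σ.rel-hom r (map σ.from v)))
      }
      where
      open ≡-Reasoning
      module σ = Automorphism σ
      to-from : ∀ {k} (v : Vec Carrier k) → map σ.to (map σ.from v) ≡ v
      to-from v = trans (sym (map-∘ σ.to σ.from v))
                 (trans (map-cong (Inverse.strictlyInverseˡ σ.bijection) v) (map-id v))

  module _ (ℭ : Structure L) where

    open Structure ℭ renaming (Carrier to C)

    Subset : Set (lsuc ℓ)
    Subset = Pred C ℓ

    whole : Subset
    whole _ = ⊤

    -- φ ⟨ a ⟩ is the formula φ(x , a) in the variables x₀ , … , xₙ₋₁ with
    -- parameters a; these take the place of the last m variables of φ.
    record ParamFormula (n : ℕ) : Set ℓ where
      constructor _⟨_⟩
      field
        {m}    : ℕ
        body   : Formula L (n + m)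
        params : Vec C m

    SatisfiedBy : ∀ {n} → Vec C n → Pred (ParamFormula n) ℓ
    SatisfiedBy x (φ ⟨ a ⟩) = ℭ ⊨ φ [ x ++ a ]

    -- Finite satisfiability in ℭ is consistency with the theory of ℭ with
    -- constants for its elements.
    record S (n : ℕ) (A : Subset) : Set (lsuc ℓ) where
      field
        formulas    : Pred (ParamFormula n) ℓ
        over        : ∀ {m} {φ : Formula L (n + m)} {a} → φ ⟨ a ⟩ ∈ formulas → All A a
        complete    : ∀ {m} (φ : Formula L (n + m)) a → All A a →
                      φ ⟨ a ⟩ ∈ formulas ⊎ (¬' φ) ⟨ a ⟩ ∈ formulas
        satisfiable : (Φ : List (ParamFormula n)) → Allᴸ formulas Φ →
                      ∃[ x ] Allᴸ (SatisfiedBy x) Φ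

  open S public using (formulas)

  module _ {ℭ : Structure L} where

    open Structure ℭ renaming (Carrier to C)

    infix 4 _⊑_ _≈_

    _⊑_ : ∀ {n A B} → S ℭ n A → S ℭ n B → Set ℓ
    p ⊑ q = formulas p ⊆ formulas q

    _≈_ : ∀ {n A B} → S ℭ n A → S ℭ n B → Set ℓ
    p ≈ q = formulas p ≐ formulas q

  module Monster (κ̄ : Set ℓ) (ℭ : Structure L) where

    open Structure ℭ using () renaming (Carrier to C)

    -- Elements of Σ C A carry a proof of membership, so Σ C A may be larger
    -- than the set A; hence smallness is expressed by an enumeration.
    Small : Pred (Subset ℭ) (lsuc ℓ)
    Small A = Σ[ I ∈ Set ℓ ] I ≺ κ̄ × Σ[ e ∈ (I → C) ] (∀ c → c ∈ A → ∃[ i ] e i ≡ c)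

    Saturated : Set (lsuc ℓ)
    Saturated = ∀ {n} (A : Subset ℭ) → Small A → (p : S ℭ n A) →
                ∃[ x ] formulas p ⊆ SatisfiedBy ℭ x

    -- Partial elementary maps are given as a ↦ b for small families a and b.
    StronglyHomogeneous : Set (lsuc ℓ)
    StronglyHomogeneous =
      (I : Set ℓ) → I ≺ κ̄ → (a b : I → C) →
      (∀ {k} (φ : Formula L k) (i : Vec I k) → (ℭ ⊨ φ [ map a i ]) ⇔ (ℭ ⊨ φ [ map b i ])) →
      Σ[ σ ∈ Automorphism ℭ ] ∀ i → to σ (a i) ≡ b i

    -- A small elementary submodel of ℭ is given as the image of an
    -- elementary embedding.
    FixesModelContaining : Subset ℭ → Pred (Automorphism ℭ) (lsuc ℓ)
    FixesModelContaining A σ =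
      Σ[ N ∈ Structure L ] Structure.Carrier N ≺ κ̄ ×
      Σ[ e ∈ ElementaryEmbedding N ℭ ]
        (∀ c → c ∈ A → ∃[ x ] ElementaryEmbedding.to e x ≡ c) ×
        (∀ x → to σ (ElementaryEmbedding.to e x) ≡ ElementaryEmbedding.to e x)

    data Autf (A : Subset ℭ) : Pred (Automorphism ℭ) (lsuc ℓ) where
      generator   : ∀ {σ} → FixesModelContaining A σ → Autf A σ
      identity    : Autf A idᵃ
      composition : ∀ {τ σ} → Autf A τ → Autf A σ → Autf A (τ ∘ᵃ σ)
      inverse     : ∀ {σ} → Autf A σ → Autf A (σ ⁻¹)

    LascarEquivalent : Subset ℭ → ∀ {m} → Vec C m → Vec C m → Set (lsuc ℓ)
    LascarEquivalent A a b = ∃[ σ ] σ ∈ Autf A × map (to σ) a ≡ b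

    -- That a and b lie in B is part of p, by S.over.
    LascarSplitsOver : Subset ℭ → ∀ {n B} → S ℭ n B → Set (lsuc ℓ)
    LascarSplitsOver A {n} p =
      ∃[ m ] Σ[ φ ∈ Formula L (n + m) ] ∃[ a ] ∃[ b ]
        LascarEquivalent A a b × φ ⟨ a ⟩ ∈ formulas p × (¬' φ) ⟨ b ⟩ ∈ formulas p

    -- At this index level Ord contains an ordinal of cardinality greater than
    -- that of the collection of all types over small sets, so that the value
    -- ∞ is never due to a lack of ordinals.
    U≥ : Ord (lsuc ℓ) → ∀ {n A} → S ℭ n A → Set (lsuc ℓ)
    U≥ zero              p = ⊤
    U≥ (suc α) {n} {A}   p =
      (κ : Set ℓ) → κ ≺ κ̄ →
      Σ[ B ∈ Subset ℭ ] Small B × A ⊆ B ×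
      Σ[ q ∈ (κ → S ℭ n B) ] Injective _≡_ _≈_ q × (∀ i → p ⊑ q i × U≥ α (q i))
    U≥ (lim I f)         p = ∀ i → U≥ (f i) p

    -- p ⊑ q already forces A ⊆ B, as p is complete over A.
    R : ∀ {n A B} → S ℭ n A → S ℭ n B → Set (lsuc ℓ)
    R {n} {A} p q = p ⊑ q × ((r : S ℭ n (whole ℭ)) → q ⊑ r → LascarSplitsOver A r)

    SUⁱ≥ : Ord (lsuc ℓ) → ∀ {n A} → S ℭ n A → Set (lsuc ℓ)
    SUⁱ≥ zero        p = ⊤
    SUⁱ≥ (suc α) {n} p =
      Σ[ B ∈ Subset ℭ ] Small B × Σ[ q ∈ S ℭ n B ] R p q × SUⁱ≥ α q
    SUⁱ≥ (lim I f)   p = ∀ i → SUⁱ≥ (f i) p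

    infix 4 U[_]≡_ SUⁱ[_]≡_

    U[_]≡_ : ∀ {n A} → S ℭ n A → Ord∞ (lsuc ℓ) → Set (lsuc (lsuc ℓ))
    U[ p ]≡ v = HasValue (λ α → U≥ α p) v

    SUⁱ[_]≡_ : ∀ {n A} → S ℭ n A → Ord∞ (lsuc ℓ) → Set (lsuc (lsuc ℓ))
    SUⁱ[ p ]≡ v = HasValue (λ α → SUⁱ≥ α p) v

  record IsMonster (T : Theory L) (κ̄ : Set ℓ) (ℭ : Structure L) : Set (lsuc ℓ) where
    field
      models              : Models ℭ T
      inaccessible        : StronglyInaccessible κ̄
      small-functions     : Σ ℕ (Language.Fun L) ≺ κ̄
      small-relations     : Σ ℕ (Language.Rel L) ≺ κ̄
      saturated           : Monster.Saturated κ̄ ℭ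
      stronglyHomogeneous : Monster.StronglyHomogeneous κ̄ ℭ

{-# OPTIONS --safe #-}

-- A U-rank that is an ordinal makes the type stable: otherwise trees of
-- instances of some formula exist at every height and, stretched to κ levels,
-- give κ extensions of any rank.  For a stable type two facts are combined.
-- * Extension: tp(y/B) extends to every D ⊇ B without losing rank.  Cantor–
--   Bendixson analysis of the patterns of truth values of the realisations of
--   tp(y/B) gives a type t of the new parameters that is invariant over every
--   model containing B; tp(y) agrees with t somewhere along a long sequence
--   of realisations of t, since each disagreement lowers the height of a tree.
-- * If every global extension of q ⊇ p splits over the domain A of p, then
--   U(p) > U(q): the parameters witnessing the splitting start a coheir
--   sequence over a model, and its conjugates yield arbitrarily many distinct
--   extensions of p of the same rank on a common domain.
-- Conversely a global type that does not Lascar-split over A is determined by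
-- data over one small model containing A, so among sufficiently many distinct
-- extensions of p one has only splitting global extensions.

module Submission where

open import Defs hiding (_≤_; _<_; zero; suc)
open import Axiom.ExcludedMiddle using (ExcludedMiddle)
open import Axiom.Extensionality.Propositional using (Extensionality)
open import Data.Bool.Base using (Bool; true; false; not) renaming (_∧_ to _∧ᵇ_)
open import Axiom.UniquenessOfIdentityProofs.WithK using (uip)
open import Data.Empty using (⊥; ⊥-elim)
open import Data.Empty.Polymorphic using () renaming (⊥ to ⊥ᵖ)
open import Data.Fin.Base using (Fin; zero; suc; toℕ; join; _↑ˡ_; _↑ʳ_)
open import Data.Fin.Properties using (toℕ-injective)
open import Data.List.Base using (List; []; _∷_; length) renaming (map to mapᴸ; _++_ to _++ᴸ_)
open import Data.List.Membership.Propositional using () renaming (_∈_ to _∈ᴸ_)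
open import Data.List.Relation.Unary.All using (All; []; _∷_)
  renaming (map to mapᴬ; tabulate to All-tabulate; lookup to All-lookup)
open import Data.List.Relation.Unary.All.Properties using (++⁺; ++⁻ˡ; ++⁻ʳ) renaming (map⁻ to All-map⁻)
open import Data.List.Relation.Unary.Any using (here; there)
open import Data.Nat.Base using (ℕ; zero; suc; _+_; _⊔_; _≤_; _≤′_; ≤′-refl; ≤′-step; s≤s) renaming (_<_ to _<ᴺ_)
open import Data.Nat.Properties using (+-assoc; +-comm; +-identityʳ; +-suc; <⇒≢; ≤-refl; ≤-trans; ≤⇒≤′;
  m≤m⊔n; m≤n⊔m; m≤n⇒m<n∨m≡n; m⊔n≤o⇒m≤o; m⊔n≤o⇒n≤o)
open import Data.Product.Base using (Σ; ∃; ∃-syntax; Σ-syntax; _×_; _,_; proj₁; proj₂)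
open import Data.Product.Properties using (Σ-≡,≡←≡)
open import Data.Sum.Base using (_⊎_; inj₁; inj₂; [_,_]′) renaming (map₁ to map₁ˢ; map₂ to map₂ˢ)
open import Data.Unit.Polymorphic using (⊤; tt)
open import Data.Vec.Base using (Vec; []; _∷_; _++_; lookup; map; tabulate; allFin)
open import Data.Vec.Properties using (map-∘; map-cong; map-id; map-++; lookup-map; lookup-++ˡ; lookup-++ʳ;
  tabulate-allFin; tabulate-cong; tabulate-∘; lookup∘tabulate; tabulate∘lookup)
open import Data.Vec.Relation.Unary.All using ([]; _∷_) renaming (All to Allⱽ; map to mapⱽ)
open import Function.Base using (_∘_; id; case_of_)
open import Function.Bundles using (_⇔_; _↣_; mk↣; mk⇔; module Equivalence; module Injection; module Inverse)
open import Function.Definitions using (Injective)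
open import Induction.WellFounded using (WellFounded; Acc; acc; module All; module FixPoint)
open import Level using (Level; Lift; lift; lower) renaming (suc to lsuc; _⊔_ to _⊔ˡ_)
open import Relation.Binary.PropositionalEquality using (_≡_; refl; sym; trans; cong; cong₂; subst; subst₂)
open import Relation.Nullary using (Dec; yes; no; does; ¬_)
open import Relation.Nullary.Decidable using (decidable-stable; dec-true)
open import Relation.Unary using (Pred; _∈_; _⊆_)

-- The obstacle is the limit step of the extension property. Rank at least α+1 over a larger set can
-- be obtained by counting, but rank at least a limit must be witnessed at all smaller ordinals by
-- one and the same extension, and extensions found separately need not coincide. This is what the
-- invariant type `t` is for: the extension it defines is fixed before any rank is mentioned, and is
-- then shown to lose none. Stability is available for one type at a time, and it enters only as a
-- bound on the heights of trees of a single formula whose leaves realise that type. Indiscernible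
-- sequences are replaced by coheir sequences: all that is used is that any two increasing pairs
-- have the same type over the model. Types over small sets are handled through realisations, types
-- in infinitely many variables through ultrafilters on the set of tuples.

private variable
  a b c : Level
  k l m n : ℕ

-- Classical logic with Boolean truth values

module Classical (em : ∀ {a} → ExcludedMiddle a) (ext : ∀ {a b} → Extensionality a b) where

  ⌊_⌋ : Set a → Bool
  ⌊ P ⌋ = does (em {P = P})

  ⌊⌋-true : {P : Set a} → P → ⌊ P ⌋ ≡ true
  ⌊⌋-true {P = P} p = dec-true (em {P = P}) p

  ⌊⌋-sound : {P : Set a} → ⌊ P ⌋ ≡ true → P
  ⌊⌋-sound {P = P} e with em {P = P}
  ... | yes p = p
  ... | no _  = case e of λ ()

  stable : {P : Set a} → ¬ ¬ P → P
  stable = decidable-stable em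

  not-true : ∀ {b} → ¬ (b ≡ true) → b ≡ false
  not-true {true}  h = ⊥-elim (h refl)
  not-true {false} h = refl

  false≢true : ∀ {b} → b ≡ false → ¬ (b ≡ true)
  false≢true refl ()

  ¬∀⇒∃¬ : {A : Set a} {P : A → Set b} → ¬ (∀ x → P x) → ∃ λ x → ¬ P x
  ¬∀⇒∃¬ h = stable λ k → h λ x → stable λ np → k (x , np)

  bool-ext : ∀ {x y : Bool} → (x ≡ true → y ≡ true) → (y ≡ true → x ≡ true) → x ≡ y
  bool-ext {true}          f g = sym (f refl)
  bool-ext {false} {true}  f g = g refl
  bool-ext {false} {false} f g = refl

  -- Well-orders, transfinite recursion and comparison of cardinals

  record WellOrder (X : Set a) : Set (lsuc a) where
    infix 4 _<_
    field
      _<_     : X → X → Set a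
      wf      : WellFounded _<_
      total   : ∀ x y → x < y ⊎ x ≡ y ⊎ y < x
      <-trans : ∀ {x y z} → x < y → y < z → x < z

  -- Zermelo: the stages are obtained from ∅ by repeatedly adjoining a chosen
  -- new element and taking unions; they form a chain, and every x is the
  -- element adjoined to the largest stage that omits it.
  module Zermelo (X : Set a) where

    Sub : Set a
    Sub = X → Bool

    infix 4 _∈ˢ_ _∉ˢ_ _⊆ˢ_

    _∈ˢ_ _∉ˢ_ : X → Sub → Set
    x ∈ˢ A = A x ≡ true
    x ∉ˢ A = ¬ (x ∈ˢ A)

    _⊆ˢ_ : Sub → Sub → Set a
    A ⊆ˢ B = ∀ x → x ∈ˢ A → x ∈ˢ B

    -- Excluded middle decides the Σ-type itself, so a positive answer carries a witness that
    -- depends on `A` alone: this is the choice function.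
    IsNext : Sub → X → Set a
    IsNext A x with em {P = ∃ (_∉ˢ A)}
    ... | yes (y , _) = x ≡ y
    ... | no _        = Lift a ⊥

    next-unique : ∀ {A x y} → IsNext A x → IsNext A y → x ≡ y
    next-unique {A} p q with em {P = ∃ (_∉ˢ A)}
    ... | yes _ = trans p (sym q)
    ... | no _  = ⊥-elim (lower p)

    next-exists : ∀ {A x} → x ∉ˢ A → ∃ λ y → IsNext A y × y ∉ˢ A
    next-exists {A} x∉A with em {P = ∃ (_∉ˢ A)}
    ... | yes (y , y∉A) = y , refl , y∉A
    ... | no h          = ⊥-elim (h (_ , x∉A))

    grow : Sub → Sub
    grow A x = ⌊ (x ∈ˢ A ⊎ IsNext A x) ⌋

    ⋃ : (Sub → Bool) → Sub
    ⋃ F x = ⌊ (∃ λ A → F A ≡ true × x ∈ˢ A) ⌋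

    data Stage : Sub → Set a where
      stage-grow : ∀ {A} → Stage A → Stage (grow A)
      stage-⋃    : (F : Sub → Bool) → (∀ A → F A ≡ true → Stage A) → Stage (⋃ F)

    ⊆-grow : ∀ {A} → A ⊆ˢ grow A
    ⊆-grow x x∈A = ⌊⌋-true (inj₁ x∈A)

    Comparable : Sub → Set a
    Comparable C = ∀ {A} → Stage A → A ⊆ˢ C ⊎ C ⊆ˢ A

    grow-⊆ : ∀ {A B x} → IsNext A x → x ∈ˢ B → A ⊆ˢ B → grow A ⊆ˢ B
    grow-⊆ {B = B} nx x∈B A⊆B y y∈ with ⌊⌋-sound y∈
    ... | inj₁ y∈A = A⊆B y y∈A
    ... | inj₂ ny  = subst (_∈ˢ B) (next-unique nx ny) x∈B

    ⊆-split : ∀ A B → A ⊆ˢ B ⊎ ∃ λ x → x ∈ˢ A × x ∉ˢ B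
    ⊆-split A B with em {P = ∃ λ x → x ∈ˢ A × x ∉ˢ B}
    ... | yes p = inj₂ p
    ... | no h  = inj₁ λ x x∈A → stable λ x∉B → h (x , x∈A , x∉B)

    sandwich : ∀ {A C} → A ⊆ˢ C → ¬ (C ⊆ˢ A) → C ⊆ˢ grow A → grow A ⊆ˢ C
    sandwich {A} {C} A⊆C C⊈A C⊆gA with ⊆-split C A
    ... | inj₁ C⊆A = ⊥-elim (C⊈A C⊆A)
    ... | inj₂ (x , x∈C , x∉A) with ⌊⌋-sound (C⊆gA x x∈C)
    ...   | inj₁ x∈A = ⊥-elim (x∉A x∈A)
    ...   | inj₂ nx  = grow-⊆ nx x∈C A⊆C

    ⊆-antisym : ∀ {A C} → A ⊆ˢ C → C ⊆ˢ A → A ≡ C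
    ⊆-antisym A⊆C C⊆A = ext λ x → bool-ext (A⊆C x) (C⊆A x)

    -- Since `grow` adds at most one element, a comparable `C` caught between `A` and `grow A`
    -- equals one of the two.
    dichotomy : ∀ {C} → Comparable C → ∀ {A} → Stage A → A ⊆ˢ C ⊎ grow C ⊆ˢ A
    dichotomy {C} cmp (stage-grow {A} sA) with dichotomy cmp sA
    ... | inj₂ gC⊆A = inj₂ λ x x∈ → ⊆-grow x (gC⊆A x x∈)
    ... | inj₁ A⊆C with em {P = C ⊆ˢ A}
    ...   | yes C⊆A = inj₂ (subst (λ D → grow C ⊆ˢ grow D) (⊆-antisym C⊆A A⊆C) λ x → id)
    ...   | no C⊈A with cmp (stage-grow sA)
    ...     | inj₁ gA⊆C = inj₁ gA⊆C
    ...     | inj₂ C⊆gA = inj₁ (sandwich A⊆C C⊈A C⊆gA)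
    dichotomy {C} cmp (stage-⋃ F sF) with em {P = ∃ λ A → F A ≡ true × grow C ⊆ˢ A}
    ... | yes (A , FA , gC⊆A) = inj₂ λ x x∈ → ⌊⌋-true (A , FA , gC⊆A x x∈)
    ... | no h = inj₁ λ x x∈ → let (A , FA , x∈A) = ⌊⌋-sound x∈ in
      [ (λ A⊆C → A⊆C x x∈A) , (λ gC⊆A → ⊥-elim (h (A , FA , gC⊆A))) ]′ (dichotomy cmp (sF A FA))

    comparable : ∀ {C} → Stage C → Comparable C
    comparable (stage-grow sC) sA with dichotomy (comparable sC) sA
    ... | inj₁ A⊆C  = inj₁ λ x x∈ → ⊆-grow x (A⊆C x x∈)
    ... | inj₂ gC⊆A = inj₂ gC⊆A
    comparable (stage-⋃ F sF) {A} sA with em {P = ∃ λ C → F C ≡ true × A ⊆ˢ C}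
    ... | yes (C , FC , A⊆C) = inj₁ λ x x∈ → ⌊⌋-true (C , FC , A⊆C x x∈)
    ... | no h = inj₂ λ x x∈ → let (C , FC , x∈C) = ⌊⌋-sound x∈ in
      [ (λ A⊆C → ⊥-elim (h (C , FC , A⊆C))) , (λ C⊆A → C⊆A x x∈C) ]′ (comparable (sF C FC) sA)

    below : X → Sub
    below x = ⋃ λ A → ⌊ (Stage A × x ∉ˢ A) ⌋

    below-stage : ∀ x → Stage (below x)
    below-stage x = stage-⋃ _ λ A e → proj₁ (⌊⌋-sound e)

    below-omits : ∀ x → x ∉ˢ below x
    below-omits x x∈ = let (A , e , x∈A) = ⌊⌋-sound x∈ in proj₂ (⌊⌋-sound e) x∈A

    below-largest : ∀ {A x} → Stage A → x ∉ˢ A → A ⊆ˢ below x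
    below-largest {A} sA x∉A y y∈A = ⌊⌋-true (A , ⌊⌋-true (sA , x∉A) , y∈A)

    below-least : ∀ {A x} → Stage A → x ∈ˢ A → below x ⊆ˢ A
    below-least {A} {x} sA x∈A with comparable (below-stage x) sA
    ... | inj₁ A⊆b = ⊥-elim (below-omits x (A⊆b x x∈A))
    ... | inj₂ b⊆A = b⊆A

    next-below : ∀ x → IsNext (below x) x
    next-below x with em {P = x ∈ˢ grow (below x)}
    ... | yes x∈ = [ (λ x∈b → ⊥-elim (below-omits x x∈b)) , id ]′ (⌊⌋-sound x∈)
    ... | no x∉  = let (y , ny , y∉) = next-exists (below-omits x) in
      ⊥-elim (y∉ (below-largest (stage-grow (below-stage x)) x∉ y (⌊⌋-true (inj₂ ny))))

    -- For the element `x` that `grow A` adds, `below x` is contained in `A`, so all predecessors of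
    -- `x` are accessible by induction on the stage.
    accessible : ∀ {A} → Stage A → ∀ {x} → x ∈ˢ A → Acc (λ y z → Lift a (y ∈ˢ below z)) x
    accessible (stage-grow {A} sA) {x} x∈ with em {P = x ∈ˢ A}
    ... | yes x∈A = accessible sA x∈A
    ... | no x∉A with dichotomy (comparable sA) (below-stage x)
    ...   | inj₁ b⊆A  = acc λ {y} y<x → accessible sA (b⊆A y (lower y<x))
    ...   | inj₂ gA⊆b = ⊥-elim (below-omits x (gA⊆b x x∈))
    accessible (stage-⋃ F sF) x∈ = let (A , FA , x∈A) = ⌊⌋-sound x∈ in accessible (sF A FA) x∈A

    wellOrder : WellOrder X
    wellOrder = record
      { _<_     = λ x y → Lift a (x ∈ˢ below y)
      ; wf      = λ x → accessible (stage-grow (below-stage x)) (⌊⌋-true (inj₂ (next-below x)))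
      ; total   = tot
      ; <-trans = λ { {x} {y} {z} (lift x<y) (lift y<z) →
                      lift (below-least (below-stage z) y<z x x<y) }
      }
      where
      tot : ∀ x y → Lift a (x ∈ˢ below y) ⊎ x ≡ y ⊎ Lift a (y ∈ˢ below x)
      tot x y with em {P = x ∈ˢ below y} | em {P = y ∈ˢ below x}
      ... | yes p | _     = inj₁ (lift p)
      ... | no _  | yes q = inj₂ (inj₂ (lift q))
      ... | no p  | no q  = inj₂ (inj₁ (next-unique (next-below x)
        (subst (λ A → IsNext A y) (⊆-antisym (below-largest (below-stage y) p)
                                             (below-largest (below-stage x) q))
               (next-below y))))

  abstract
    wellOrder : (X : Set a) → WellOrder X
    wellOrder X = Zermelo.wellOrder X

  -- Well-founded recursion in a form in which the recursive values come as a
  -- total function whose values outside the initial segment are arbitrary.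
  module Recursion {X : Set a} (W : WellOrder X) {Y : Set b} (y₀ : Y) (F : X → (X → Y) → Y) where

    open WellOrder W

    restrict : (x : X) → (∀ {z} → z < x → Y) → X → Y
    restrict x rec z with em {P = z < x}
    ... | yes z<x = rec z<x
    ... | no _    = y₀

    private
      step : ∀ x → (∀ {z} → z < x → Y) → Y
      step x rec = F x (restrict x rec)

      step-ext : (x : X) {r s : ∀ {z} → z < x → Y} → (∀ {z} z<x → r {z} z<x ≡ s z<x) →
                 step x r ≡ step x s
      step-ext x {r} {s} h = cong (F x) (ext λ z → lem z)
        where
        lem : ∀ z → restrict x r z ≡ restrict x s z
        lem z with em {P = z < x}
        ... | yes z<x = h z<x
        ... | no _    = refl

    fix : X → Y
    fix = All.wfRec wf _ (λ _ → Y) step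

    fix-below : X → X → Y
    fix-below x = restrict x λ {z} _ → fix z

    fix-unfold : ∀ x → fix x ≡ F x (fix-below x)
    fix-unfold x = FixPoint.unfold-wfRec wf (λ _ → Y) step step-ext

    fix-below-≡ : ∀ {x z} → z < x → fix-below x z ≡ fix z
    fix-below-≡ {x} {z} z<x with em {P = z < x}
    ... | yes _ = refl
    ... | no h  = ⊥-elim (h z<x)

  module _ {X : Set a} (W : WellOrder X) where
    open WellOrder W

    <-irrefl : ∀ {x} → ¬ (x < x)
    <-irrefl {x} = go (wf x)
      where
      go : ∀ {x} → Acc _<_ x → ¬ (x < x)
      go (acc rs) x<x = go (rs x<x) x<x

    injective-if-increasing : {Y : Set b} (f : X → Y) → (∀ {x y} → x < y → ¬ (f x ≡ f y)) →
                              Injective _≡_ _≡_ f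
    injective-if-increasing f h {x} {y} e with total x y
    ... | inj₁ x<y        = ⊥-elim (h x<y e)
    ... | inj₂ (inj₁ x≡y) = x≡y
    ... | inj₂ (inj₂ y<x) = ⊥-elim (h y<x (sym e))

    list-max : {Q : X → Set c} → ∀ {x xs} → Q x → All Q xs →
               ∃ λ m → Q m × All (λ y → y ≡ m ⊎ y < m) (x ∷ xs)
    list-max {x = x} q [] = x , q , inj₁ refl ∷ []
    list-max {x = x} q (r ∷ rs) with list-max r rs
    ... | m , qm , ≤m with total x m
    ...   | inj₁ x<m        = m , qm , inj₂ x<m ∷ ≤m
    ...   | inj₂ (inj₁ x≡m) = m , qm , inj₁ x≡m ∷ ≤m
    ...   | inj₂ (inj₂ m<x) = x , q , inj₁ refl ∷
      mapᴬ [ (λ { refl → inj₂ m<x }) , (λ y<m → inj₂ (<-trans y<m m<x)) ]′ ≤m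

  inject : {X : Set a} {Y : Set b} (f : X → Y) → (∀ {x y} → f x ≡ f y → x ≡ y) → X ↣ Y
  inject f h = mk↣ h

  section : {X : Set a} {Y : Set b} (f : X → Y) → (∀ y → ∃ λ x → f x ≡ y) → Y ↣ X
  section f h = inject (λ y → proj₁ (h y)) λ {x} {y} e →
    trans (sym (proj₂ (h x))) (trans (cong f e) (proj₂ (h y)))

  module Greedy {X : Set a} {Y : Set b} (y₀ : Y) where
    private W = wellOrder X
    open WellOrder W

    Fresh : X → (X → Y) → Set (a ⊔ˡ b)
    Fresh x g = ∃ λ y → ∀ z → z < x → ¬ (g z ≡ y)

    pick : X → (X → Y) → Y
    pick x g with em {P = Fresh x g}
    ... | yes (y , _) = y
    ... | no _        = y₀

    pick-fresh : ∀ {x g} → Fresh x g → ∀ z → z < x → ¬ (g z ≡ pick x g)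
    pick-fresh {x} {g} fr with em {P = Fresh x g}
    ... | yes (_ , h) = h
    ... | no h        = ⊥-elim (h fr)

    open Recursion W y₀ pick

    comparable : X ↣ Y ⊎ Y ↣ X
    comparable with em {P = ∀ x → Fresh x (fix-below x)}
    ... | yes fr = inj₁ (inject fix (injective-if-increasing W fix λ {x} {y} x<y e →
      pick-fresh (fr y) x x<y (trans (fix-below-≡ x<y) (trans e (fix-unfold y)))))
    ... | no h = let (x , stuck) = ¬∀⇒∃¬ h in inj₂ (section (fix-below x) λ y →
      stable λ k → stuck (y , λ z z<x e → k (z , e)))

  comparability : (X : Set a) (Y : Set b) → X ↣ Y ⊎ Y ↣ X
  comparability X Y with em {P = Y}
  ... | yes y₀ = Greedy.comparable y₀
  ... | no ¬y  = inj₂ (inject (λ y → ⊥-elim (¬y y)) λ {y} → ⊥-elim (¬y y))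

  cantor : {X : Set a} → ¬ ((X → Bool) ↣ X)
  cantor {X = X} i = contra (bool-cases (d (to d)))
    where
    open Injection i using (to; injective)
    d : X → Bool
    d x = ⌊ (∃ λ f → to f ≡ x × f x ≡ false) ⌋
    bool-cases : ∀ b → b ≡ true ⊎ b ≡ false
    bool-cases true  = inj₁ refl
    bool-cases false = inj₂ refl
    contra : ¬ (d (to d) ≡ true ⊎ d (to d) ≡ false)
    contra (inj₁ t) = let (f , e , q) = ⌊⌋-sound t in
      false≢true q (subst (λ g → g (to d) ≡ true) (sym (injective e)) t)
    contra (inj₂ q) = false≢true q (⌊⌋-true (d , refl , q))

  -- Ultrafilters

  ∧-true : ∀ {x y} → x ≡ true → y ≡ true → x ∧ᵇ y ≡ true
  ∧-true refl refl = refl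

  ∧-trueˡ : ∀ {x y} → x ∧ᵇ y ≡ true → x ≡ true
  ∧-trueˡ {true} e = refl

  ∧-trueʳ : ∀ {x y} → x ∧ᵇ y ≡ true → y ≡ true
  ∧-trueʳ {true} e = e

  not-true⁻ : ∀ {x} → not x ≡ true → ¬ (x ≡ true)
  not-true⁻ e refl = case e of λ ()

  not-true⁺ : ∀ {x} → ¬ (x ≡ true) → not x ≡ true
  not-true⁺ {true}  h = ⊥-elim (h refl)
  not-true⁺ {false} h = refl

  -- Sets are Boolean-valued so that an ultrafilter stays in the universe of `P`; `_∋_` applies it
  -- to propositions of any level.
  record Ultrafilter (P : Set a) : Set a where
    field
      mem       : (P → Bool) → Bool
      mem-mono  : ∀ {A B} → (∀ p → A p ≡ true → B p ≡ true) → mem A ≡ true → mem B ≡ true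
      mem-∩     : ∀ {A B} → mem A ≡ true → mem B ≡ true → mem (λ p → A p ∧ᵇ B p) ≡ true
      mem-split : ∀ A → mem A ≡ true ⊎ mem (not ∘ A) ≡ true
      mem-inh   : ∀ {A} → mem A ≡ true → ∃ λ p → A p ≡ true

  module _ {P : Set a} where

    infix 4 _∋_

    _∋_ : Ultrafilter P → (P → Set b) → Set
    𝒰 ∋ Q = Ultrafilter.mem 𝒰 (λ p → ⌊ Q p ⌋) ≡ true

    module _ (𝒰 : Ultrafilter P) where
      open Ultrafilter 𝒰

      ∋-mono : {Q : P → Set b} {R : P → Set c} → (∀ p → Q p → R p) → 𝒰 ∋ Q → 𝒰 ∋ R
      ∋-mono h = mem-mono λ p e → ⌊⌋-true (h p (⌊⌋-sound e))

      ∋-× : {Q : P → Set b} {R : P → Set c} → 𝒰 ∋ Q → 𝒰 ∋ R → 𝒰 ∋ (λ p → Q p × R p)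
      ∋-× q r = mem-mono (λ p e → ⌊⌋-true (⌊⌋-sound (∧-trueˡ e) , ⌊⌋-sound (∧-trueʳ e))) (mem-∩ q r)

      ∋-inh : {Q : P → Set b} → 𝒰 ∋ Q → ∃ Q
      ∋-inh q = let (p , e) = mem-inh q in p , ⌊⌋-sound e

      ∋-split : (Q : P → Set b) → 𝒰 ∋ Q ⊎ 𝒰 ∋ (λ p → ¬ Q p)
      ∋-split Q with mem-split (λ p → ⌊ Q p ⌋)
      ... | inj₁ q = inj₁ q
      ... | inj₂ q = inj₂ (mem-mono (λ p e → ⌊⌋-true λ x → not-true⁻ e (⌊⌋-true x)) q)

      ∋-¬ : {Q : P → Set b} → 𝒰 ∋ (λ p → ¬ Q p) → ¬ (𝒰 ∋ Q)
      ∋-¬ n q = let (_ , x , y) = ∋-inh (∋-× n q) in x y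

      ∋-¬⁺ : {Q : P → Set b} → ¬ (𝒰 ∋ Q) → 𝒰 ∋ (λ p → ¬ Q p)
      ∋-¬⁺ {Q = Q} n = [ (λ q → ⊥-elim (n q)) , id ]′ (∋-split Q)

      ∋-all : {Q : P → Set b} → (∀ p → Q p) → 𝒰 ∋ Q
      ∋-all {Q = Q} h = [ id , (λ n → let (p , x) = ∋-inh n in ⊥-elim (x (h p))) ]′ (∋-split Q)

      ∋-All : {I : Set c} {Q : I → P → Set b} {L : List I} → All (λ i → 𝒰 ∋ Q i) L →
              𝒰 ∋ (λ p → All (λ i → Q i p) L)
      ∋-All []       = ∋-all λ _ → []
      ∋-All (q ∷ qs) = ∋-mono (λ _ (x , xs) → x ∷ xs) (∋-× q (∋-All qs))

  -- Partition regularity without closure under intersection: enough for an ultrafilter all of whose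
  -- members are large. It is used for inhabited sets and for sets carrying trees of every height.
  record IsLargeness {P : Set a} (Large : (P → Bool) → Set b) : Set (a ⊔ˡ b) where
    field
      large-mono  : ∀ {A B} → (∀ p → A p ≡ true → B p ≡ true) → Large A → Large B
      large-split : ∀ {A} (B : P → Bool) → Large A → Large (λ p → A p ∧ᵇ B p) ⊎ Large (λ p → A p ∧ᵇ not (B p))
      large-inh   : ∀ {A} → Large A → ∃ λ p → A p ≡ true

  module UltrafilterLemma {P : Set a} {Large : (P → Bool) → Set b} (isL : IsLargeness Large)
                          {I : Set c} {g : Level} (G : I → P → Set g)
                          (base : ∀ L → Large (λ p → ⌊ All (λ i → G i p) L ⌋)) where

    open IsLargeness isL
    private W = wellOrder (P → Bool)
    open WellOrder W

    meet : List I → List (P → Bool) → P → Bool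
    meet L M p = ⌊ (All (λ i → G i p) L × All (λ A → A p ≡ true) M) ⌋

    Ok : (P → Bool) → ((P → Bool) → Bool) → Set _
    Ok A m = ∀ L M → All (λ B → B < A × m B ≡ true) M → Large (λ p → meet L M p ∧ᵇ A p)

    open Recursion W false (λ A m → ⌊ Ok A m ⌋)

    -- The sets are treated one after the other; one is accepted when this
    -- keeps all finite intersections large.
    Accepted : (P → Bool) → Set
    Accepted A = fix A ≡ true

    accepted⇒ok : ∀ {A} → Accepted A → Ok A fix
    accepted⇒ok {A} q L M hM = ⌊⌋-sound (trans (sym (fix-unfold A)) q) L M
      (mapᴬ (λ (lt , m) → lt , trans (fix-below-≡ lt) m) hM)

    ok⇒accepted : ∀ {A} → Ok A fix → Accepted A
    ok⇒accepted {A} ok = trans (fix-unfold A) (⌊⌋-true λ L M hM → ok L M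
      (mapᴬ (λ (lt , m) → lt , trans (sym (fix-below-≡ lt)) m) hM))

    remove-max : ∀ {m M} → All (λ B → B ≡ m ⊎ B < m) M → All Accepted M →
                 ∃ λ M′ → All (λ B → B < m × Accepted B) M′ ×
                          (∀ p → All (λ A → A p ≡ true) M′ → m p ≡ true → All (λ A → A p ≡ true) M)
    remove-max [] [] = [] , [] , λ _ _ _ → []
    remove-max (h ∷ hs) (a ∷ as) with remove-max hs as | h
    ... | M′ , acc′ , back | inj₁ refl = M′ , acc′ , λ p q e → e ∷ back p q e
    ... | M′ , acc′ , back | inj₂ lt   = _ ∷ M′ , (lt , a) ∷ acc′ ,
                                         λ { p (q ∷ qs) e → q ∷ back p qs e }

    -- The acceptance of the member that is last in the well-order already took care of all finite
    -- meets of sets accepted earlier.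
    meet-large : ∀ L M → All Accepted M → Large (meet L M)
    meet-large L [] [] = large-mono (λ p e → ⌊⌋-true (⌊⌋-sound e , [])) (base L)
    meet-large L (A ∷ M) (a ∷ as) with list-max W a as
    ... | m , m-acc , ≤m with remove-max ≤m (a ∷ as)
    ...   | M′ , acc′ , back = large-mono (λ p e → ⌊⌋-true (lem p (⌊⌋-sound (∧-trueˡ e)) (∧-trueʳ e)))
                                          (accepted⇒ok m-acc L M′ acc′)
      where
      lem : ∀ p → All (λ i → G i p) L × All (λ A → A p ≡ true) M′ → m p ≡ true →
            All (λ i → G i p) L × All (λ A → A p ≡ true) (A ∷ M)
      lem p (l , q) e = l , back p q e

    Refuted : (P → Bool) → Set _
    Refuted A = ∃ λ L → ∃ λ M → All Accepted M × ¬ Large (λ p → meet L M p ∧ᵇ A p)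

    rejected⇒refuted : ∀ {A} → ¬ Accepted A → Refuted A
    rejected⇒refuted {A} n = stable λ k → n (ok⇒accepted λ L M hM → stable λ nl →
      k (L , M , mapᴬ proj₂ hM , nl))

    meet-++ˡ : ∀ L₁ {L₂} M₁ {M₂ p} → meet (L₁ ++ᴸ L₂) (M₁ ++ᴸ M₂) p ≡ true → meet L₁ M₁ p ≡ true
    meet-++ˡ L₁ M₁ e = let (l , m) = ⌊⌋-sound e in ⌊⌋-true (++⁻ˡ L₁ l , ++⁻ˡ M₁ m)

    meet-++ʳ : ∀ L₁ {L₂} M₁ {M₂ p} → meet (L₁ ++ᴸ L₂) (M₁ ++ᴸ M₂) p ≡ true → meet L₂ M₂ p ≡ true
    meet-++ʳ L₁ M₁ e = let (l , m) = ⌊⌋-sound e in ⌊⌋-true (++⁻ʳ L₁ l , ++⁻ʳ M₁ m)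

    -- If both halves were rejected, the two refuting lists could be merged; their meet is large, so
    -- one half of it is large, against one of the refutations.
    accepted-split : ∀ A → Accepted A ⊎ Accepted (not ∘ A)
    accepted-split A with em {P = Accepted A} | em {P = Accepted (not ∘ A)}
    ... | yes y | _     = inj₁ y
    ... | no _  | yes y = inj₂ y
    ... | no n₁ | no n₂ with rejected⇒refuted n₁ | rejected⇒refuted n₂
    ...   | L₁ , M₁ , a₁ , r₁ | L₂ , M₂ , a₂ , r₂
      with large-split A (meet-large (L₁ ++ᴸ L₂) (M₁ ++ᴸ M₂) (++⁺ a₁ a₂))
    ...     | inj₁ l = ⊥-elim (r₁ (large-mono (λ p e → ∧-true (meet-++ˡ L₁ M₁ (∧-trueˡ e)) (∧-trueʳ e)) l))
    ...     | inj₂ l = ⊥-elim (r₂ (large-mono (λ p e → ∧-true (meet-++ʳ L₁ M₁ (∧-trueˡ e)) (∧-trueʳ e)) l))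

    accepted-inh : ∀ {A B} → Accepted A → Accepted B → ∃ λ p → A p ≡ true × B p ≡ true
    accepted-inh a b with large-inh (meet-large [] (_ ∷ _ ∷ []) (a ∷ b ∷ []))
    ... | p , e with proj₂ (⌊⌋-sound e)
    ...   | x ∷ y ∷ [] = p , x , y

    accepted-by : ∀ {A} → (Accepted (not ∘ A) → ⊥) → Accepted A
    accepted-by {A} h = [ id , (λ n → ⊥-elim (h n)) ]′ (accepted-split A)

    ultrafilter : Ultrafilter P
    ultrafilter = record
      { mem       = fix
      ; mem-mono  = λ h a → accepted-by λ n → let (p , x , y) = accepted-inh a n in not-true⁻ y (h p x)
      ; mem-∩     = λ a b → accepted-by λ n → inter a b n
      ; mem-split = accepted-split
      ; mem-inh   = λ a → let (p , x , _) = accepted-inh a a in p , x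
      }
      where
      inter : ∀ {A B} → Accepted A → Accepted B → Accepted (λ p → not (A p ∧ᵇ B p)) → ⊥
      inter a b n with large-inh (meet-large [] (_ ∷ _ ∷ _ ∷ []) (a ∷ b ∷ n ∷ []))
      ... | p , e with proj₂ (⌊⌋-sound e)
      ...   | x ∷ y ∷ z ∷ [] = not-true⁻ z (∧-true x y)

    ultrafilter-∋ : ∀ i → ultrafilter ∋ G i
    ultrafilter-∋ i = accepted-by λ n → clash (large-inh (meet-large (i ∷ []) (_ ∷ []) (n ∷ [])))
      where
      clash : (∃ λ p → meet (i ∷ []) ((λ p → not ⌊ G i p ⌋) ∷ []) p ≡ true) → ⊥
      clash (p , e) with ⌊⌋-sound e
      ... | g ∷ [] , z ∷ [] = not-true⁻ z (⌊⌋-true g)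

    ultrafilter-large : ∀ {A} → Ultrafilter.mem ultrafilter A ≡ true → Large A
    ultrafilter-large a = large-mono (λ p e → lem p (⌊⌋-sound e)) (meet-large [] (_ ∷ []) (a ∷ []))
      where
      lem : ∀ p {A} → All (λ i → G i p) [] × All (λ B → B p ≡ true) (A ∷ []) → A p ≡ true
      lem p (_ , e ∷ []) = e

  inhabited-isLargeness : {P : Set a} → IsLargeness {P = P} (λ A → ∃ λ p → A p ≡ true)
  inhabited-isLargeness {P = P} = record
    { large-mono  = λ h (p , e) → p , h p e
    ; large-split = λ {A} B (p , e) → split A B p e
    ; large-inh   = id
    }
    where
    split : ∀ (A B : P → Bool) p → A p ≡ true →
            (∃ λ p → A p ∧ᵇ B p ≡ true) ⊎ (∃ λ p → A p ∧ᵇ not (B p) ≡ true)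
    split A B p e with B p in q
    ... | true  = inj₁ (p , ∧-true e q)
    ... | false = inj₂ (p , ∧-true e (not-true⁺ (false≢true q)))

  module _ {P : Set a} {I : Set c} {g : Level} (G : I → P → Set g)
           (fip : ∀ L → ∃ λ p → All (λ i → G i p) L) where

    fip⇒ultrafilter : Σ[ 𝒰 ∈ Ultrafilter P ] ∀ i → 𝒰 ∋ G i
    fip⇒ultrafilter = ultrafilter , ultrafilter-∋
      where
      base : ∀ L → ∃ λ p → ⌊ All (λ i → G i p) L ⌋ ≡ true
      base L = let (p , h) = fip L in p , ⌊⌋-true h
      open UltrafilterLemma inhabited-isLargeness G base

  -- Cardinal arithmetic below the inaccessible cardinal

  module Smallness {ℓ : Level} {κ : Set ℓ} (inacc : StronglyInaccessible κ) where

    open StronglyInaccessible inacc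
    open Injection

    _↣-∘_ : {X : Set a} {Y : Set b} {Z : Set c} → X ↣ Y → Y ↣ Z → X ↣ Z
    f ↣-∘ g = inject (λ x → to g (to f x)) λ e → injective f (injective g e)

    ↣-small : {X : Set a} {Y : Set b} → Y ↣ X → X ≺ κ → Y ≺ κ
    ↣-small i (j , n) = (i ↣-∘ j) , λ k → n (k ↣-∘ i)

    surj-small : {X : Set a} {Y : Set b} (f : X → Y) → (∀ y → ∃ λ x → f x ≡ y) → X ≺ κ → Y ≺ κ
    surj-small f h = ↣-small (section f h)

    Lift-small : {X : Set a} → X ≺ κ → Lift b X ≺ κ
    Lift-small = ↣-small (inject lower λ { {lift _} {lift _} refl → refl })

    ℕ-small : ℕ ≺ κ
    ℕ-small = uncountable

    Fin-small : ∀ {n} → Fin n ≺ κ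
    Fin-small = ↣-small (inject toℕ toℕ-injective) ℕ-small

    Bool-small : Bool ≺ κ
    Bool-small = ↣-small (inject (λ { true → 1 ; false → 0 })
      λ { {true} {true} _ → refl ; {false} {false} _ → refl
        ; {true} {false} () ; {false} {true} () }) ℕ-small

    Σ-small : {I : Set ℓ} {X : I → Set ℓ} → I ≺ κ → (∀ i → X i ≺ κ) → Σ I X ≺ κ
    Σ-small i x = regular _ _ i x

    Σℕ-small : {X : ℕ → Set ℓ} → (∀ i → X i ≺ κ) → Σ ℕ X ≺ κ
    Σℕ-small x = surj-small {X = Σ (Lift ℓ ℕ) _} (λ (i , y) → lower i , y)
      (λ (i , y) → (lift i , y) , refl) (Σ-small (Lift-small ℕ-small) (λ i → x (lower i)))

    ×-small : {X Y : Set ℓ} → X ≺ κ → Y ≺ κ → (X × Y) ≺ κ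
    ×-small x y = Σ-small x λ _ → y

    ⊎-small : {X Y : Set ℓ} → X ≺ κ → Y ≺ κ → (X ⊎ Y) ≺ κ
    ⊎-small {X} {Y} x y = surj-small {X = Σ (Lift ℓ Bool) λ { (lift true) → X ; (lift false) → Y }}
      (λ { (lift true , x) → inj₁ x ; (lift false , y) → inj₂ y })
      (λ { (inj₁ x) → (lift true , x) , refl ; (inj₂ y) → (lift false , y) , refl })
      (Σ-small (Lift-small Bool-small) λ { (lift true) → x ; (lift false) → y })

    Vec-small : {X : Set ℓ} → X ≺ κ → ∀ n → Vec X n ≺ κ
    Vec-small x zero    = surj-small {X = Fin 1} (λ _ → []) (λ { [] → Fin.zero , refl }) Fin-small
    Vec-small x (suc n) = surj-small (λ (y , ys) → y ∷ ys) (λ { (y ∷ ys) → (y , ys) , refl })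
      (×-small x (Vec-small x n))

    pow-small : {X : Set ℓ} → X ≺ κ → (X → Bool) ≺ κ
    pow-small = strongLimit _

  -- Of the 2^2^κ indices, a family that separates them has κ distinct members.
  Separated : Set a → Set a
  Separated κ = (κ → Bool) → Bool

  module _ {κ : Set a} {X : Set b} (val : X → Separated κ → Bool)
           (sep : ∀ {i j} → ¬ (i ≡ j) → ∃ λ x → ¬ (val x i ≡ val x j)) where

    private
      -- Being a row is a Boolean condition, so rows are equal when their functions are, and `Row`
      -- lives in the universe of `κ` whatever that of `X`.
      Row : Set a
      Row = Σ (Separated κ → Bool) λ v → ⌊ (∃ λ x → val x ≡ v) ⌋ ≡ true

      row-≡ : {r s : Row} → proj₁ r ≡ proj₁ s → r ≡ s
      row-≡ {v , p} {_ , q} refl = cong (v ,_) (uip p q)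

      -- With at most `κ` rows an index would be determined by its column, a subset of `κ`, so that
      -- 2^2^κ would inject into 2^κ.
      few : ¬ (Row ↣ κ)
      few f = cantor (inject column λ {i} {j} e → stable λ i≢j →
        let (x , d) = sep i≢j
            r       = val x , ⌊⌋-true (x , refl)
        in d (trans (sym (column-to i r)) (trans (cong (λ c → c (to r)) e) (column-to j r))))
        where
        open Injection f using (to; injective)
        column : Separated κ → κ → Bool
        column i k = ⌊ (∃ λ r → to r ≡ k × proj₁ r i ≡ true) ⌋
        column-to : ∀ i r → column i (to r) ≡ proj₁ r i
        column-to i r = bool-ext
          (λ e → let (s , p , q) = ⌊⌋-sound e in subst (λ s → proj₁ s i ≡ true) (injective p) q)
          (λ e → ⌊⌋-true (r , refl , e))

    many-distinct : ∃ λ (g : κ → X) → ∀ {k l} → val (g k) ≡ val (g l) → k ≡ l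
    many-distinct with comparability κ Row
    ... | inj₂ f = ⊥-elim (few f)
    ... | inj₁ f = (λ k → proj₁ (choose k)) , λ {k} {l} e → injective (row-≡
        (trans (sym (proj₂ (choose k))) (trans e (proj₂ (choose l)))))
      where
      open Injection f using (to; injective)
      choose : ∀ k → ∃ λ x → val x ≡ proj₁ (to k)
      choose k = ⌊⌋-sound (proj₂ (to k))

  -- Binary trees and ladders of a relation

  module Tree {A Z : Set a} (ρ : A → Z → Set a) where

    -- Full binary trees of height n with nodes in Q and leaves in P: the
    -- leaves to the left of a node z satisfy ρ _ z, those to the right do not.
    Tr : ℕ → (A → Set a) → (Z → Set a) → Set a
    Tr zero    P Q = ∃ P
    Tr (suc n) P Q = ∃ λ z → Q z × Tr n (λ x → P x × ρ x z) Q × Tr n (λ x → P x × ¬ ρ x z) Q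

    tr-mono : ∀ n {P P′ Q Q′} → (∀ x → P x → P′ x) → (∀ z → Q z → Q′ z) → Tr n P Q → Tr n P′ Q′
    tr-mono zero    f g (x , p) = x , f x p
    tr-mono (suc n) f g (z , q , l , r) = z , g z q , tr-mono n (λ x (p , s) → f x p , s) g l ,
                                                      tr-mono n (λ x (p , s) → f x p , s) g r

    tr-leaf : ∀ n {P Q} → Tr n P Q → ∃ P
    tr-leaf zero    t = t
    tr-leaf (suc n) (z , _ , l , _) = let (x , p , _) = tr-leaf n l in x , p

    tr-lower : ∀ m n {P Q} → Tr (m + n) P Q → Tr n P Q
    tr-lower zero    n t = t
    tr-lower (suc m) n (z , _ , l , _) = tr-mono n (λ _ → proj₁) (λ _ → id) (tr-lower m n l)

    tr-lowerʳ : ∀ m n {P Q} → Tr (m + n) P Q → Tr m P Q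
    tr-lowerʳ zero    n t = tr-leaf n t
    tr-lowerʳ (suc m) n (z , q , l , r) = z , q , tr-lowerʳ m n l , tr-lowerʳ m n r

    -- Pigeonhole for coloured nodes: a root of the first colour tops two subtrees of that colour
    -- unless one side already contains the wanted tree of the second colour; symmetrically for a
    -- root of the second colour.
    tr-nodes : ∀ m n {P Q Q₁ Q₂} → (∀ z → Q z → Q₁ z ⊎ Q₂ z) → Tr (m + n) P Q → Tr m P Q₁ ⊎ Tr n P Q₂
    tr-nodes zero    n       c t = inj₁ (tr-leaf n t)
    tr-nodes (suc m) zero    c t = inj₂ (tr-leaf (suc m + zero) t)
    tr-nodes (suc m) (suc n) {P} {Q} c (z , q , l , r) with c z q
    ... | inj₁ q₁ with tr-nodes m (suc n) c l | tr-nodes m (suc n) c r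
    ...   | inj₁ l′ | inj₁ r′ = inj₁ (z , q₁ , l′ , r′)
    ...   | inj₂ l′ | _       = inj₂ (tr-mono (suc n) (λ _ → proj₁) (λ _ → id) l′)
    ...   | inj₁ _  | inj₂ r′ = inj₂ (tr-mono (suc n) (λ _ → proj₁) (λ _ → id) r′)
    tr-nodes (suc m) (suc n) {P} {Q} c (z , q , l , r) | inj₂ q₂
      with tr-nodes (suc m) n c (subst (λ h → Tr h (λ x → P x × ρ x z) Q) (+-suc m n) l)
         | tr-nodes (suc m) n c (subst (λ h → Tr h (λ x → P x × ¬ ρ x z) Q) (+-suc m n) r)
    ...   | inj₂ l′ | inj₂ r′ = inj₂ (z , q₂ , l′ , r′)
    ...   | inj₁ l′ | _       = inj₁ (tr-mono (suc m) (λ _ → proj₁) (λ _ → id) l′)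
    ...   | inj₂ _  | inj₁ r′ = inj₁ (tr-mono (suc m) (λ _ → proj₁) (λ _ → id) r′)

    -- Pigeonhole for coloured leaves: if both sides yield the first colour, the root joins them;
    -- otherwise one side already yields the full height in the second colour.
    tr-leaves : ∀ m n {P P₁ P₂ Q} → (∀ x → P x → P₁ x ⊎ P₂ x) → Tr (m + n) P Q → Tr m P₁ Q ⊎ Tr n P₂ Q
    tr-leaves zero n {P} {P₁} c t with em {P = ∃ P₁}
    ... | yes p = inj₁ p
    ... | no h  = inj₂ (tr-mono n (λ x p → [ (λ p₁ → ⊥-elim (h (x , p₁))) , id ]′ (c x p)) (λ _ → id) t)
    tr-leaves (suc m) n c (z , q , l , r)
      with tr-leaves m n (λ x (p , s) → [ (λ p₁ → inj₁ (p₁ , s)) , (λ p₂ → inj₂ (p₂ , s)) ]′ (c x p)) l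
         | tr-leaves m n (λ x (p , s) → [ (λ p₁ → inj₁ (p₁ , s)) , (λ p₂ → inj₂ (p₂ , s)) ]′ (c x p)) r
    ... | inj₁ l′ | inj₁ r′ = inj₁ (z , q , l′ , r′)
    ... | inj₂ l′ | _       = inj₂ (tr-mono n (λ _ → proj₁) (λ _ → id) l′)
    ... | inj₁ _  | inj₂ r′ = inj₂ (tr-mono n (λ _ → proj₁) (λ _ → id) r′)

    -- Sequences e₀, e₁, … in P and b₀, b₁, … in Q with ρ eⱼ bᵢ iff i ≤ j.
    Ladder : ℕ → (A → Set a) → (Z → Set a) → Set a
    Ladder zero    P Q = ⊤
    Ladder (suc k) P Q = ∃ λ e → ∃ λ b → P e × Q b × ρ e b ×
                         Ladder k (λ x → P x × ρ x b) (λ z → Q z × ¬ ρ e z)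

    ladder-mono : ∀ k {P P′ Q Q′} → (∀ x → P x → P′ x) → (∀ z → Q z → Q′ z) → Ladder k P Q → Ladder k P′ Q′
    ladder-mono zero    f g _ = tt
    ladder-mono (suc k) f g (e , b , p , q , s , l) = e , b , f e p , g b q , s ,
      ladder-mono k (λ x (p , t) → f x p , t) (λ z (q , t) → g z q , t) l

    -- The cut is made at the `b` in position `k`: the first `k` of the `e` fail it, those from
    -- position `k` on satisfy it.
    ladder-split : ∀ k l {P Q} → Ladder (k + suc l) P Q → ∃ λ b → Q b ×
                   Ladder k (λ x → P x × ¬ ρ x b) Q × Ladder (suc l) (λ x → P x × ρ x b) Q
    ladder-split zero l (e , b , p , q , s , t) = b , q , tt , e , b , (p , s) , q , s ,
      ladder-mono l (λ x (p , u) → (p , u) , u) (λ _ → id) t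
    ladder-split (suc k) l (e , b , p , q , s , t) =
      let (b′ , (q′ , n) , t₁ , t₂) = ladder-split k l t in
      b′ , q′ , (e , b , (p , n) , q , s , ladder-mono k (λ x ((p , u) , v) → (p , v) , u) (λ _ → id) t₁) ,
      ladder-mono (suc l) (λ x ((p , _) , v) → p , v) (λ _ → proj₁) t₂

    -- Equal to 2ⁿ - 1, so `suc (log⁻¹ n)` is the number of leaves of a tree of height `n`; halving
    -- a ladder of that length repeatedly is a binary search, and its cuts are the nodes.
    log⁻¹ : ℕ → ℕ
    log⁻¹ zero    = zero
    log⁻¹ (suc n) = log⁻¹ n + suc (log⁻¹ n)

    ladder⇒tree : ∀ n {P Q} → Ladder (suc (log⁻¹ n)) P Q → Tr n P Q
    ladder⇒tree zero    (e , _ , p , _) = e , p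
    ladder⇒tree (suc n) t = let (b , q , t₁ , t₂) = ladder-split (suc (log⁻¹ n)) (log⁻¹ n) t in
      b , q , ladder⇒tree n t₂ , ladder⇒tree n t₁

  module _ {A Z : Set a} (ρ : A → Z → Set a) where

    private
      ρᵒ : Z → A → Set a
      ρᵒ z x = ρ x z
      ρⁿ : A → Z → Set a
      ρⁿ x z = ¬ ρ x z
      module T = Tree ρ
      module O = Tree ρᵒ
      module N = Tree ρⁿ

    tree-negate : ∀ n {P Q} → N.Tr n P Q → T.Tr n P Q
    tree-negate zero    t = t
    tree-negate (suc n) (z , q , l , r) = z , q ,
      T.tr-mono n (λ x (p , s) → p , stable s) (λ _ → id) (tree-negate n r) , tree-negate n l

    -- The argument of Hodges. A leaf `b` colours the nodes by their relation to it. The root `e` of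
    -- a one-coloured subtree forms with `b` the next step of a ladder for the relation or for its
    -- complement, and the ladder continues in the half of that subtree where the relation to `e` is
    -- opposite to that of `b`.
    opposite-tree⇒ladder : ∀ k l → ∃ λ h → ∀ {P Q} → O.Tr h Q P → T.Ladder k P Q ⊎ N.Ladder l P Q
    opposite-tree⇒ladder zero    l       = 0 , λ _ → inj₁ tt
    opposite-tree⇒ladder (suc k) zero    = 0 , λ _ → inj₂ tt
    -- `tr-nodes` costs half of the height; below the root of the remaining tree there is room for
    -- either recursive call.
    opposite-tree⇒ladder (suc k) (suc l) = suc (h₁ + h₂) + suc (h₁ + h₂) , go
      where
      IH₁ = opposite-tree⇒ladder k (suc l)
      IH₂ = opposite-tree⇒ladder (suc k) l
      h₁ = proj₁ IH₁
      h₂ = proj₁ IH₂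
      go : ∀ {P Q} → O.Tr (suc (h₁ + h₂) + suc (h₁ + h₂)) Q P → T.Ladder (suc k) P Q ⊎ N.Ladder (suc l) P Q
      go {P} {Q} t with O.tr-leaf (suc (h₁ + h₂) + suc (h₁ + h₂)) t
      ... | b , q with O.tr-nodes (suc (h₁ + h₂)) (suc (h₁ + h₂)) {Q₁ = λ x → P x × ρ x b} {Q₂ = λ x → P x × ¬ ρ x b}
                         (λ x p → case em of λ { (yes s) → inj₁ (p , s) ; (no s) → inj₂ (p , s) }) t
      ...   | inj₁ (e , (p , s) , _ , r) with proj₂ IH₁ (O.tr-lowerʳ h₁ h₂ r)
      ...     | inj₁ lad = inj₁ (e , b , p , q , s , lad)
      ...     | inj₂ lad = inj₂ (N.ladder-mono (suc l) (λ _ → proj₁) (λ _ → proj₁) lad)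
      go {P} {Q} t | b , q | inj₂ (e , (p , s) , r , _) with proj₂ IH₂ (O.tr-lower h₁ h₂ r)
      ...     | inj₁ lad = inj₁ (T.ladder-mono (suc k) (λ _ → proj₁) (λ _ → proj₁) lad)
      ...     | inj₂ lad = inj₂ (e , b , p , q , s ,
                             N.ladder-mono l (λ _ → id) (λ z (q , u) → q , λ n → n u) lad)

    -- Arbitrarily high trees with the two sorts exchanged give long ladders, and ladders are cut
    -- into trees of either orientation. This is the symmetry of the stability of a formula in its
    -- two groups of variables.
    opposite-trees⇒trees : ∀ {P Q} → (∀ h → O.Tr h Q P) → ∀ n → T.Tr n P Q
    opposite-trees⇒trees t n with opposite-tree⇒ladder (suc (T.log⁻¹ n)) (suc (N.log⁻¹ n))
    ... | h , f with f (t h)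
    ...   | inj₁ lad = T.ladder⇒tree n lad
    ...   | inj₂ lad = tree-negate n (N.ladder⇒tree n lad)

  -- Limits of patterns and Cantor-Bendixson derivatives

  abstract
    tails : Σ[ 𝒱 ∈ Ultrafilter ℕ ] ∀ k → 𝒱 ∋ (k ≤_)
    tails = fip⇒ultrafilter _≤_ fip
      where
      fip : ∀ L → ∃ λ i → All (_≤ i) L
      fip []      = 0 , []
      fip (k ∷ L) = let (i , h) = fip L in k ⊔ i , m≤m⊔n k i ∷ mapᴬ (λ p → ≤-trans p (m≤n⊔m k i)) h

  -- The limit of a sequence of 0-1 functions agrees with infinitely many of
  -- its members on every finite set.
  module Limit {X : Set a} (s : ℕ → X → Bool) where

    private
      𝒱 = proj₁ tails

    abstract
      limit : X → Bool
      limit x = ⌊ 𝒱 ∋ (λ i → s i x ≡ true) ⌋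

      close : ∀ x → 𝒱 ∋ (λ i → s i x ≡ limit x)
      close x with ∋-split 𝒱 (λ i → s i x ≡ true)
      ... | inj₁ u = ∋-mono 𝒱 (λ i e → trans e (sym (⌊⌋-true u))) u
      ... | inj₂ u = ∋-mono 𝒱 (λ i e → trans (not-true e) (sym (not-true λ t → ∋-¬ 𝒱 u (⌊⌋-sound t)))) u

      agrees : ∀ F k → ∃ λ i → k ≤ i × All (λ x → s i x ≡ limit x) F
      agrees F k = ∋-inh 𝒱 (∋-× 𝒱 (proj₂ tails k) (∋-All 𝒱 (All-tabulate λ {x} _ → close x)))

  module CantorBendixson {X Y : Set a} (R : X → Y → Bool) (Y₀ : Y → Set a) where

    splits : Y → X → Set a
    splits y x = Lift a (R x y ≡ true)

    open Tree splits

    Fits : List X → (X → Bool) → Y → Set a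
    Fits F π y = All (λ x → R x y ≡ π x) F

    Agree : List X → (X → Bool) → (X → Bool) → Set a
    Agree F π π′ = All (λ x → π x ≡ π′ x) F

    -- The iterated derivatives of the closed set of patterns that are
    -- finitely satisfiable in Y₀.
    K : ℕ → (X → Bool) → Set a
    K zero    π = ∀ F → ∃ λ y → Y₀ y × Fits F π y
    K (suc n) π = ∀ F → ∃ λ π′ → K n π′ × ¬ (π′ ≡ π) × Agree F π′ π

    fits-trans : ∀ {F π π′ y} → Fits F π′ y → Agree F π′ π → Fits F π y
    fits-trans []       []       = []
    fits-trans (p ∷ ps) (q ∷ qs) = trans p q ∷ fits-trans ps qs

    branch : ∀ n {π₁ π₂ π x F} → Tr n (λ y → Y₀ y × Fits (x ∷ F) π₁ y) (λ _ → ⊤) →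
             Tr n (λ y → Y₀ y × Fits (x ∷ F) π₂ y) (λ _ → ⊤) → Agree F π₁ π → Agree F π₂ π →
             π₁ x ≡ true → π₂ x ≡ false → Tr (suc n) (λ y → Y₀ y × Fits F π y) (λ _ → ⊤)
    branch n {x = x} t₁ t₂ a₁ a₂ e₁ e₂ = x , tt ,
      tr-mono n (λ { y (y₀ , e ∷ f) → (y₀ , fits-trans f a₁) , lift (trans e e₁) }) (λ _ → id) t₁ ,
      tr-mono n (λ { y (y₀ , e ∷ f) → (y₀ , fits-trans f a₂) , λ { (lift t) → false≢true (trans e e₂) t } })
                (λ _ → id) t₂

    either-way : ∀ n {π₁ π₂ π x F} → Tr n (λ y → Y₀ y × Fits (x ∷ F) π₁ y) (λ _ → ⊤) →
                 Tr n (λ y → Y₀ y × Fits (x ∷ F) π₂ y) (λ _ → ⊤) → Agree F π₁ π → Agree F π₂ π →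
                 ∀ {b c} → π₁ x ≡ b → π₂ x ≡ c → ¬ (b ≡ c) → Tr (suc n) (λ y → Y₀ y × Fits F π y) (λ _ → ⊤)
    either-way n t₁ t₂ a₁ a₂ {true}  {true}  e₁ e₂ d = ⊥-elim (d refl)
    either-way n t₁ t₂ a₁ a₂ {true}  {false} e₁ e₂ d = branch n t₁ t₂ a₁ a₂ e₁ e₂
    either-way n t₁ t₂ a₁ a₂ {false} {true}  e₁ e₂ d = branch n t₂ t₁ a₂ a₁ e₂ e₁
    either-way n t₁ t₂ a₁ a₂ {false} {false} e₁ e₂ d = ⊥-elim (d refl)

    all-tail : {P : X → Set} {x : X} {F : List X} → All P (x ∷ F) → All P F
    all-tail (_ ∷ h) = h

    all-head : {P : X → Set} {x : X} {F : List X} → All P (x ∷ F) → P x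
    all-head (p ∷ _) = p

    -- Near `π` lies some `π₁` that differs from it at a point `x`, and some `π₂` that agrees with
    -- it at `x` too; the trees belonging to these two are hung below the root `x`.
    K⇒tree : ∀ n {π} F → K n π → Tr n (λ y → Y₀ y × Fits F π y) (λ _ → ⊤)
    K⇒tree zero    F k = k F
    K⇒tree (suc n) {π} F k =
      let (π₁ , k₁ , π₁≢π , a₁) = k F
          (x , d)               = ¬∀⇒∃¬ (λ h → π₁≢π (ext h))
          (π₂ , k₂ , _ , a₂)    = k (x ∷ F)
      in either-way n (K⇒tree n (x ∷ F) k₁) (K⇒tree n (x ∷ F) k₂) a₁ (all-tail a₂) refl (all-head a₂) d

    K-fits : ∀ n {π} → K n π → ∀ F → ∃ λ y → Y₀ y × Fits F π y
    K-fits n k F = tr-leaf n (K⇒tree n F k)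

    -- A point of the `N`-th derivative would carry a tree of height `N`; so the bound on heights
    -- makes the derivatives vanish, and there is a last inhabited one.
    last-derivative : ∀ N → ¬ Tr N Y₀ (λ _ → ⊤) → ∃ Y₀ → ∃ λ n → ∃ (K n) × ¬ ∃ (K (suc n))
    last-derivative N bound (y , y₀) = go N (λ (π , k) → bound (tr-mono N (λ _ → proj₁) (λ _ → id) (K⇒tree N [] k)))
      where
      go : ∀ N → ¬ ∃ (K N) → ∃ λ n → ∃ (K n) × ¬ ∃ (K (suc n))
      go zero    h = ⊥-elim (h ((λ x → R x y) , λ F → y , y₀ , All-tabulate λ _ → refl))
      go (suc N) h with em {P = ∃ (K N)}
      ... | yes k = N , k , h
      ... | no k  = go N k

    no-sequence : ∀ {n} → ¬ ∃ (K (suc n)) → (s : ℕ → X → Bool) → (∀ i → K n (s i)) →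
                  ¬ (∀ {i j} → i <ᴺ j → ¬ (s i ≡ s j))
    no-sequence {n} none s k inj = none (limit , point)
      where
      open Limit s
      point : K (suc n) limit
      point F with agrees F 0
      ... | i , _ , f with em {P = s i ≡ limit} | agrees F (suc i)
      ...   | no d  | _           = s i , k i , d , f
      -- A member that equals the limit is replaced by a later one: members are distinct, so that
      -- one differs from the limit.
      ...   | yes e | j , i<j , g = s j , k j , (λ e′ → inj i<j (trans e (sym e′))) , g

    finitely-many : ∀ {n} → ¬ ∃ (K (suc n)) → ∃ λ L → ∀ {π} → K n π → π ∈ᴸ L
    finitely-many {n} none = stable λ h → no-sequence none (s h) (λ i → proj₁ (proj₂ (new h (stage h i)))) (distinct h)
      where
      module _ (h : ¬ ∃ λ L → ∀ {π} → K n π → π ∈ᴸ L) where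
        new : ∀ L → ∃ λ π → K n π × ¬ (π ∈ᴸ L)
        new L = stable λ m → h (L , λ {π} k → stable λ π∉L → m (π , k , π∉L))
        stage : ℕ → List (X → Bool)
        stage zero    = []
        stage (suc i) = proj₁ (new (stage i)) ∷ stage i
        s : ℕ → X → Bool
        s i = proj₁ (new (stage i))
        earlier : ∀ {i j} → i <ᴺ j → s i ∈ᴸ stage j
        earlier {i} {suc j} (s≤s i≤j) with m≤n⇒m<n∨m≡n i≤j
        ... | inj₁ i<j  = there (earlier i<j)
        ... | inj₂ refl = here refl
        distinct : ∀ {i j} → i <ᴺ j → ¬ (s i ≡ s j)
        distinct {i} {j} i<j e = proj₂ (proj₂ (new (stage j))) (subst (_∈ᴸ stage j) e (earlier i<j))

    -- The last derivative is finite, so a point has only finitely many possible rows of truth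
    -- values on it; `Limit`, applied to these rows, plays the role of the pigeonhole principle.
    repetition : ∀ {n} → ¬ ∃ (K (suc n)) → (x : ℕ → X) →
                 ∃ λ i → ∃ λ j → i <ᴺ j × ∀ {π} → K n π → π (x i) ≡ π (x j)
    repetition {n} none x with finitely-many none
    ... | L , all = let (i , _ , p) = agrees L 0 ; (j , i<j , q) = agrees L (suc i) in
      i , j , i<j , λ k → trans (All-lookup p (all k)) (sym (All-lookup q (all k)))
      where open Limit {X = X → Bool} (λ i π → π (x i))

    -- For `g` and `h` induced by an automorphism this closes every derivative under automorphisms;
    -- the right inverse `g⁻` keeps distinct patterns distinct.
    K-invariant : (g g⁻ : X → X) → (∀ x → g (g⁻ x) ≡ x) → (h : Y → Y) → (∀ {y} → Y₀ y → Y₀ (h y)) →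
                  (∀ x y → R x (h y) ≡ R (g x) y) → ∀ n {π} → K n π → K n (π ∘ g)
    K-invariant g g⁻ inv h y₀ r zero k F = let (y , q , f) = k (mapᴸ g F) in
      h y , y₀ q , mapᴬ (λ {x} e → trans (r x y) e) (All-map⁻ f)
    K-invariant g g⁻ inv h y₀ r (suc n) {π} k F = let (π′ , k′ , d , ag) = k (mapᴸ g F) in
      π′ ∘ g , K-invariant g g⁻ inv h y₀ r n k′ ,
      (λ e → d (ext λ x → trans (cong π′ (sym (inv x))) (trans (cong (λ q → q (g⁻ x)) e) (cong π (inv x))))) ,
      All-map⁻ ag

-- Formulas whose variables are named by arbitrary sets

module Syntax (ext : ∀ {a b} → Extensionality a b) {ℓ : Level} (L : Language ℓ) (ℭ : Structure L) where

  open Structure ℭ renaming (Carrier to C)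
  open Equivalence using (to; from)

  ren-term  : (Fin k → Fin l) → Term L k → Term L l
  ren-terms : (Fin k → Fin l) → Vec (Term L k) m → Vec (Term L l) m
  ren-term ρ (var i)    = var (ρ i)
  ren-term ρ (fun f ts) = fun f (ren-terms ρ ts)
  ren-terms ρ []       = []
  ren-terms ρ (t ∷ ts) = ren-term ρ t ∷ ren-terms ρ ts

  lift-ren : (Fin k → Fin l) → Fin (suc k) → Fin (suc l)
  lift-ren ρ zero    = zero
  lift-ren ρ (suc i) = suc (ρ i)

  ren : (Fin k → Fin l) → Formula L k → Formula L l
  ren ρ (s ≗ t)    = ren-term ρ s ≗ ren-term ρ t
  ren ρ (rel r ts) = rel r (ren-terms ρ ts)
  ren ρ (¬' φ)     = ¬' ren ρ φ
  ren ρ (φ ∧ ψ)    = ren ρ φ ∧ ren ρ ψ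
  ren ρ (∃' φ)     = ∃' ren (lift-ren ρ) φ

  module _ {v : Vec C k} {w : Vec C l} {ρ : Fin k → Fin l}
           (h : ∀ i → lookup w (ρ i) ≡ lookup v i) where

    eval-ren  : (t : Term L k) → eval ℭ w (ren-term ρ t) ≡ eval ℭ v t
    evals-ren : (ts : Vec (Term L k) m) → evals ℭ w (ren-terms ρ ts) ≡ evals ℭ v ts
    eval-ren (var i)    = h i
    eval-ren (fun f ts) = cong ⟦ f ⟧ᶠ (evals-ren ts)
    evals-ren []       = refl
    evals-ren (t ∷ ts) = cong₂ _∷_ (eval-ren t) (evals-ren ts)

  ⊨-ren : {v : Vec C k} {w : Vec C l} {ρ : Fin k → Fin l} → (∀ i → lookup w (ρ i) ≡ lookup v i) →
          (φ : Formula L k) → (ℭ ⊨ ren ρ φ [ w ]) ≡ (ℭ ⊨ φ [ v ])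
  ⊨-ren h (s ≗ t)    = cong₂ _≡_ (eval-ren h s) (eval-ren h t)
  ⊨-ren h (rel r ts) = cong ⟦ r ⟧ʳ (evals-ren h ts)
  ⊨-ren h (¬' φ)     = cong ¬_ (⊨-ren h φ)
  ⊨-ren h (φ ∧ ψ)    = cong₂ _×_ (⊨-ren h φ) (⊨-ren h ψ)
  ⊨-ren h (∃' φ)     = cong ∃ (ext λ c → ⊨-ren (λ { zero → refl ; (suc i) → h i }) φ)

  -- The variables are named by elements of `V`, which may be positions in an infinite tuple,
  -- parameters, or a sum of several kinds. Substitution is `mapᴵ`, and types of infinite tuples
  -- need no coding of indices.
  record Inst (V : Set b) : Set (ℓ ⊔ˡ b) where
    constructor inst
    field
      {arity} : ℕ
      fml     : Formula L arity
      args    : Vec V arity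

  ⟦_⟧ : {V : Set b} → Inst V → (V → C) → Set ℓ
  ⟦ inst φ i ⟧ v = ℭ ⊨ φ [ map v i ]

  mapᴵ : {V : Set b} {W : Set c} → (V → W) → Inst V → Inst W
  mapᴵ h (inst φ i) = inst φ (map h i)

  ⟦mapᴵ⟧ : {V : Set b} {W : Set c} (h : V → W) (ι : Inst V) (v : W → C) →
           ⟦ mapᴵ h ι ⟧ v ≡ ⟦ ι ⟧ (v ∘ h)
  ⟦mapᴵ⟧ h (inst φ i) v = cong (ℭ ⊨ φ [_]) (sym (map-∘ v h i))

  ⟦⟧-cong : {V : Set b} (ι : Inst V) {v w : V → C} → (∀ x → v x ≡ w x) → ⟦ ι ⟧ v → ⟦ ι ⟧ w
  ⟦⟧-cong (inst φ i) h = subst (ℭ ⊨ φ [_]) (map-cong h i)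

  ⟦mapᴵ⟧⁺ : {V : Set b} {W : Set c} (h : V → W) (ι : Inst V) {v : V → C} {w : W → C} →
            (∀ x → v x ≡ w (h x)) → ⟦ ι ⟧ v → ⟦ mapᴵ h ι ⟧ w
  ⟦mapᴵ⟧⁺ h ι {w = w} e s = subst id (sym (⟦mapᴵ⟧ h ι w)) (⟦⟧-cong ι e s)

  ⟦mapᴵ⟧⁻ : {V : Set b} {W : Set c} (h : V → W) (ι : Inst V) {v : V → C} {w : W → C} →
            (∀ x → w (h x) ≡ v x) → ⟦ mapᴵ h ι ⟧ w → ⟦ ι ⟧ v
  ⟦mapᴵ⟧⁻ h ι {w = w} e s = ⟦⟧-cong ι e (subst id (⟦mapᴵ⟧ h ι w) s)

  ¬ᴵ_ : {V : Set b} → Inst V → Inst V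
  ¬ᴵ inst φ i = inst (¬' φ) i

  infixr 5 _∧ᴵ_

  _∧ᴵ_ : {V : Set b} → Inst V → Inst V → Inst V
  inst {k} φ i ∧ᴵ inst {l} ψ j = inst (ren (_↑ˡ l) φ ∧ ren (k ↑ʳ_) ψ) (i ++ j)

  ⟦∧ᴵ⟧ : {V : Set b} (ι κ : Inst V) (v : V → C) → ⟦ ι ∧ᴵ κ ⟧ v ≡ (⟦ ι ⟧ v × ⟦ κ ⟧ v)
  ⟦∧ᴵ⟧ (inst {k} φ i) (inst {l} ψ j) v = cong₂ _×_
    (⊨-ren (λ x → trans (lookup-map (x ↑ˡ l) v (i ++ j))
                 (trans (cong v (lookup-++ˡ i j x)) (sym (lookup-map x v i)))) φ)
    (⊨-ren (λ x → trans (lookup-map (k ↑ʳ x) v (i ++ j))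
                 (trans (cong v (lookup-++ʳ i j x)) (sym (lookup-map x v j)))) ψ)

  ⊤ᴵ : {V : Set b} → Inst V
  ⊤ᴵ = inst (∃' (var zero ≗ var zero)) []

  ⟦⊤ᴵ⟧ : {V : Set b} (v : V → C) → ⟦ ⊤ᴵ ⟧ v
  ⟦⊤ᴵ⟧ v = nonempty , refl

  ⋀ᴵ : {V : Set b} → List (Inst V) → Inst V
  ⋀ᴵ []       = ⊤ᴵ
  ⋀ᴵ (ι ∷ ιs) = ι ∧ᴵ ⋀ᴵ ιs

  ⋀ᴵ⁺ : {V : Set b} {v : V → C} (ιs : List (Inst V)) → All (λ ι → ⟦ ι ⟧ v) ιs → ⟦ ⋀ᴵ ιs ⟧ v
  ⋀ᴵ⁺ {v = v} []       []       = ⟦⊤ᴵ⟧ v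
  ⋀ᴵ⁺ {v = v} (ι ∷ ιs) (x ∷ xs) = subst id (sym (⟦∧ᴵ⟧ ι (⋀ᴵ ιs) v)) (x , ⋀ᴵ⁺ ιs xs)

  ⋀ᴵ⁻ : {V : Set b} {v : V → C} (ιs : List (Inst V)) → ⟦ ⋀ᴵ ιs ⟧ v → All (λ ι → ⟦ ι ⟧ v) ιs
  ⋀ᴵ⁻ []       _ = []
  ⋀ᴵ⁻ {v = v} (ι ∷ ιs) x = let (y , ys) = subst id (⟦∧ᴵ⟧ ι (⋀ᴵ ιs) v) x in y ∷ ⋀ᴵ⁻ ιs ys

  ∃ⁿ : ∀ n → Formula L (n + m) → Formula L m
  ∃ⁿ zero    φ = φ
  ∃ⁿ (suc n) φ = ∃ⁿ n (∃' φ)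

  ∃ⁿ⁺ : ∀ n (φ : Formula L (n + m)) {v} (x : Vec C n) → ℭ ⊨ φ [ x ++ v ] → ℭ ⊨ ∃ⁿ n φ [ v ]
  ∃ⁿ⁺ zero    φ []      h = h
  ∃ⁿ⁺ (suc n) φ (c ∷ x) h = ∃ⁿ⁺ n (∃' φ) x (c , h)

  ∃ⁿ⁻ : ∀ n (φ : Formula L (n + m)) {v} → ℭ ⊨ ∃ⁿ n φ [ v ] → ∃ λ (x : Vec C n) → ℭ ⊨ φ [ x ++ v ]
  ∃ⁿ⁻ zero    φ h = [] , h
  ∃ⁿ⁻ (suc n) φ h = let (x , c , g) = ∃ⁿ⁻ n (∃' φ) h in c ∷ x , g

  -- Named variables brought into the order `x ++ a` that `ParamFormula` prescribes: the block to be
  -- quantified or typed comes first.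
  record Sorted (n : ℕ) (W : Set b) : Set (ℓ ⊔ˡ b) where
    constructor sorted
    field
      {rest}  : ℕ
      body    : Formula L (n + rest)
      outer   : Vec W rest

  holds : {W : Set b} → Sorted n W → Vec C n → (W → C) → Set ℓ
  holds (sorted φ js) x w = ℭ ⊨ φ [ x ++ map w js ]

  sort-vars : {W : Set b} → Vec (Fin n ⊎ W) k →
              Σ[ m ∈ ℕ ] Σ[ js ∈ Vec W m ] (Fin k → Fin n ⊎ Fin m)
  sort-vars []           = 0 , [] , λ ()
  sort-vars (inj₁ x ∷ i) = let (m , js , ρ) = sort-vars i in
    m , js , λ { zero → inj₁ x ; (suc y) → ρ y }
  sort-vars (inj₂ w ∷ i) = let (m , js , ρ) = sort-vars i in
    suc m , w ∷ js , λ { zero → inj₂ zero ; (suc y) → map₂ˢ suc (ρ y) }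

  sort-vars-lookup : {W : Set b} (i : Vec (Fin n ⊎ W) k) (x : Fin n → C) (w : W → C) (y : Fin k) →
    let (m , js , ρ) = sort-vars i in
    [ x , lookup (map w js) ]′ (ρ y) ≡ [ x , w ]′ (lookup i y)
  sort-vars-lookup (inj₁ _ ∷ i) x w zero    = refl
  sort-vars-lookup (inj₁ _ ∷ i) x w (suc y) = sort-vars-lookup i x w y
  sort-vars-lookup (inj₂ _ ∷ i) x w zero    = refl
  sort-vars-lookup (inj₂ u ∷ i) x w (suc y) with sort-vars i | sort-vars-lookup i x w y
  ... | m , js , ρ | h with ρ y
  ...   | inj₁ _ = h
  ...   | inj₂ _ = h

  sort : {W : Set b} → Inst (Fin n ⊎ W) → Sorted n W
  sort {n = n} (inst φ i) = let (m , js , ρ) = sort-vars i in sorted (ren (join n m ∘ ρ) φ) js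

  holds-sort : {W : Set b} (ι : Inst (Fin n ⊎ W)) (x : Fin n → C) (w : W → C) →
               holds (sort ι) (tabulate x) w ≡ ⟦ ι ⟧ [ x , w ]′
  holds-sort {n = n} (inst φ i) x w = ⊨-ren lem φ
    where
    r  = proj₁ (sort-vars i)
    js = proj₁ (proj₂ (sort-vars i))
    ρ  = proj₂ (proj₂ (sort-vars i))
    cases : ∀ (z : Fin n ⊎ Fin r) →
            lookup (tabulate x ++ map w js) (join n r z) ≡ [ x , lookup (map w js) ]′ z
    cases (inj₁ y) = trans (lookup-++ˡ (tabulate x) (map w js) y) (lookup∘tabulate x y)
    cases (inj₂ y) = lookup-++ʳ (tabulate x) (map w js) y
    lem : ∀ y → lookup (tabulate x ++ map w js) (join n r (ρ y)) ≡ lookup (map [ x , w ]′ i) y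
    lem y = trans (cases (ρ y)) (trans (sort-vars-lookup i x w y) (sym (lookup-map y _ i)))

  ∃ᴵ : {W : Set b} → Inst (Fin n ⊎ W) → Inst W
  ∃ᴵ {n = n} ι = inst (∃ⁿ n (Sorted.body (sort ι))) (Sorted.outer (sort ι))

  ∃ᴵ⁺ : {W : Set b} (ι : Inst (Fin n ⊎ W)) {w : W → C} (x : Fin n → C) →
        ⟦ ι ⟧ [ x , w ]′ → ⟦ ∃ᴵ ι ⟧ w
  ∃ᴵ⁺ {n = n} ι {w} x h = ∃ⁿ⁺ n (Sorted.body (sort ι)) (tabulate x)
    (subst id (sym (holds-sort ι x w)) h)

  tabulate-lookup : (x : Vec C n) → tabulate (lookup x) ≡ x
  tabulate-lookup = tabulate∘lookup

  ∃ᴵ⁻ : {W : Set b} (ι : Inst (Fin n ⊎ W)) {w : W → C} →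
        ⟦ ∃ᴵ ι ⟧ w → ∃ λ (x : Fin n → C) → ⟦ ι ⟧ [ x , w ]′
  ∃ᴵ⁻ {n = n} ι {w} h = let (x , g) = ∃ⁿ⁻ n (Sorted.body (sort ι)) h in
    lookup x , subst id (holds-sort ι (lookup x) w)
      (subst (λ y → holds (sort ι) y w) (sym (tabulate-lookup x)) g)

  module _ (σ : Automorphism ℭ) where

    private
      σ→ = Automorphism.to σ
      σ← = Automorphism.from σ

    auto-invˡ : ∀ c → σ→ (σ← c) ≡ c
    auto-invˡ = Inverse.strictlyInverseˡ (Automorphism.bijection σ)

    auto-invʳ : ∀ c → σ← (σ→ c) ≡ c
    auto-invʳ = Inverse.strictlyInverseʳ (Automorphism.bijection σ)

    eval-auto  : (v : Vec C k) (t : Term L k) → eval ℭ (map σ→ v) t ≡ σ→ (eval ℭ v t)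
    evals-auto : (v : Vec C k) (ts : Vec (Term L k) m) →
                 evals ℭ (map σ→ v) ts ≡ map σ→ (evals ℭ v ts)
    eval-auto v (var i)    = lookup-map i σ→ v
    eval-auto v (fun f ts) = trans (cong ⟦ f ⟧ᶠ (evals-auto v ts)) (sym (Automorphism.fun-hom σ f _))
    evals-auto v []       = refl
    evals-auto v (t ∷ ts) = cong₂ _∷_ (eval-auto v t) (evals-auto v ts)

    ⊨-auto : (φ : Formula L k) (v : Vec C k) → (ℭ ⊨ φ [ v ]) ⇔ (ℭ ⊨ φ [ map σ→ v ])
    ⊨-auto (s ≗ t) v = mk⇔
      (λ e → trans (eval-auto v s) (trans (cong σ→ e) (sym (eval-auto v t))))
      (λ e → trans (sym (auto-invʳ _)) (trans (cong σ← (trans (sym (eval-auto v s))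
        (trans e (eval-auto v t)))) (auto-invʳ _)))
    ⊨-auto (rel r ts) v = mk⇔
      (λ x → subst ⟦ r ⟧ʳ (sym (evals-auto v ts)) (to (Automorphism.rel-hom σ r _) x))
      (λ x → from (Automorphism.rel-hom σ r _) (subst ⟦ r ⟧ʳ (evals-auto v ts) x))
    ⊨-auto (¬' φ) v = mk⇔ (λ n x → n (from (⊨-auto φ v) x)) (λ n x → n (to (⊨-auto φ v) x))
    ⊨-auto (φ ∧ ψ) v = mk⇔
      (λ (x , y) → to (⊨-auto φ v) x , to (⊨-auto ψ v) y)
      (λ (x , y) → from (⊨-auto φ v) x , from (⊨-auto ψ v) y)
    ⊨-auto (∃' φ) v = mk⇔
      (λ (c , x) → σ→ c , to (⊨-auto φ (c ∷ v)) x)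
      (λ (c , x) → σ← c , from (⊨-auto φ (σ← c ∷ v))
        (subst (λ d → ℭ ⊨ φ [ d ∷ map σ→ v ]) (sym (auto-invˡ c)) x))

    ⟦⟧-auto : {V : Set b} (ι : Inst V) (v : V → C) → ⟦ ι ⟧ v ⇔ ⟦ ι ⟧ (σ→ ∘ v)
    ⟦⟧-auto (inst φ i) v = subst (λ w → (ℭ ⊨ φ [ map v i ]) ⇔ (ℭ ⊨ φ [ w ]))
      (sym (map-∘ σ→ v i)) (⊨-auto φ (map v i))

module Model (em : ∀ {a} → ExcludedMiddle a) (ext : ∀ {a b} → Extensionality a b) {ℓ : Level}
             (L : Language ℓ) (T : Theory L) (κ̄ : Set ℓ) (ℭ : Structure L) (isMonster : IsMonster T κ̄ ℭ) where

  open Classical em ext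
  open Syntax ext L ℭ
  open Language L
  open Structure ℭ renaming (Carrier to C)
  open Equivalence using (to; from)
  open IsMonster isMonster
  open Monster κ̄ ℭ
  open Smallness inaccessible

  -- Smallness of the set of formulas

  Eventually : (ℕ → Set a) → Set a
  Eventually P = ∃ λ k₀ → ∀ k → k₀ ≤ k → P k

  eventually-× : {P : ℕ → Set a} {Q : ℕ → Set b} → Eventually P → Eventually Q →
                 Eventually (λ k → P k × Q k)
  eventually-× (k₁ , p) (k₂ , q) = k₁ ⊔ k₂ , λ k h → p k (m⊔n≤o⇒m≤o k₁ k₂ h) , q k (m⊔n≤o⇒n≤o k₁ k₂ h)

  eventually-suc : {P : ℕ → Set a} → Eventually (λ k → P (suc k)) → Eventually P
  eventually-suc (k₀ , p) = suc k₀ , λ { (suc k) (s≤s h) → p k h }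

  eventually-map : {P : ℕ → Set a} {Q : ℕ → Set b} → (∀ {k} → P k → Q k) → Eventually P → Eventually Q
  eventually-map f (k₀ , p) = k₀ , λ k h → f (p k h)

  Term≤ : ℕ → ℕ → Set ℓ
  Term≤ zero    n = ⊥ᵖ
  Term≤ (suc k) n = Lift ℓ (Fin n) ⊎ Σ (Σ ℕ Fun) λ (l , _) → Vec (Term≤ k n) l

  term≤-small : ∀ k → Term≤ k n ≺ κ̄
  term≤-small zero    = ↣-small (inject (λ ()) λ { {()} }) ℕ-small
  term≤-small (suc k) = ⊎-small (Lift-small Fin-small)
    (Σ-small small-functions λ (l , _) → Vec-small (term≤-small k) l)

  decode-term  : ∀ k → Term≤ k n → Term L n
  decode-terms : ∀ k → Vec (Term≤ k n) l → Vec (Term L n) l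
  decode-term (suc k) (inj₁ (lift i))       = var i
  decode-term (suc k) (inj₂ ((_ , f) , ts)) = fun f (decode-terms k ts)
  decode-terms k []       = []
  decode-terms k (t ∷ ts) = decode-term k t ∷ decode-terms k ts

  -- Codes are graded by depth. Asking for a code at every sufficiently large depth, not at one
  -- depth, lets the finitely many subterms share a common bound.
  encode-term  : (t : Term L n) → Eventually λ k → ∃ λ u → decode-term k u ≡ t
  encode-terms : (ts : Vec (Term L n) l) → Eventually λ k → ∃ λ us → decode-terms k us ≡ ts
  encode-term (var i)    = eventually-suc (0 , λ k _ → inj₁ (lift i) , refl)
  encode-term (fun f ts) = eventually-suc (eventually-map
    (λ (us , e) → inj₂ ((_ , f) , us) , cong (fun f) e) (encode-terms ts))
  encode-terms []       = 0 , λ k _ → [] , refl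
  encode-terms (t ∷ ts) = eventually-map (λ ((u , e) , (us , es)) → u ∷ us , cong₂ _∷_ e es)
    (eventually-× (encode-term t) (encode-terms ts))

  from-eventually : {X : ℕ → Set ℓ} {Y : Set ℓ} → (∀ k → X k ≺ κ̄) → (f : ∀ k → X k → Y) →
                    (∀ y → Eventually λ k → ∃ λ x → f k x ≡ y) → Y ≺ κ̄
  from-eventually s f h = surj-small (λ (k , x) → f k x)
    (λ y → let (k , p) = h y ; (x , e) = p k ≤-refl in (k , x) , e) (Σℕ-small s)
    where open import Data.Nat.Properties using (≤-refl)

  term-small : Term L n ≺ κ̄
  term-small = from-eventually term≤-small decode-term encode-term

  Formula≤ : ℕ → ℕ → Set ℓ
  Formula≤ zero    n = ⊥ᵖ
  Formula≤ (suc k) n = (Term L n × Term L n) ⊎ (Σ (Σ ℕ Rel) λ (l , _) → Vec (Term L n) l) ⊎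
    Formula≤ k n ⊎ (Formula≤ k n × Formula≤ k n) ⊎ Formula≤ k (suc n)

  formula≤-small : ∀ k → Formula≤ k n ≺ κ̄
  formula≤-small zero    = ↣-small (inject (λ ()) λ { {()} }) ℕ-small
  formula≤-small (suc k) = ⊎-small (×-small term-small term-small)
    (⊎-small (Σ-small small-relations λ (l , _) → Vec-small term-small l)
    (⊎-small (formula≤-small k) (⊎-small (×-small (formula≤-small k) (formula≤-small k))
                                         (formula≤-small k))))

  decode : ∀ k → Formula≤ k n → Formula L n
  decode (suc k) (inj₁ (s , t))                      = s ≗ t
  decode (suc k) (inj₂ (inj₁ ((_ , r) , ts)))        = rel r ts
  decode (suc k) (inj₂ (inj₂ (inj₁ φ)))              = ¬' decode k φ
  decode (suc k) (inj₂ (inj₂ (inj₂ (inj₁ (φ , ψ))))) = decode k φ ∧ decode k ψ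
  decode (suc k) (inj₂ (inj₂ (inj₂ (inj₂ φ))))       = ∃' decode k φ

  encode : (φ : Formula L n) → Eventually λ k → ∃ λ χ → decode k χ ≡ φ
  encode (s ≗ t)    = eventually-suc (0 , λ k _ → inj₁ (s , t) , refl)
  encode (rel r ts) = eventually-suc (0 , λ k _ → inj₂ (inj₁ ((_ , r) , ts)) , refl)
  encode (¬' φ)     = eventually-suc (eventually-map
    (λ (χ , e) → inj₂ (inj₂ (inj₁ χ)) , cong ¬'_ e) (encode φ))
  encode (φ ∧ ψ)    = eventually-suc (eventually-map
    (λ ((χ , e) , (ξ , e′)) → inj₂ (inj₂ (inj₂ (inj₁ (χ , ξ)))) , cong₂ _∧_ e e′)
    (eventually-× (encode φ) (encode ψ)))
  encode (∃' φ)     = eventually-suc (eventually-map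
    (λ (χ , e) → inj₂ (inj₂ (inj₂ (inj₂ χ))) , cong ∃'_ e) (encode φ))

  formula-small : Formula L n ≺ κ̄
  formula-small = from-eventually formula≤-small decode encode

  inst-small : {V : Set ℓ} → V ≺ κ̄ → Inst V ≺ κ̄
  inst-small s = surj-small (λ (k , φ , i) → inst φ i) (λ { (inst φ i) → (_ , φ , i) , refl })
    (Σℕ-small λ k → ×-small formula-small (Vec-small s k))

  -- Small parameter sets and equality of types

  Range : {I : Set b} → (I → C) → Pred C (b ⊔ˡ ℓ)
  Range e c = ∃ λ i → e i ≡ c

  range-small : {I : Set ℓ} → I ≺ κ̄ → (e : I → C) → Small (Range e)
  range-small s e = _ , s , e , λ c h → h

  tuple-small : (x : Fin n → C) → Small (Range x)
  tuple-small x = _ , Lift-small Fin-small , x ∘ lower , λ c (i , e) → lift i , e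

  infixr 6 _∪_

  _∪_ : Pred C ℓ → Pred C ℓ → Pred C ℓ
  (A ∪ B) c = A c ⊎ B c

  ∪-small : {A B : Subset ℭ} → Small A → Small B → Small (A ∪ B)
  ∪-small (I , s , e , h) (J , t , f , g) = (I ⊎ J) , ⊎-small s t , [ e , f ]′ ,
    λ { c (inj₁ x) → let (i , p) = h c x in inj₁ i , p
      ; c (inj₂ x) → let (j , p) = g c x in inj₂ j , p }

  ⊆-small : {A B : Subset ℭ} → A ⊆ B → Small B → Small A
  ⊆-small i (I , s , e , h) = I , s , e , λ c x → h c (i x)

  -- `Small` only covers `A` and may list other elements as well; here every index names a member.
  record Enumeration (A : Subset ℭ) : Set (lsuc ℓ) where
    field
      Index  : Set ℓ
      small  : Index ≺ κ̄
      elem   : Index → Σ C A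
      covers : ∀ {c} → A c → ∃ λ i → proj₁ (elem i) ≡ c

  enumerate : {A : Subset ℭ} → Small A → Enumeration A
  enumerate {A} (I , s , e , h) = record
    { Index  = Σ I λ i → ⌊ A (e i) ⌋ ≡ true
    ; small  = ↣-small (inject proj₁ λ { {i , p} {_ , q} refl → cong (i ,_) (uip p q) }) s
    ; elem   = λ (i , p) → e i , ⌊⌋-sound p
    ; covers = λ x → let (i , p) = h _ x in (i , ⌊⌋-true (subst A (sym p) x)) , p
    }

  infix 4 _≈[_]_

  -- Equality of tp(e/D) and tp(f/D): one implication suffices, because formulas are closed under
  -- negation.
  _≈[_]_ : {J : Set b} → (J → C) → Subset ℭ → (J → C) → Set (b ⊔ˡ ℓ)
  e ≈[ D ] f = ∀ ι → ⟦ ι ⟧ [ e , proj₁ {B = D} ]′ → ⟦ ι ⟧ [ f , proj₁ ]′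

  module _ {J : Set b} {D : Subset ℭ} where

    ≈-refl : {e : J → C} → e ≈[ D ] e
    ≈-refl ι h = h

    ≈-trans : {e f g : J → C} → e ≈[ D ] f → f ≈[ D ] g → e ≈[ D ] g
    ≈-trans p q ι h = q ι (p ι h)

    ≈-sym : {e f : J → C} → e ≈[ D ] f → f ≈[ D ] e
    ≈-sym p ι h = stable λ n → p (¬ᴵ ι) n h

    ≈-pointwise : {e f : J → C} → (∀ j → e j ≡ f j) → e ≈[ D ] f
    ≈-pointwise p ι = ⟦⟧-cong ι λ { (inj₁ j) → p j ; (inj₂ _) → refl }

    ≈-∘ : {I : Set c} (h : I → J) {e f : J → C} → e ≈[ D ] f → (e ∘ h) ≈[ D ] (f ∘ h)
    ≈-∘ h {e} {f} p ι x = ⟦mapᴵ⟧⁻ (map₁ˢ h) ι (val f) (p (mapᴵ (map₁ˢ h) ι)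
      (⟦mapᴵ⟧⁺ (map₁ˢ h) ι (λ v → sym (val e v)) x))
      where
      val : ∀ (g : J → C) v → [ g , proj₁ {B = D} ]′ (map₁ˢ h v) ≡ [ g ∘ h , proj₁ ]′ v
      val g (inj₁ _) = refl
      val g (inj₂ _) = refl

    module _ {D′ : Subset ℭ} (i : D ⊆ D′) where

      widen : J ⊎ Σ C D → J ⊎ Σ C D′
      widen = map₂ˢ λ (c , d) → c , i d

      widen-val : ∀ (g : J → C) v → [ g , proj₁ ]′ (widen v) ≡ [ g , proj₁ ]′ v
      widen-val g (inj₁ _) = refl
      widen-val g (inj₂ _) = refl

    ≈-mono : {D′ : Subset ℭ} {e f : J → C} → D ⊆ D′ → e ≈[ D′ ] f → e ≈[ D ] f
    ≈-mono {e = e} {f} i p ι x = ⟦mapᴵ⟧⁻ (widen i) ι (widen-val i f) (p (mapᴵ (widen i) ι)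
      (⟦mapᴵ⟧⁺ (widen i) ι (λ v → sym (widen-val i e v)) x))

  Fixes : Automorphism ℭ → Subset ℭ → Set ℓ
  Fixes σ D = ∀ {c} → D c → Automorphism.to σ c ≡ c

  ≈-auto : {J : Set b} {D : Subset ℭ} (σ : Automorphism ℭ) → Fixes σ D → (e : J → C) →
           e ≈[ D ] (Automorphism.to σ ∘ e)
  ≈-auto σ fx e ι x = ⟦⟧-cong ι (λ { (inj₁ _) → refl ; (inj₂ (c , d)) → fx d })
    (to (⟦⟧-auto σ ι _) x)

  infix 10 _·_

  -- The image of `D` under `σ`, written as a preimage so that membership needs no existential.
  _·_ : Automorphism ℭ → Subset ℭ → Subset ℭ
  (σ · D) c = D (Automorphism.from σ c)

  ·-small : ∀ σ {D} → Small D → Small (σ · D)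
  ·-small σ (I , s , e , h) = I , s , Automorphism.to σ ∘ e ,
    λ c d → let (i , p) = h _ d in i , trans (cong (Automorphism.to σ) p) (auto-invˡ σ c)

  ≈-· : {J : Set b} {D : Subset ℭ} (σ : Automorphism ℭ) {e f : J → C} → e ≈[ D ] f →
        (Automorphism.to σ ∘ e) ≈[ σ · D ] (Automorphism.to σ ∘ f)
  ≈-· {J = J} {D} σ {e} {f} p ι x = ⟦⟧-cong ι (val f) (to (⟦⟧-auto σ ι _) (⟦mapᴵ⟧⁻ h ι (λ _ → refl)
    (p (mapᴵ h ι) (⟦mapᴵ⟧⁺ h ι (λ _ → refl) (from (⟦⟧-auto σ ι _) (⟦⟧-cong ι (λ v → sym (val e v)) x))))))
    where
    h : J ⊎ Σ C (σ · D) → J ⊎ Σ C D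
    h = map₂ˢ λ (c , d) → Automorphism.from σ c , d
    val : ∀ (g : J → C) v → Automorphism.to σ ([ g , proj₁ ]′ (h v)) ≡ [ Automorphism.to σ ∘ g , proj₁ ]′ v
    val g (inj₁ _)       = refl
    val g (inj₂ (c , _)) = auto-invˡ σ c

  homogeneous : {J : Set ℓ} {D : Subset ℭ} → J ≺ κ̄ → Small D → {e f : J → C} → e ≈[ D ] f →
                Σ[ σ ∈ Automorphism ℭ ] (∀ j → Automorphism.to σ (e j) ≡ f j) × Fixes σ D
  homogeneous {J} {D} sJ sD {e} {f} p = σ , (λ j → h (inj₁ j)) ,
    λ d → let (i , q) = covers d in trans (cong (Automorphism.to σ) (sym q)) (trans (h (inj₂ i)) q)
    where
    open Enumeration (enumerate sD)
    ext-by : (J → C) → J ⊎ Index → C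
    ext-by g = [ g , proj₁ ∘ elem ]′
    val : ∀ g v → [ g , proj₁ ]′ (map₂ˢ elem v) ≡ ext-by g v
    val g (inj₁ _) = refl
    val g (inj₂ _) = refl
    fwd : ∀ {e f : J → C} → e ≈[ D ] f → ∀ (ι : Inst (J ⊎ Index)) → ⟦ ι ⟧ (ext-by e) → ⟦ ι ⟧ (ext-by f)
    fwd {e} {f} p ι x = ⟦mapᴵ⟧⁻ (map₂ˢ elem) ι (val f) (p (mapᴵ (map₂ˢ elem) ι)
      (⟦mapᴵ⟧⁺ (map₂ˢ elem) ι (λ v → sym (val e v)) x))
    r = stronglyHomogeneous (J ⊎ Index) (⊎-small sJ small) (ext-by e) (ext-by f)
          λ φ i → mk⇔ (fwd p (inst φ i)) (fwd (≈-sym p) (inst φ i))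
    σ = proj₁ r
    h = proj₂ r

  -- An ultrafilter on tuples stands for a global type in the variables `J`, namely what holds for
  -- almost all tuples; `e` realises its restriction to `D`.
  _⊩[_]_ : {J : Set ℓ} → (J → C) → Subset ℭ → Ultrafilter (J → C) → Set ℓ
  e ⊩[ D ] 𝒰 = ∀ ι → 𝒰 ∋ (λ f → ⟦ ι ⟧ [ f , proj₁ {B = D} ]′) → ⟦ ι ⟧ [ e , proj₁ ]′

  ⊩-≈ : {J : Set ℓ} (𝒰 : Ultrafilter (J → C)) {D : Subset ℭ} {e f : J → C} →
        e ⊩[ D ] 𝒰 → f ⊩[ D ] 𝒰 → e ≈[ D ] f
  ⊩-≈ 𝒰 p q ι x = q ι (stable λ n → p (¬ᴵ ι) (∋-¬⁺ 𝒰 n) x)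

  module _ {J : Set b} (ψ : Inst (Fin n ⊎ J)) where

    ≈⇒⟦⟧ : {D : Subset ℭ} {z z′ : Fin n → C} → z ≈[ D ] z′ → (f : J → C) → (∀ j → D (f j)) →
           ⟦ ψ ⟧ [ z , f ]′ → ⟦ ψ ⟧ [ z′ , f ]′
    ≈⇒⟦⟧ {D} {z} {z′} p f d s = ⟦mapᴵ⟧⁻ q ψ (λ v → sym (val z′ v)) (p (mapᴵ q ψ) (⟦mapᴵ⟧⁺ q ψ (val z) s))
      where
      q : Fin n ⊎ J → Fin n ⊎ Σ C D
      q = map₂ˢ λ j → f j , d j
      val : ∀ z v → [ z , f ]′ v ≡ [ z , proj₁ ]′ (q v)
      val z (inj₁ _) = refl
      val z (inj₂ _) = refl

    auto⇒⟦⟧ : (σ : Automorphism ℭ) {z : Fin n → C} {f f′ : J → C} → (∀ j → Automorphism.to σ (f j) ≡ f′ j) →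
              ⟦ ψ ⟧ [ z , f ]′ ⇔ ⟦ ψ ⟧ [ Automorphism.to σ ∘ z , f′ ]′
    auto⇒⟦⟧ σ h = mk⇔ (λ s → ⟦⟧-cong ψ val (to (⟦⟧-auto σ ψ _) s))
                      (λ s → from (⟦⟧-auto σ ψ _) (⟦⟧-cong ψ (λ v → sym (val v)) s))
      where
      val : ∀ v → Automorphism.to σ ([ _ , _ ]′ v) ≡ [ _ , _ ]′ v
      val (inj₁ _) = refl
      val (inj₂ j) = h j

  -- Realisations of types in infinitely many variables

  map-congⱽ : {V : Set b} {v w : V → C} {i : Vec V k} → Allⱽ (λ x → v x ≡ w x) i → map v i ≡ map w i
  map-congⱽ []       = refl
  map-congⱽ (p ∷ ps) = cong₂ _∷_ p (map-congⱽ ps)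

  -- Saturation speaks of finite tuples only, so a tuple indexed by `J` is built by recursion along
  -- a well-order of `J`, one coordinate at a time over those already chosen.
  module Realise {J : Set ℓ} (J-small : J ≺ κ̄) (𝒰 : Ultrafilter (J → C))
                 {D : Subset ℭ} (D-small : Small D) where

    private W = wellOrder J
    open WellOrder W

    Var : (J → Set ℓ) → Set ℓ
    Var P = Σ J P ⊎ Σ C D

    val : (J → C) → {P : J → Set ℓ} → Var P → C
    val g = [ g ∘ proj₁ , proj₁ ]′

    Good : J → (J → C) → C → Set ℓ
    Good j g c = (ι : Inst (Fin 1 ⊎ Var (_< j))) →
      𝒰 ∋ (λ f → ⟦ ι ⟧ [ (λ _ → f j) , val f ]′) → ⟦ ι ⟧ [ (λ _ → c) , val g ]′

    pick : J → (J → C) → C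
    pick j g with em {P = ∃ (Good j g)}
    ... | yes (c , _) = c
    ... | no _        = nonempty

    pick-good : ∀ {j g} → ∃ (Good j g) → Good j g (pick j g)
    pick-good {j} {g} h with em {P = ∃ (Good j g)}
    ... | yes (_ , p) = p
    ... | no n        = ⊥-elim (n h)

    open Recursion W nonempty pick

    Good-cong : ∀ {j g g′ c} → (∀ {i} → i < j → g i ≡ g′ i) → Good j g c → Good j g′ c
    Good-cong h p ι u = ⟦⟧-cong ι (λ { (inj₁ _) → refl ; (inj₂ (inj₁ (i , lt))) → h lt
                                     ; (inj₂ (inj₂ _)) → refl }) (p ι u)

    module _ {P : J → Set ℓ} (good : ∀ j → P j → Good j fix (fix j)) where

      AtMost : J → Var P → Set ℓ
      AtMost m (inj₁ (j , _)) = j ≡ m ⊎ j < m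
      AtMost m (inj₂ _)       = ⊤

      Outer : Var P → Set ℓ
      Outer (inj₁ _) = ⊥ᵖ
      Outer (inj₂ _) = ⊤

      at-most-mono : ∀ {m m′} → m < m′ → ∀ {v} → AtMost m v → AtMost m′ v
      at-most-mono lt {inj₁ (j , _)} (inj₁ refl) = inj₂ lt
      at-most-mono lt {inj₁ (j , _)} (inj₂ lt′)  = inj₂ (<-trans lt′ lt)
      at-most-mono lt {inj₂ _}       _           = tt

      outer-at-most : ∀ {m v} → Outer v → AtMost m v
      outer-at-most {v = inj₂ _} _ = tt

      bound : (i : Vec (Var P) k) → Allⱽ Outer i ⊎ ∃ λ m → P m × Allⱽ (AtMost m) i
      bound [] = inj₁ []
      bound (inj₂ _ ∷ i) with bound i
      ... | inj₁ o            = inj₁ (tt ∷ o)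
      ... | inj₂ (m , pm , h) = inj₂ (m , pm , tt ∷ h)
      bound (inj₁ (j , pj) ∷ i) with bound i
      ... | inj₁ o = inj₂ (j , pj , inj₁ refl ∷ mapⱽ outer-at-most o)
      ... | inj₂ (m , pm , h) with total j m
      ...   | inj₁ lt         = inj₂ (m , pm , inj₂ lt ∷ h)
      ...   | inj₂ (inj₁ e)   = inj₂ (m , pm , inj₁ e ∷ h)
      ...   | inj₂ (inj₂ lt)  = inj₂ (j , pj , inj₁ refl ∷ mapⱽ (at-most-mono lt) h)

      outer-const : ∀ f g {v} → Outer v → val f v ≡ val g v
      outer-const f g {inj₂ _} _ = refl

      move : ∀ m → Var P → Fin 1 ⊎ Var (_< m)
      move m (inj₂ d) = inj₂ (inj₂ d)
      move m (inj₁ (j , _)) with total j m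
      ... | inj₁ lt = inj₂ (inj₁ (j , lt))
      ... | inj₂ _  = inj₁ zero

      move-val : ∀ {m} g v → AtMost m v → [ (λ _ → g m) , val g ]′ (move m v) ≡ val g v
      move-val g (inj₂ _) _ = refl
      move-val {m} g (inj₁ (j , _)) h with total j m
      move-val g (inj₁ (j , _)) h           | inj₁ _ = refl
      move-val g (inj₁ (j , _)) h           | inj₂ (inj₁ refl) = refl
      move-val g (inj₁ (j , _)) (inj₁ refl) | inj₂ (inj₂ lt) = refl
      move-val g (inj₁ (j , _)) (inj₂ lt′)  | inj₂ (inj₂ lt) = ⊥-elim (<-irrefl W (<-trans lt lt′))

      -- Only finitely many coordinates occur in `ι`. With the largest one in the place of the new
      -- variable the claim is an instance of `Good`; if none occurs, the truth value does not
      -- depend on the tuple.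
      transfer : (ι : Inst (Var P)) → 𝒰 ∋ (λ f → ⟦ ι ⟧ (val f)) → ⟦ ι ⟧ (val fix)
      transfer (inst φ i) u with bound i
      ... | inj₁ o = let (f , h) = ∋-inh 𝒰 u in
        subst (ℭ ⊨ φ [_]) (map-congⱽ (mapⱽ (outer-const f fix) o)) h
      ... | inj₂ (m , pm , h) = subst (ℭ ⊨ φ [_]) (moved fix)
        (good m pm (inst φ (map (move m) i)) (∋-mono 𝒰 (λ f → subst (ℭ ⊨ φ [_]) (sym (moved f))) u))
        where
        moved : ∀ g → map [ (λ _ → g m) , val g ]′ (map (move m) i) ≡ map (val g) i
        moved g = trans (sym (map-∘ _ _ i)) (map-congⱽ (mapⱽ (λ {v} → move-val g v) h))

    module _ (j : J) (good : ∀ i → i < j → Good i fix (fix i)) where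

      w : Var (_< j) → C
      w = val fix

      InType : ParamFormula ℭ 1 → Set ℓ
      InType (φ ⟨ a ⟩) = ∃ λ i → map w i ≡ a × 𝒰 ∋ (λ f → ℭ ⊨ φ [ f j ∷ map (val f) i ])

      lift-params : {a : Vec C m} → Allⱽ (Range w) a → ∃ λ i → map w i ≡ a
      lift-params []             = [] , refl
      lift-params ((v , e) ∷ es) = let (i , p) = lift-params es in v ∷ i , cong₂ _∷_ e p

      in-range : (i : Vec (Var (_< j)) m) → Allⱽ (Range w) (map w i)
      in-range []      = []
      in-range (v ∷ i) = (v , refl) ∷ in-range i

      Requirement : ParamFormula ℭ 1 → Inst (Fin 1 ⊎ Var (_< j)) → Set ℓ
      Requirement θ ι = ∀ (x : Fin 1 → C) → ⟦ ι ⟧ [ x , w ]′ → SatisfiedBy ℭ (tabulate x) θ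

      requirement : ∀ θ → InType θ → ∃ λ ι →
        𝒰 ∋ (λ f → ⟦ ι ⟧ [ (λ _ → f j) , val f ]′) × Requirement θ ι
      requirement (φ ⟨ _ ⟩) (i , refl , u) = inst φ (inj₁ zero ∷ map inj₂ i) ,
        ∋-mono 𝒰 (λ f → subst (λ z → ℭ ⊨ φ [ f j ∷ z ]) (map-∘ _ _ i)) u ,
        λ x → subst (λ z → ℭ ⊨ φ [ x zero ∷ z ]) (sym (map-∘ _ _ i))

      requirements : ∀ {Φ} → All InType Φ → ∃ λ ιs →
        All (λ ι → 𝒰 ∋ (λ f → ⟦ ι ⟧ [ (λ _ → f j) , val f ]′)) ιs ×
        (∀ (x : Fin 1 → C) → All (λ ι → ⟦ ι ⟧ [ x , w ]′) ιs → All (SatisfiedBy ℭ (tabulate x)) Φ)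
      requirements []                = [] , [] , λ _ _ → []
      requirements {θ ∷ _} (h ∷ hs) = let (ι , u , r) = requirement θ h ; (ιs , us , rs) = requirements hs in
        ι ∷ ιs , u ∷ us , λ { x (p ∷ ps) → r x p ∷ rs x ps }

      -- That some element satisfies finitely many of the formulas is a statement about earlier
      -- coordinates; it holds for almost all tuples, hence by `transfer` for the coordinates chosen
      -- so far.
      next-type : S ℭ 1 (Range w)
      next-type = record
        { formulas    = InType
        ; over        = λ { (i , refl , _) → in-range i }
        ; complete    = cmpl
        ; satisfiable = sat
        }
        where
        cmpl : ∀ {m} (φ : Formula L (1 + m)) a → Allⱽ (Range w) a → InType (φ ⟨ a ⟩) ⊎ InType ((¬' φ) ⟨ a ⟩)
        cmpl φ a h with lift-params h
        ... | i , refl with ∋-split 𝒰 (λ f → ℭ ⊨ φ [ f j ∷ map (val f) i ])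
        ...   | inj₁ u = inj₁ (i , refl , u)
        ...   | inj₂ u = inj₂ (i , refl , u)
        sat : (Φ : List (ParamFormula ℭ 1)) → All InType Φ → ∃[ x ] All (SatisfiedBy ℭ x) Φ
        sat Φ hs with requirements hs
        ... | ιs , us , back =
          let (x , h) = ∃ᴵ⁻ (⋀ᴵ ιs) (transfer good (∃ᴵ (⋀ᴵ ιs)) (∋-mono 𝒰
                          (λ f p → ∃ᴵ⁺ (⋀ᴵ ιs) (λ _ → f j) (⋀ᴵ⁺ ιs p)) (∋-All 𝒰 us)))
          in tabulate x , back x (⋀ᴵ⁻ ιs h)

      range-w-small : Small (Range w)
      range-w-small = ⊆-small
        (λ { (inj₁ (i , _) , e) → inj₁ (i , e) ; (inj₂ (c , d) , e) → inj₂ (subst D e d) })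
        (∪-small (range-small J-small fix) D-small)

      exists-good : ∃ (Good j fix)
      exists-good with saturated (Range w) range-w-small next-type
      ... | x ∷ [] , h = x , λ ι u → subst id (holds-sort ι (λ _ → x) w)
        (h {Sorted.body (sort ι) ⟨ map w (Sorted.outer (sort ι)) ⟩} (Sorted.outer (sort ι) , refl , ∋-mono 𝒰
          (λ f → subst id (sym (holds-sort ι (λ _ → f j) (val f)))) u))

    all-good : ∀ j → Acc _<_ j → Good j fix (fix j)
    all-good j (acc rs) = Good-cong fix-below-≡ (subst (Good j (fix-below j)) (sym (fix-unfold j))
      (pick-good (let (c , p) = exists-good j λ i lt → all-good i (rs lt) in
        c , Good-cong (λ lt → sym (fix-below-≡ lt)) p)))

    abstract
      realisation : J → C
      realisation = fix

      realises : realisation ⊩[ D ] 𝒰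
      realises ι u = ⟦mapᴵ⟧⁻ h ι (λ { (inj₁ _) → refl ; (inj₂ _) → refl }) (transfer {P = λ _ → ⊤} (λ j _ → all-good j (wf j)) (mapᴵ h ι) (∋-mono 𝒰
          (λ f x → ⟦mapᴵ⟧⁺ h ι (λ { (inj₁ _) → refl ; (inj₂ _) → refl }) x) u))
        where
        h : J ⊎ Σ C D → Var (λ _ → ⊤)
        h = map₁ˢ (_, tt)

  ⊩-mono : {J : Set ℓ} (𝒰 : Ultrafilter (J → C)) {D D′ : Subset ℭ} {e : J → C} → D ⊆ D′ →
           e ⊩[ D′ ] 𝒰 → e ⊩[ D ] 𝒰
  ⊩-mono 𝒰 {e = e} i p ι u = ⟦mapᴵ⟧⁻ (widen i) ι (widen-val i e) (p (mapᴵ (widen i) ι)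
    (∋-mono 𝒰 (λ f → ⟦mapᴵ⟧⁺ (widen i) ι (λ v → sym (widen-val i f v))) u))

  -- The order type is whatever well-order `Λ` happens to carry: only the cardinality of the
  -- sequence is under control.
  module MorleySequence {J Λ : Set ℓ} (J-small : J ≺ κ̄) (Λ-small : Λ ≺ κ̄) (𝒰 : Ultrafilter (J → C))
                        {D : Subset ℭ} (D-small : Small D) where

    open WellOrder (wellOrder Λ)

    Earlier : Λ → (Λ → J → C) → Subset ℭ
    Earlier k g = D ∪ λ c → ∃ λ l → l < k × ∃ λ j → g l j ≡ c

    earlier-small : ∀ k g → Small (Earlier k g)
    earlier-small k g = ∪-small D-small (⊆-small (λ { (l , _ , j , e) → (l , j) , e })
      (range-small (×-small Λ-small J-small) λ (l , j) → g l j))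

    pick : Λ → (Λ → J → C) → J → C
    pick k g = Realise.realisation J-small 𝒰 (earlier-small k g)

    open Recursion (wellOrder Λ) (λ _ → nonempty) pick

    abstract
      sequence : Λ → J → C
      sequence = fix

    Before : Λ → Subset ℭ
    Before k = Earlier k sequence

    before-small : ∀ k → Small (Before k)
    before-small k = earlier-small k sequence

    abstract
      sequence-realises : ∀ k → sequence k ⊩[ Before k ] 𝒰
      sequence-realises k = subst (λ e → e ⊩[ Before k ] 𝒰) (sym (fix-unfold k))
        (⊩-mono 𝒰 {D′ = Earlier k (fix-below k)} {e = pick k (fix-below k)}
          (λ { (inj₁ d) → inj₁ d
             ; (inj₂ (l , lt , j , e)) → inj₂ (l , lt , j , trans (cong (λ f → f j) (fix-below-≡ lt)) e) })
          (Realise.realises J-small 𝒰 (earlier-small k (fix-below k))))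

  -- Complete types of finite tuples

  module _ {D : Subset ℭ} where

    attach : {a : Vec C m} → Allⱽ D a → Vec (Σ C D) m
    attach {a = []}    []       = []
    attach {a = c ∷ _} (d ∷ ds) = (c , d) ∷ attach ds

    map-attach : {a : Vec C m} (h : Allⱽ D a) → map proj₁ (attach h) ≡ a
    map-attach []       = refl
    map-attach (d ∷ ds) = cong (_ ∷_) (map-attach ds)

    all-proj₁ : (i : Vec (Σ C D) m) → Allⱽ D (map proj₁ i)
    all-proj₁ []            = []
    all-proj₁ ((_ , d) ∷ i) = d ∷ all-proj₁ i

    block : {a : Vec C m} → Formula L (n + m) → Allⱽ D a → Inst (Fin n ⊎ Σ C D)
    block φ h = inst φ (map inj₁ (allFin _) ++ map inj₂ (attach h))

    ⟦block⟧ : {a : Vec C m} (φ : Formula L (n + m)) (h : Allⱽ D a) (x : Fin n → C) →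
              ⟦ block φ h ⟧ [ x , proj₁ ]′ ≡ (ℭ ⊨ φ [ tabulate x ++ a ])
    ⟦block⟧ φ h x = cong (ℭ ⊨ φ [_]) (trans (map-++ _ (map inj₁ (allFin _)) _) (cong₂ _++_
      (trans (sym (map-∘ _ inj₁ (allFin _))) (sym (tabulate-allFin x)))
      (trans (sym (map-∘ _ inj₂ (attach h))) (map-attach h))))

    ≈⇒⊨ : {x y : Fin n → C} → x ≈[ D ] y → (φ : Formula L (n + m)) {a : Vec C m} → Allⱽ D a →
          ℭ ⊨ φ [ tabulate x ++ a ] → ℭ ⊨ φ [ tabulate y ++ a ]
    ≈⇒⊨ {x = x} {y} p φ h s = subst id (⟦block⟧ φ h y)
      (p (block φ h) (subst id (sym (⟦block⟧ φ h x)) s))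

    ⊨⇒≈ : {x y : Fin n → C} →
          (∀ {m} (φ : Formula L (n + m)) {a : Vec C m} → Allⱽ D a →
             ℭ ⊨ φ [ tabulate x ++ a ] → ℭ ⊨ φ [ tabulate y ++ a ]) →
          x ≈[ D ] y
    ⊨⇒≈ {x = x} {y} h ι s = subst id (holds-sort ι y proj₁)
      (h (Sorted.body (sort ι)) (all-proj₁ (Sorted.outer (sort ι)))
        (subst id (sym (holds-sort ι x proj₁)) s))

    tp : (Fin n → C) → S ℭ n D
    tp x = record
      { formulas    = λ { (φ ⟨ a ⟩) → Allⱽ D a × ℭ ⊨ φ [ tabulate x ++ a ] }
      ; over        = proj₁
      ; complete    = λ φ a h → case em of λ
          { (yes s) → inj₁ (h , s)
          ; (no s)  → inj₂ (h , s) }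
      ; satisfiable = λ Φ hs → tabulate x , mapᴬ proj₂ hs
      }

    infix 4 _⊨ₜ_

    _⊨ₜ_ : (Fin n → C) → S ℭ n D → Set ℓ
    x ⊨ₜ p = formulas p ⊆ SatisfiedBy ℭ (tabulate x)

    ⊨ₜ-tp : (x : Fin n → C) → x ⊨ₜ tp x
    ⊨ₜ-tp x = proj₂

    ⊨ₜ-realised : Small D → (p : S ℭ n D) → ∃ λ x → x ⊨ₜ p
    ⊨ₜ-realised s p = let (x , h) = saturated D s p in
      lookup x , λ {θ} q → subst (λ y → SatisfiedBy ℭ y θ) (sym (tabulate∘lookup x)) (h {θ} q)

    ∈-type : {x : Fin n → C} {p : S ℭ n D} → x ⊨ₜ p → (φ : Formula L (n + m)) {a : Vec C m} →
             Allⱽ D a → ℭ ⊨ φ [ tabulate x ++ a ] → φ ⟨ a ⟩ ∈ formulas p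
    ∈-type {p = p} h φ d s = [ id , (λ q → ⊥-elim (h q s)) ]′ (S.complete p φ _ d)

    ⊨ₜ-unique : {x y : Fin n → C} {p : S ℭ n D} → x ⊨ₜ p → y ⊨ₜ p → x ≈[ D ] y
    ⊨ₜ-unique {p = p} h g = ⊨⇒≈ λ φ d s → g (∈-type {p = p} h φ d s)

  ultra-type : (D : Subset ℭ) → Ultrafilter (Fin n → C) → S ℭ n D
  ultra-type D 𝒲 = record
    { formulas    = λ { (φ ⟨ a ⟩) → Allⱽ D a × Lift ℓ (𝒲 ∋ λ x → ℭ ⊨ φ [ tabulate x ++ a ]) }
    ; over        = proj₁
    ; complete    = λ φ a h → [ (λ u → inj₁ (h , lift u)) , (λ u → inj₂ (h , lift u)) ]′
                                (∋-split 𝒲 λ x → ℭ ⊨ φ [ tabulate x ++ a ])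
    ; satisfiable = λ Φ hs → let (x , h) = ∋-inh 𝒲 (∋-All 𝒲 (mapᴬ (λ (_ , u) → lower u) hs)) in
                             tabulate x , h
    }

  -- Small elementary submodels, by the Tarski-Vaught test

  Elementary : Subset ℭ → Set ℓ
  Elementary N = (ι : Inst (Fin 1 ⊎ Σ C N)) (x : Fin 1 → C) → ⟦ ι ⟧ [ x , proj₁ ]′ →
                 ∃ λ c → N c × ⟦ ι ⟧ [ (λ _ → c) , proj₁ ]′

  elementary-block : {N : Subset ℭ} → Elementary N → ∀ n (ι : Inst (Fin n ⊎ Σ C N)) (x : Fin n → C) →
                     ⟦ ι ⟧ [ x , proj₁ ]′ → ∃ λ y → (∀ i → N (y i)) × ⟦ ι ⟧ [ y , proj₁ ]′
  elementary-block el zero ι x h = x , (λ ()) , h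
  elementary-block {N} el (suc n) ι x h = y , inN , holdsι
    where
    shift : Fin (suc n) ⊎ Σ C N → Fin n ⊎ (Fin 1 ⊎ Σ C N)
    shift (inj₁ zero)    = inj₂ (inj₁ zero)
    shift (inj₁ (suc i)) = inj₁ i
    shift (inj₂ d)       = inj₂ (inj₂ d)
    shift-val : ∀ (x : Fin (suc n) → C) v →
                [ x , proj₁ ]′ v ≡ [ x ∘ suc , [ (λ _ → x zero) , proj₁ ]′ ]′ (shift v)
    shift-val x (inj₁ zero)    = refl
    shift-val x (inj₁ (suc i)) = refl
    shift-val x (inj₂ d)       = refl
    first : ∃ λ c → N c × ⟦ ∃ᴵ (mapᴵ shift ι) ⟧ [ (λ _ → c) , proj₁ ]′
    first = el (∃ᴵ (mapᴵ shift ι)) (λ _ → x zero) (∃ᴵ⁺ (mapᴵ shift ι) (x ∘ suc)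
      (⟦mapᴵ⟧⁺ shift ι (shift-val x) h))
    c₀ = proj₁ first
    plug : Fin n ⊎ (Fin 1 ⊎ Σ C N) → Fin n ⊎ Σ C N
    plug = map₂ˢ [ (λ _ → c₀ , proj₁ (proj₂ first)) , id ]′
    plug-val : ∀ (z : Fin n → C) v → [ z , [ (λ _ → c₀) , proj₁ ]′ ]′ v ≡ [ z , proj₁ ]′ (plug v)
    plug-val z (inj₁ _)        = refl
    plug-val z (inj₂ (inj₁ _)) = refl
    plug-val z (inj₂ (inj₂ _)) = refl
    middle = ∃ᴵ⁻ (mapᴵ shift ι) (proj₂ (proj₂ first))
    rest = elementary-block el n (mapᴵ plug (mapᴵ shift ι)) (proj₁ middle)
      (⟦mapᴵ⟧⁺ plug (mapᴵ shift ι) (plug-val (proj₁ middle)) (proj₂ middle))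
    y : Fin (suc n) → C
    y zero    = c₀
    y (suc i) = proj₁ rest i
    inN : ∀ i → N (y i)
    inN zero    = proj₁ (proj₂ first)
    inN (suc i) = proj₁ (proj₂ rest) i
    holdsι : ⟦ ι ⟧ [ y , proj₁ ]′
    holdsι = ⟦mapᴵ⟧⁻ shift ι (λ v → sym (shift-val y v)) (⟦mapᴵ⟧⁻ plug (mapᴵ shift ι) (λ v → sym (plug-val (proj₁ rest) v)) (proj₂ (proj₂ rest)))

  module SkolemHull {A : Subset ℭ} (A-small : Small A) where

    open Enumeration (enumerate A-small)

    -- Elements of the hull are named by codes that record how they arise as witnesses. Smallness is
    -- counted on the codes, several of which may name the same element.
    Level≤ : ℕ → Set ℓ
    value  : ∀ k → Level≤ k → C

    Level≤ zero    = Index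
    Level≤ (suc k) = Level≤ k ⊎ Inst (Fin 1 ⊎ Level≤ k)

    skolem : {V : Set ℓ} → Inst (Fin 1 ⊎ V) → (V → C) → C
    skolem ι v with em {P = ∃ λ (x : Fin 1 → C) → ⟦ ι ⟧ [ x , v ]′}
    ... | yes (x , _) = x zero
    ... | no _        = nonempty

    value zero    i        = proj₁ (elem i)
    value (suc k) (inj₁ h) = value k h
    value (suc k) (inj₂ ι) = skolem ι (value k)

    skolem-holds : {V : Set ℓ} (ι : Inst (Fin 1 ⊎ V)) {v : V → C} (x : Fin 1 → C) → ⟦ ι ⟧ [ x , v ]′ →
                   ⟦ ι ⟧ [ (λ _ → skolem ι v) , v ]′
    skolem-holds ι {v} x h with em {P = ∃ λ (x : Fin 1 → C) → ⟦ ι ⟧ [ x , v ]′}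
    ... | yes (y , g) = ⟦⟧-cong ι (λ { (inj₁ zero) → refl ; (inj₂ _) → refl }) g
    ... | no n        = ⊥-elim (n (x , h))

    level-small : ∀ k → Level≤ k ≺ κ̄
    level-small zero    = small
    level-small (suc k) = ⊎-small (level-small k)
      (inst-small (⊎-Fin-small (level-small k)))
      where
      ⊎-Fin-small : {V : Set ℓ} → V ≺ κ̄ → (Fin 1 ⊎ V) ≺ κ̄
      ⊎-Fin-small {V} s = surj-small {X = Lift ℓ (Fin 1) ⊎ V} (map₁ˢ lower)
        (λ { (inj₁ i) → inj₁ (lift i) , refl ; (inj₂ v) → inj₂ v , refl }) (⊎-small (Lift-small Fin-small) s)

    hull : Subset ℭ
    hull = Range {I = Σ ℕ Level≤} λ (k , h) → value k h

    hull-small : Small hull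
    hull-small = range-small (Σℕ-small level-small) _

    ⊆-hull : A ⊆ hull
    ⊆-hull d = let (i , e) = covers d in (0 , i) , e

    raise : {c : C} → ∀ k (h : Level≤ k) → value k h ≡ c → ∀ l → k ≤ l → ∃ λ g → value l g ≡ c
    raise k h e l k≤l = go (≤⇒≤′ k≤l)
      where
      open import Data.Nat.Base using (_≤′_; ≤′-refl; ≤′-step)
      open import Data.Nat.Properties using (≤⇒≤′)
      go : ∀ {l} → k ≤′ l → ∃ λ g → value l g ≡ _
      go ≤′-refl       = h , e
      go (≤′-step k≤l) = let (g , p) = go k≤l in inj₁ g , p

    common-level : (i : Vec (Fin 1 ⊎ Σ C hull) m) → Eventually λ k → ∃ λ (j : Vec (Fin 1 ⊎ Level≤ k) m) →
                   ∀ (x : Fin 1 → C) → map [ x , value k ]′ j ≡ map [ x , proj₁ ]′ i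
    common-level []           = 0 , λ k _ → [] , λ x → refl
    common-level (inj₁ z ∷ i) = eventually-map (λ (j , e) → inj₁ z ∷ j , λ x → cong (x z ∷_) (e x))
                                               (common-level i)
    common-level (inj₂ (c , (k , h) , e) ∷ i) = eventually-map
      (λ ((g , p) , (j , q)) → inj₂ g ∷ j , λ x → cong₂ _∷_ p (q x))
      (eventually-× (k , raise k h e) (common-level i))

    hull-elementary : Elementary hull
    hull-elementary (inst φ i) x s with common-level i
    ... | k , h with h k (≤-refl)
      where open import Data.Nat.Properties using (≤-refl)
    ...   | j , e = value (suc k) (inj₂ (inst φ j)) , ((suc k , inj₂ (inst φ j)) , refl) ,
      subst (ℭ ⊨ φ [_]) (e _) (skolem-holds (inst φ j) x (subst (ℭ ⊨ φ [_]) (sym (e x)) s))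

  record SmallModel (A : Subset ℭ) : Set (lsuc ℓ) where
    field
      N          : Subset ℭ
      N-small    : Small N
      elementary : Elementary N
      includes   : A ⊆ N

  löwenheim-skolem : {A : Subset ℭ} → Small A → SmallModel A
  löwenheim-skolem s = record
    { N = hull ; N-small = hull-small ; elementary = hull-elementary ; includes = ⊆-hull }
    where open SkolemHull s

  module Submodel {N : Subset ℭ} (N-small : Small N) (el : Elementary N) where

    -- A Boolean membership proof is unique, so the carrier has no duplicates; otherwise equality in
    -- the submodel would not agree with equality in `ℭ`.
    Carrierᴺ : Set ℓ
    Carrierᴺ = Σ C λ c → ⌊ N c ⌋ ≡ true

    as-param : Carrierᴺ → Σ C N
    as-param (c , p) = c , ⌊⌋-sound p

    carrier-≡ : {x y : Carrierᴺ} → proj₁ x ≡ proj₁ y → x ≡ y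
    carrier-≡ {x , p} {_ , q} refl = cong (x ,_) (uip p q)

    map-param : (v : Vec Carrierᴺ k) → map proj₁ (map as-param v) ≡ map proj₁ v
    map-param v = sym (map-∘ proj₁ as-param v)

    evals-vars : {w : Vec C l} (v : Vec C k) {ρ : Fin k → Fin l} → (∀ i → lookup w (ρ i) ≡ lookup v i) →
                 evals ℭ w (tabulate (var ∘ ρ)) ≡ v
    evals-vars []      h = refl
    evals-vars (c ∷ v) h = cong₂ _∷_ (h zero) (evals-vars v (h ∘ suc))

    with-params : (v : Vec Carrierᴺ k) (x : Fin 1 → C) →
                  map [ x , proj₁ {B = N} ]′ (map inj₂ (map as-param v)) ≡ map proj₁ v
    with-params v x = trans (sym (map-∘ _ inj₂ (map as-param v))) (map-param v)

    fun-closed : (f : Fun k) (v : Vec Carrierᴺ k) → N (⟦ f ⟧ᶠ (map proj₁ v))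
    fun-closed {k} f v = subst N (trans (proj₂ (proj₂ found)) (cong ⟦ f ⟧ᶠ (args _))) (proj₁ (proj₂ found))
      where
      ι : Inst (Fin 1 ⊎ Σ C N)
      ι = inst (var zero ≗ fun f (tabulate (var ∘ suc))) (inj₁ zero ∷ map inj₂ (map as-param v))
      args : ∀ (x : Fin 1 → C) → evals ℭ (x zero ∷ map [ x , proj₁ ]′ (map inj₂ (map as-param v)))
               (tabulate (var ∘ suc)) ≡ map proj₁ v
      args x = trans (evals-vars (map [ x , proj₁ ]′ (map inj₂ (map as-param v))) λ i → refl) (with-params v x)
      found = el ι (λ _ → ⟦ f ⟧ᶠ (map proj₁ v)) (sym (cong ⟦ f ⟧ᶠ (args _)))

    structure : Structure L
    structure = record
      { Carrier  = Carrierᴺ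
      ; nonempty = let (c , d , _) = el ⊤ᴵ (λ _ → nonempty)
                         (⟦⊤ᴵ⟧ {V = Fin 1 ⊎ Σ C N} [ (λ _ → nonempty) , proj₁ ]′) in c , ⌊⌋-true d
      ; ⟦_⟧ᶠ     = λ f v → ⟦ f ⟧ᶠ (map proj₁ v) , ⌊⌋-true (fun-closed f v)
      ; ⟦_⟧ʳ     = λ r v → ⟦ r ⟧ʳ (map proj₁ v)
      }

    eval-sub  : (v : Vec Carrierᴺ k) (t : Term L k) → proj₁ (eval structure v t) ≡ eval ℭ (map proj₁ v) t
    evals-sub : (v : Vec Carrierᴺ k) (ts : Vec (Term L k) l) →
                map proj₁ (evals structure v ts) ≡ evals ℭ (map proj₁ v) ts
    eval-sub v (var i)    = sym (lookup-map i proj₁ v)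
    eval-sub v (fun f ts) = cong ⟦ f ⟧ᶠ (evals-sub v ts)
    evals-sub v []       = refl
    evals-sub v (t ∷ ts) = cong₂ _∷_ (eval-sub v t) (evals-sub v ts)

    ⊨-sub : (φ : Formula L k) (v : Vec Carrierᴺ k) → (structure ⊨ φ [ v ]) ⇔ (ℭ ⊨ φ [ map proj₁ v ])
    ⊨-sub (s ≗ t) v = mk⇔
      (λ e → trans (sym (eval-sub v s)) (trans (cong proj₁ e) (eval-sub v t)))
      (λ e → carrier-≡ (trans (eval-sub v s) (trans e (sym (eval-sub v t)))))
    ⊨-sub (rel r ts) v = mk⇔ (subst ⟦ r ⟧ʳ (evals-sub v ts)) (subst ⟦ r ⟧ʳ (sym (evals-sub v ts)))
    ⊨-sub (¬' φ) v = mk⇔ (λ n x → n (from (⊨-sub φ v) x)) (λ n x → n (to (⊨-sub φ v) x))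
    ⊨-sub (φ ∧ ψ) v = mk⇔
      (λ (x , y) → to (⊨-sub φ v) x , to (⊨-sub ψ v) y)
      (λ (x , y) → from (⊨-sub φ v) x , from (⊨-sub ψ v) y)
    ⊨-sub (∃' φ) v = mk⇔
      (λ (c , x) → proj₁ c , to (⊨-sub φ (c ∷ v)) x)
      (λ (c , x) → let (d , dN , y) = el (inst φ (inj₁ zero ∷ map inj₂ (map as-param v))) (λ _ → c)
                         (subst (λ w → ℭ ⊨ φ [ c ∷ w ]) (sym (with-params v _)) x)
                   in (d , ⌊⌋-true dN) , from (⊨-sub φ ((d , ⌊⌋-true dN) ∷ v))
                        (subst (λ w → ℭ ⊨ φ [ d ∷ w ]) (with-params v _) y))

    embedding : ElementaryEmbedding structure ℭ
    embedding = record { to = proj₁ ; elementary = ⊨-sub }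

    carrier-small : Carrierᴺ ≺ κ̄
    carrier-small = let (I , s , e , h) = N-small in ↣-small
      (inject (λ (c , p) → proj₁ (h c (⌊⌋-sound p)))
        (λ { {c , p} {d , q} r → carrier-≡ (trans (sym (proj₂ (h c (⌊⌋-sound p))))
          (trans (cong e r) (proj₂ (h d (⌊⌋-sound q))))) })) s

    fixes-model : {A : Subset ℭ} → A ⊆ N → ∀ {σ} → Fixes σ N → FixesModelContaining A σ
    fixes-model i fx = structure , carrier-small , embedding ,
      (λ c d → (c , ⌊⌋-true (i d)) , refl) , λ (c , p) → fx (⌊⌋-sound p)

  -- Lascar equivalence and splitting over models

  image-elementary : {N : Structure L} (e : ElementaryEmbedding N ℭ) →
                     Elementary (Range (ElementaryEmbedding.to e))
  image-elementary {N} e ι x h = result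
    where
    module e = ElementaryEmbedding e
    pull : Fin 1 ⊎ Σ C (Range e.to) → Fin 1 ⊎ Structure.Carrier N
    pull = map₂ˢ λ (_ , y , _) → y
    pull-val : ∀ (x : Fin 1 → C) v → [ x , proj₁ ]′ v ≡ [ x , e.to ]′ (pull v)
    pull-val x (inj₁ _)           = refl
    pull-val x (inj₂ (_ , _ , p)) = sym p
    s = sort (mapᴵ pull ι)
    body  = Sorted.body s
    outer = Sorted.outer s
    in-N = from (e.elementary (∃' body) outer) (x zero , subst id (sym (holds-sort (mapᴵ pull ι) x e.to))
      (⟦mapᴵ⟧⁺ pull ι (pull-val x) h))
    result : ∃ λ c → Range e.to c × ⟦ ι ⟧ [ (λ _ → c) , proj₁ ]′
    result = e.to (proj₁ in-N) , (proj₁ in-N , refl) , ⟦mapᴵ⟧⁻ pull ι (λ v → sym (pull-val _ v)) (subst id (holds-sort (mapᴵ pull ι) _ e.to)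
        (to (e.elementary body (proj₁ in-N ∷ outer)) (proj₂ in-N)))

  -- Homogeneity turns equality of types over `N` into an automorphism fixing `N`, which is a
  -- generator of `Autf`.
  model⇒lascar : {A N : Subset ℭ} → Small N → Elementary N → A ⊆ N → {a b : Vec C m} →
                 lookup a ≈[ N ] lookup b → LascarEquivalent A a b
  model⇒lascar {A = A} {N} s el i {a} {b} p =
    let (σ , h , fx) = homogeneous {J = Lift ℓ (Fin _)} (Lift-small Fin-small) s (≈-∘ lower p) in
    σ , generator (Submodel.fixes-model s el {A} i {σ} fx) ,
    trans (cong (map (Automorphism.to σ)) (sym (tabulate∘lookup a)))
      (trans (sym (tabulate-∘ (Automorphism.to σ) (lookup a)))
        (trans (tabulate-cong λ j → h (lift j)) (tabulate∘lookup b)))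

  SplitsOverModel : {A : Subset ℭ} → S ℭ n (whole ℭ) → SmallModel A → Set ℓ
  SplitsOverModel {n} r M = ∃ λ m → Σ[ φ ∈ Formula L (n + m) ] ∃ λ a → ∃ λ b →
    lookup a ≈[ SmallModel.N M ] lookup b × φ ⟨ a ⟩ ∈ formulas r × (¬' φ) ⟨ b ⟩ ∈ formulas r

  type-consistent : {D : Subset ℭ} (p : S ℭ n D) {φ : Formula L (n + m)} {a : Vec C m} →
                    φ ⟨ a ⟩ ∈ formulas p → ¬ ((¬' φ) ⟨ a ⟩ ∈ formulas p)
  type-consistent p h g with S.satisfiable p (_ ∷ _ ∷ []) (h ∷ g ∷ [])
  ... | x , s ∷ t ∷ [] = t s

  all-whole : (a : Vec C m) → Allⱽ (whole ℭ) a
  all-whole []      = []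
  all-whole (_ ∷ a) = tt ∷ all-whole a

  -- A type splitting over no small model that contains `A` is preserved by every generator of
  -- `Autf`, hence by the whole group, and then it cannot Lascar-split.
  lascar-splits⇒splits : {A : Subset ℭ} (r : S ℭ n (whole ℭ)) → LascarSplitsOver A r →
                         ∃ (SplitsOverModel {A = A} r)
  lascar-splits⇒splits {n} {A} r (m , φ , a , b , (σ , autf , refl) , h , g) = stable λ none →
    let
      step : ∀ σ → FixesModelContaining A σ → Invariant σ
      step σ (N , s , e , i , fx) φ a h = [ id , (λ g → ⊥-elim (none (
          record { N = Range (ElementaryEmbedding.to e) ; N-small = range-small s _
                 ; elementary = image-elementary e ; includes = λ {c} → i c }
        , _ , φ , a , _ , (λ ι t → ⟦⟧-cong ι
            (λ { (inj₁ j) → sym (lookup-map j (Automorphism.to σ) a) ; (inj₂ _) → refl })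
            (≈-auto σ (λ { (x , refl) → fx x }) (lookup a) ι t)) , h , g))) ]′
        (S.complete r φ (map (Automorphism.to σ) a) (all-whole _))
    in type-consistent r (preserve step σ autf φ a h) g
    where
    member : ∀ {m} → Formula L (n + m) → Vec C m → Set ℓ
    member φ a = φ ⟨ a ⟩ ∈ formulas r

    Invariant : Automorphism ℭ → Set ℓ
    Invariant σ = ∀ {m} (φ : Formula L (n + m)) a → member φ a → member φ (map (Automorphism.to σ) a)

    backwards : ∀ σ → Invariant σ → ∀ {m} (φ : Formula L (n + m)) a →
                member φ (map (Automorphism.to σ) a) → member φ a
    backwards σ inv φ a h = [ id , (λ g → ⊥-elim (type-consistent r h (inv (¬' φ) a g))) ]′
      (S.complete r φ a (all-whole a))

    preserve : (∀ σ → FixesModelContaining A σ → Invariant σ) → ∀ σ → Autf A σ → Invariant σ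
    preserve step σ (generator f) = step σ f
    preserve step _ identity φ a h = subst (member φ) (sym (map-id a)) h
    preserve step _ (composition {τ} {σ} t s) φ a h = subst (member φ)
      (sym (map-∘ (Automorphism.to τ) (Automorphism.to σ) a))
      (preserve step τ t φ _ (preserve step σ s φ a h))
    preserve step _ (inverse {σ} s) φ a h = backwards σ (preserve step σ s) φ _
      (subst (member φ) (sym (trans (sym (map-∘ (Automorphism.to σ) (Automorphism.from σ) a))
        (trans (map-cong (auto-invˡ σ) a) (map-id a)))) h)

  -- Coheirs

  Finitary : ℕ → Set ℓ
  Finitary m = Lift ℓ (Fin m)

  -- A global coheir of tp(e/N): `over-N` makes the type given by `𝒰` finitely satisfiable in `N`.
  record Coheir {N : Subset ℭ} (e : Finitary m → C) : Set ℓ where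
    field
      𝒰         : Ultrafilter (Finitary m → C)
      over-N    : 𝒰 ∋ λ f → ∀ j → N (f j)
      extends   : (ι : Inst (Finitary m ⊎ Σ C N)) → ⟦ ι ⟧ [ e , proj₁ ]′ → 𝒰 ∋ λ f → ⟦ ι ⟧ [ f , proj₁ ]′

    base-≈ : {f : Finitary m → C} → f ⊩[ N ] 𝒰 → e ≈[ N ] f
    base-≈ h ι s = h ι (extends ι s)

  coheir : {N : Subset ℭ} → Elementary N → (e : Finitary m → C) → Coheir {N = N} e
  coheir {m} {N} el e = record { 𝒰 = 𝒰 ; over-N = ∋-mono 𝒰 (λ _ → proj₁) (∈𝒰 (⊤ᴵ , ⟦⊤ᴵ⟧ {V = V} [ e , proj₁ ]′))
                               ; extends = λ ι s → ∋-mono 𝒰 (λ _ → proj₂) (∈𝒰 (ι , s)) }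
    where
    V = Finitary m ⊎ Σ C N
    G : (Σ (Inst V) λ ι → ⟦ ι ⟧ [ e , proj₁ ]′) → (Finitary m → C) → Set ℓ
    G (ι , _) f = (∀ j → N (f j)) × ⟦ ι ⟧ [ f , proj₁ ]′
    unlift : V → Fin m ⊎ Σ C N
    unlift = map₁ˢ lower
    unlift-val : ∀ (f : Finitary m → C) v → [ f , proj₁ ]′ v ≡ [ f ∘ lift , proj₁ ]′ (unlift v)
    unlift-val f (inj₁ _) = refl
    unlift-val f (inj₂ _) = refl
    all-true : ∀ Ls → All (λ ι → ⟦ ι ⟧ [ e , proj₁ ]′) (mapᴸ proj₁ Ls)
    all-true []             = []
    all-true ((_ , s) ∷ Ls) = s ∷ all-true Ls
    back : ∀ {f} Ls → (∀ j → N (f j)) → All (λ ι → ⟦ ι ⟧ [ f , proj₁ ]′) (mapᴸ proj₁ Ls) → All (λ i → G i f) Ls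
    back []       d []       = []
    back (_ ∷ Ls) d (x ∷ xs) = (d , x) ∷ back Ls d xs
    fip : ∀ Ls → ∃ λ f → All (λ i → G i f) Ls
    fip Ls = let
        ι = ⋀ᴵ (mapᴸ proj₁ Ls)
        (y , d , s) = elementary-block el m (mapᴵ unlift ι) (e ∘ lift)
          (⟦mapᴵ⟧⁺ unlift ι (unlift-val e) (⋀ᴵ⁺ _ (all-true Ls)))
      in y ∘ lower , back Ls (d ∘ lower) (⋀ᴵ⁻ (mapᴸ proj₁ Ls) (⟦mapᴵ⟧⁻ unlift ι (λ v → sym (unlift-val _ v)) s))
    𝒰 = proj₁ (fip⇒ultrafilter G fip)
    ∈𝒰 = proj₂ (fip⇒ultrafilter G fip)

  -- Coheirs are invariant: for f in N the truth of ι(a,f) depends only on tp(a/N).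
  coheir-swap : {N : Subset ℭ} {e : Finitary m → C} (co : Coheir {N = N} e) {J : Set ℓ}
                {a a′ : J → C} → a ≈[ N ] a′ →
                {f f′ : Finitary m → C} → f ⊩[ N ∪ Range a ] Coheir.𝒰 co → f′ ⊩[ N ∪ Range a′ ] Coheir.𝒰 co →
                [ a , f ]′ ≈[ N ] [ a′ , f′ ]′
  coheir-swap {m} {N} co {J} {a} {a′} p {f} {f′} h h′ ι s = stable λ n →
    ∋-¬ 𝒰 (∋-¬⁺ 𝒰 λ u → n (eval-in a′ f′ h′ ι u)) (∋-mono 𝒰 (λ g (d , t) → transport g d t)
      (∋-× 𝒰 over-N (stable λ k → eval-in a f h (¬ᴵ ι) (∋-¬⁺ 𝒰 k) s)))
    where
    open Coheir co
    at : (J → C) → (Finitary m → C) → (J ⊎ Finitary m) ⊎ Σ C N → C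
    at a g = [ [ a , g ]′ , proj₁ ]′
    eval-in : ∀ a f → f ⊩[ N ∪ Range a ] 𝒰 → ∀ ι → 𝒰 ∋ (λ g → ⟦ ι ⟧ (at a g)) → ⟦ ι ⟧ (at a f)
    eval-in a f h ι u = ⟦mapᴵ⟧⁻ q ι (λ v → sym (q-val f v)) (h (mapᴵ q ι) (∋-mono 𝒰 (λ g t → ⟦mapᴵ⟧⁺ q ι (q-val g) t) u))
      where
      q : (J ⊎ Finitary m) ⊎ Σ C N → Finitary m ⊎ Σ C (N ∪ Range a)
      q (inj₁ (inj₁ j))  = inj₂ (a j , inj₂ (j , refl))
      q (inj₁ (inj₂ x))  = inj₁ x
      q (inj₂ (c , d))   = inj₂ (c , inj₁ d)
      q-val : ∀ g v → at a g v ≡ [ g , proj₁ ]′ (q v)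
      q-val g (inj₁ (inj₁ j)) = refl
      q-val g (inj₁ (inj₂ x)) = refl
      q-val g (inj₂ _)        = refl
    transport : ∀ g → (∀ j → N (g j)) → ⟦ ι ⟧ (at a g) → ⟦ ι ⟧ (at a′ g)
    transport g d t = ⟦mapᴵ⟧⁻ q ι (λ v → sym (q-val a′ v)) (p (mapᴵ q ι) (⟦mapᴵ⟧⁺ q ι (q-val a) t))
      where
      q : (J ⊎ Finitary m) ⊎ Σ C N → J ⊎ Σ C N
      q (inj₁ (inj₁ j)) = inj₁ j
      q (inj₁ (inj₂ x)) = inj₂ (g x , d x)
      q (inj₂ v)        = inj₂ v
      q-val : ∀ a v → at a g v ≡ [ a , proj₁ ]′ (q v)
      q-val a (inj₁ (inj₁ j)) = refl
      q-val a (inj₁ (inj₂ x)) = refl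
      q-val a (inj₂ _)        = refl

  -- The rank U on realisations, and U at most SUⁱ

  Rk : Ord (lsuc ℓ) → (Fin n → C) → Subset ℭ → Set (lsuc ℓ)
  Rk Ord.zero    x D = ⊤
  Rk (Ord.suc α) x D = (κ : Set ℓ) → κ ≺ κ̄ →
    Σ[ B ∈ Subset ℭ ] Small B × D ⊆ B × Σ[ y ∈ (κ → Fin _ → C) ]
      (∀ {i j} → y i ≈[ B ] y j → i ≡ j) × (∀ i → x ≈[ D ] y i × Rk α (y i) B)
  Rk (lim I f)   x D = ∀ i → Rk (f i) x D

  Rk-antitone : ∀ α {x : Fin n → C} {D B} → B ⊆ D → Rk α x D → Rk α x B
  Rk-antitone Ord.zero    i h = tt
  Rk-antitone (Ord.suc α) i h κ s = let (B , sB , j , y , inj , g) = h κ s in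
    B , sB , (λ b → j (i b)) , y , inj , λ k → ≈-mono i (proj₁ (g k)) , proj₂ (g k)
  Rk-antitone (lim I f)   i h = λ k → Rk-antitone (f k) i (h k)

  Rk-≈ : ∀ α {x x′ : Fin n → C} {D} → x ≈[ D ] x′ → Rk α x D → Rk α x′ D
  Rk-≈ Ord.zero    p h = tt
  Rk-≈ (Ord.suc α) p h κ s = let (B , sB , j , y , inj , g) = h κ s in
    B , sB , j , y , inj , λ k → ≈-trans (≈-sym p) (proj₁ (g k)) , proj₂ (g k)
  Rk-≈ (lim I f)   p h = λ k → Rk-≈ (f k) p (h k)

  ≈-·⁻ : {J : Set b} {D : Subset ℭ} (σ : Automorphism ℭ) {e f : J → C} →
         (Automorphism.to σ ∘ e) ≈[ σ · D ] (Automorphism.to σ ∘ f) → e ≈[ D ] f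
  ≈-·⁻ {D = D} σ p = ≈-trans (≈-pointwise λ j → sym (auto-invʳ σ _)) (≈-trans
    (≈-mono (λ {c} d → subst D (sym (auto-invʳ σ c)) d) (≈-· (σ ⁻¹) p)) (≈-pointwise λ j → auto-invʳ σ _))

  Rk-auto : ∀ α (σ : Automorphism ℭ) {x : Fin n → C} {D} → Rk α x D → Rk α (Automorphism.to σ ∘ x) (σ · D)
  Rk-auto Ord.zero    σ h = tt
  Rk-auto (Ord.suc α) σ h κ s = let (B , sB , j , y , inj , g) = h κ s in
    σ · B , ·-small σ sB , (λ d → j d) , (λ k → Automorphism.to σ ∘ y k) , (λ e → inj (≈-·⁻ σ e)) ,
    λ k → ≈-· σ (proj₁ (g k)) , Rk-auto α σ (proj₂ (g k))
  Rk-auto (lim I f)   σ h = λ k → Rk-auto (f k) σ (h k)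

  Rk-auto⁻ : ∀ α (σ : Automorphism ℭ) {x : Fin n → C} {D} → Rk α (Automorphism.to σ ∘ x) (σ · D) → Rk α x D
  Rk-auto⁻ α σ {x} {D} h = Rk-≈ α (≈-pointwise λ j → auto-invʳ σ _)
    (Rk-antitone α (λ {c} d → subst D (sym (auto-invʳ σ c)) d) (Rk-auto α (σ ⁻¹) h))

  ≈⇒type-≈ : {B : Subset ℭ} {q q′ : S ℭ n B} {y y′ : Fin n → C} → y ⊨ₜ q → y′ ⊨ₜ q′ → y ≈[ B ] y′ → q ≈ q′
  ≈⇒type-≈ {q = q} {q′} h h′ p =
    (λ { {φ ⟨ a ⟩} m → ∈-type {p = q′} h′ φ (S.over q m) (≈⇒⊨ p φ (S.over q m) (h m)) }) ,
    (λ { {φ ⟨ a ⟩} m → ∈-type {p = q} h φ (S.over q′ m) (≈⇒⊨ (≈-sym p) φ (S.over q′ m) (h′ m)) })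

  U⇒Rk : ∀ α {A : Subset ℭ} {p : S ℭ n A} {x : Fin n → C} → x ⊨ₜ p → U≥ α p → Rk α x A
  U⇒Rk Ord.zero    h u = tt
  U⇒Rk (Ord.suc α) {p = p} h u κ s =
    let (B , sB , i , q , inj , g) = u κ s
        y = λ k → ⊨ₜ-realised sB (q k)
    in B , sB , (λ a → i a) , (λ k → proj₁ (y k)) ,
       (λ {k} {l} e → inj (≈⇒type-≈ {q = q k} {q l} (proj₂ (y k)) (proj₂ (y l)) e)) ,
       λ k → ⊨ₜ-unique {p = p} h (λ m → proj₂ (y k) (proj₁ (g k) m)) , U⇒Rk α {p = q k} (proj₂ (y k)) (proj₂ (g k))
  U⇒Rk (lim I f) {p = p} h u = λ k → U⇒Rk (f k) {p = p} h (u k)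

  ⊑-tp : {A B : Subset ℭ} {p : S ℭ n A} {x y : Fin n → C} → A ⊆ B → x ⊨ₜ p → x ≈[ A ] y → p ⊑ tp {D = B} y
  ⊑-tp {p = p} i h e {φ ⟨ a ⟩} m = mapⱽ (λ d → i d) (S.over p m) , ≈⇒⊨ e φ (S.over p m) (h m)

  Rk⇒U : ∀ α {A : Subset ℭ} {p : S ℭ n A} {x : Fin n → C} → x ⊨ₜ p → Rk α x A → U≥ α p
  Rk⇒U Ord.zero    h u = tt
  Rk⇒U (Ord.suc α) {p = p} h u κ s =
    let (B , sB , i , y , inj , g) = u κ s
    in B , sB , (λ a → i a) , (λ k → tp (y k)) ,
       (λ { (e , _) → inj (⊨⇒≈ λ φ d t → proj₂ (e {φ ⟨ _ ⟩} (d , t))) }) ,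
       λ k → ⊑-tp {p = p} i h (proj₁ (g k)) , Rk⇒U α {p = tp (y k)} (λ {θ} → ⊨ₜ-tp (y k) {θ}) (proj₂ (g k))
  Rk⇒U (lim I f) {p = p} h u = λ k → Rk⇒U (f k) {p = p} h (u k)

  -- A global type that does not split over A is determined by the set of pairs
  -- (φ , tp(a/N)) with φ(x,a) in it, for a small model N containing A.
  module NonSplitting {A : Subset ℭ} (A-small : Small A) (n : ℕ) where

    open SmallModel (löwenheim-skolem A-small)
    open Enumeration (enumerate N-small)

    TypeCode : ℕ → Set ℓ
    TypeCode m = Inst (Finitary m ⊎ Index) → Bool

    Code : Set ℓ
    Code = (Σ ℕ λ m → Formula L (n + m) × TypeCode m) → Bool

    code-small : Code ≺ κ̄
    code-small = pow-small (Σℕ-small λ m → ×-small formula-small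
      (pow-small (inst-small (⊎-small (Lift-small Fin-small) small))))

    type-code : Vec C m → TypeCode m
    type-code a ι = ⌊ ⟦ ι ⟧ [ lookup a ∘ lower , proj₁ ∘ elem ]′ ⌋

    same-code : {a b : Vec C m} → type-code a ≡ type-code b → lookup a ≈[ N ] lookup b
    same-code {m} {a} {b} e ι t = ⟦mapᴵ⟧⁻ q ι (λ v → sym (q-val b v)) (⌊⌋-sound (trans (sym (cong (λ g → g (mapᴵ q ι)) e))
        (⌊⌋-true (⟦mapᴵ⟧⁺ q ι (q-val a) t))))
      where
      q : Fin m ⊎ Σ C N → Finitary m ⊎ Index
      q (inj₁ j)       = inj₁ (lift j)
      q (inj₂ (c , d)) = inj₂ (proj₁ (covers d))
      q-val : ∀ a v → [ lookup a , proj₁ ]′ v ≡ [ lookup a ∘ lower , proj₁ ∘ elem ]′ (q v)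
      q-val a (inj₁ j)       = refl
      q-val a (inj₂ (c , d)) = sym (proj₂ (covers d))

    code : S ℭ n (whole ℭ) → Code
    code r (m , φ , s) = ⌊ (∃ λ a → type-code a ≡ s × φ ⟨ a ⟩ ∈ formulas r) ⌋

    code-determines : {r r′ : S ℭ n (whole ℭ)} → ¬ LascarSplitsOver A r′ → code r ≡ code r′ →
                      ∀ {m} (φ : Formula L (n + m)) a → φ ⟨ a ⟩ ∈ formulas r → φ ⟨ a ⟩ ∈ formulas r′
    code-determines {r} {r′} ns e φ a h =
      let (a′ , same , h′) = ⌊⌋-sound (trans (sym (cong (λ g → g (_ , φ , type-code a)) e))
                                             (⌊⌋-true (a , refl , h)))
      in [ id , (λ g → ⊥-elim (ns (_ , φ , a′ , a ,
             model⇒lascar N-small elementary includes {a′} {a} (same-code {a = a′} {a} same) , h′ , g))) ]′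
         (S.complete r′ φ a (all-whole a))

    many⇒splits : {B : Subset ℭ} (y : (Code → Bool) → Fin n → C) → (∀ {i j} → y i ≈[ B ] y j → i ≡ j) →
                  ∃ λ i → ∀ r → tp {D = B} (y i) ⊑ r → LascarSplitsOver A r
    many⇒splits {B} y inj = stable λ none → cantor (inject (λ i → code (r none i)) λ {i} {j} e →
      inj (⊨⇒≈ λ φ d t → stable λ nt → type-consistent (r none j)
        (code-determines {r none i} {r none j} (proj₂ (proj₂ (chosen none j))) e φ _ (proj₁ (proj₂ (chosen none i)) (d , t)))
        (proj₁ (proj₂ (chosen none j)) (d , nt))))
      where
      module _ (none : ¬ ∃ λ (i : Code → Bool) → ∀ (r : S ℭ n (whole ℭ)) → tp {D = B} (y i) ⊑ r → LascarSplitsOver A r) where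
        chosen : ∀ i → ∃ λ r → tp {D = B} (y i) ⊑ r × ¬ LascarSplitsOver A r
        chosen i = stable λ k → none (i , λ r e → stable λ ns → k (r , (λ {θ} → e {θ}) , ns))
        r : (Code → Bool) → S ℭ n (whole ℭ)
        r i = proj₁ (chosen i)

  Rk⇒SU : ∀ α {A : Subset ℭ} {p : S ℭ n A} {x : Fin n → C} → Small A → x ⊨ₜ p → Rk α x A → SUⁱ≥ α p
  Rk⇒SU Ord.zero    sA h u = tt
  Rk⇒SU {n} (Ord.suc α) {p = p} sA h u =
    -- More extensions than there are codes of non-splitting global types.
    let (B , sB , i , y , inj , g) = u (Code → Bool) (pow-small code-small)
        (k , splits) = many⇒splits y inj
    in B , sB , tp (y k) , (⊑-tp {p = p} i h (proj₁ (g k)) , splits) ,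
       Rk⇒SU α {p = tp (y k)} sB (λ {θ} → ⊨ₜ-tp (y k) {θ}) (proj₂ (g k))
    where open NonSplitting sA n
  Rk⇒SU (lim I f) {p = p} sA h u = λ k → Rk⇒SU (f k) {p = p} sA h (u k)

  -- Types that are unstable for some formula have every rank

  module _ {m : ℕ} (ψ : Inst (Fin n ⊎ Fin m)) where

    cut : (Fin n → C) → (Fin m → C) → Set ℓ
    cut x y = ⟦ ψ ⟧ [ x , y ]′

    open Tree cut

    -- For a fixed height the existence of a tree is first order: the root is quantified, and the
    -- leaf condition is strengthened by its two sides. This lets such statements pass from an
    -- ultrafilter to its realisations.
    tree-formula : {W : Set b} → ℕ → Inst (Fin n ⊎ W) → Inst W
    tree-formula zero    θ = ∃ᴵ θ
    tree-formula (suc N) θ = ∃ᴵ (tree-formula N (mapᴵ (map₂ˢ inj₂) θ ∧ᴵ mapᴵ (map₂ˢ inj₁) ψ) ∧ᴵ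
                                 tree-formula N (mapᴵ (map₂ˢ inj₂) θ ∧ᴵ ¬ᴵ mapᴵ (map₂ˢ inj₁) ψ))

    Trees : {W : Set b} → ℕ → Inst (Fin n ⊎ W) → (W → C) → Set ℓ
    Trees N θ w = Tr N (λ x → ⟦ θ ⟧ [ x , w ]′) (λ _ → ⊤)

    module _ {W : Set b} (θ : Inst (Fin n ⊎ W)) (w : W → C) (y : Fin m → C) where

      private
        wy : Fin m ⊎ W → C
        wy = [ y , w ]′
        θ′ = mapᴵ (map₂ˢ {A = Fin n} (inj₂ {A = Fin m})) θ
        ψ′ = mapᴵ (map₂ˢ {A = Fin n} (inj₁ {B = W})) ψ

      θ-val : ∀ x → ⟦ θ′ ⟧ [ x , wy ]′ ⇔ ⟦ θ ⟧ [ x , w ]′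
      θ-val x = mk⇔
        (λ s → ⟦mapᴵ⟧⁻ _ θ (λ { (inj₁ _) → refl ; (inj₂ _) → refl }) s)
        (λ s → ⟦mapᴵ⟧⁺ _ θ (λ { (inj₁ _) → refl ; (inj₂ _) → refl }) s)

      ψ-val : ∀ x → ⟦ ψ′ ⟧ [ x , wy ]′ ⇔ cut x y
      ψ-val x = mk⇔
        (λ s → ⟦mapᴵ⟧⁻ _ ψ (λ { (inj₁ _) → refl ; (inj₂ _) → refl }) s)
        (λ s → ⟦mapᴵ⟧⁺ _ ψ (λ { (inj₁ _) → refl ; (inj₂ _) → refl }) s)

      left-val : ∀ x → ⟦ θ′ ∧ᴵ ψ′ ⟧ [ x , wy ]′ ⇔ (⟦ θ ⟧ [ x , w ]′ × cut x y)
      left-val x = mk⇔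
        (λ s → let (t , u) = subst id (⟦∧ᴵ⟧ θ′ ψ′ _) s in to (θ-val x) t , to (ψ-val x) u)
        (λ (t , u) → subst id (sym (⟦∧ᴵ⟧ θ′ ψ′ _)) (from (θ-val x) t , from (ψ-val x) u))

      right-val : ∀ x → ⟦ θ′ ∧ᴵ ¬ᴵ ψ′ ⟧ [ x , wy ]′ ⇔ (⟦ θ ⟧ [ x , w ]′ × ¬ cut x y)
      right-val x = mk⇔
        (λ s → let (t , u) = subst id (⟦∧ᴵ⟧ θ′ (¬ᴵ ψ′) _) s in to (θ-val x) t , λ v → u (from (ψ-val x) v))
        (λ (t , u) → subst id (sym (⟦∧ᴵ⟧ θ′ (¬ᴵ ψ′) _)) (from (θ-val x) t , λ v → u (to (ψ-val x) v)))

    left-θ right-θ : {W : Set b} → Inst (Fin n ⊎ W) → Inst (Fin n ⊎ (Fin m ⊎ W))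
    left-θ  θ = mapᴵ (map₂ˢ inj₂) θ ∧ᴵ mapᴵ (map₂ˢ inj₁) ψ
    right-θ θ = mapᴵ (map₂ˢ inj₂) θ ∧ᴵ ¬ᴵ mapᴵ (map₂ˢ inj₁) ψ

    tree-formula⁺ : {W : Set b} → ∀ N (θ : Inst (Fin n ⊎ W)) w → Trees N θ w → ⟦ tree-formula N θ ⟧ w
    tree-formula⁺ zero    θ w (x , s)         = ∃ᴵ⁺ θ x s
    tree-formula⁺ (suc N) θ w (y , _ , l , r) =
      ∃ᴵ⁺ (tree-formula N (left-θ θ) ∧ᴵ tree-formula N (right-θ θ)) y
        (subst id (sym (⟦∧ᴵ⟧ (tree-formula N (left-θ θ)) (tree-formula N (right-θ θ)) _))
      ( tree-formula⁺ N (left-θ θ) _ (tr-mono N (λ x → from (left-val θ w y x)) (λ _ → id) l)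
      , tree-formula⁺ N (right-θ θ) _ (tr-mono N (λ x → from (right-val θ w y x)) (λ _ → id) r)))

    tree-formula⁻ : {W : Set b} → ∀ N (θ : Inst (Fin n ⊎ W)) w → ⟦ tree-formula N θ ⟧ w → Trees N θ w
    tree-formula⁻ zero    θ w s = ∃ᴵ⁻ θ s
    tree-formula⁻ (suc N) θ w s =
      let (y , t) = ∃ᴵ⁻ (tree-formula N (left-θ θ) ∧ᴵ tree-formula N (right-θ θ)) s
          (l , r) = subst id (⟦∧ᴵ⟧ (tree-formula N (left-θ θ)) (tree-formula N (right-θ θ)) _) t
      in y , tt , tr-mono N (λ x → to (left-val θ w y x)) (λ _ → id) (tree-formula⁻ N (left-θ θ) _ l)
                , tr-mono N (λ x → to (right-val θ w y x)) (λ _ → id) (tree-formula⁻ N (right-θ θ) _ r)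

    -- In the usual terms: the local rank R(-, ψ, 2) of every formula in tp(x/D) is infinite.
    Unstable : (Fin n → C) → Subset ℭ → Set ℓ
    Unstable x D = (θ : Inst (Fin n ⊎ Σ C D)) → ⟦ θ ⟧ [ x , proj₁ ]′ → ∀ N → Trees N θ proj₁

    Apart : ℕ → ((Fin n → C) → Set ℓ) → (Fin m → C) → (Fin m → C) → Set ℓ
    Apart N P y y′ = Tr N (λ x → P x × cut x y × ¬ cut x y′) (λ _ → ⊤) ⊎
                     Tr N (λ x → P x × ¬ cut x y × cut x y′) (λ _ → ⊤)

    apart-weaken : ∀ {H} N h {P P′ y y′} → H ≡ N + h → (∀ x → P x → P′ x) → Apart H P y y′ → Apart N P′ y y′
    apart-weaken N h refl f (inj₁ t) = inj₁ (tr-mono N (λ x (p , s) → f x p , s) (λ _ → id) (tr-lowerʳ N h t))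
    apart-weaken N h refl f (inj₂ t) = inj₂ (tr-mono N (λ x (p , s) → f x p , s) (λ _ → id) (tr-lowerʳ N h t))

    -- The nodes met on the rightmost branch are pairwise apart.
    comb : {Λ : Set ℓ} (F : List Λ) → ∀ N P → Tr (length F + N) P (λ _ → ⊤) →
           ∃ λ (c : Λ → Fin m → C) →
             (∀ {i} → i ∈ᴸ F → Tr N (λ x → P x × cut x (c i)) (λ _ → ⊤)) ×
             (∀ {i j} → i ∈ᴸ F → j ∈ᴸ F → ¬ (i ≡ j) → Apart N P (c i) (c j))
    comb [] N P t = (λ _ _ → nonempty) , (λ ()) , λ ()
    comb {Λ} (i₀ ∷ F) N P t with em {P = i₀ ∈ᴸ F}
    ... | yes i₀∈F = let (c , s , a) = comb F N P (tr-lower 1 (length F + N) t) in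
      c , (λ i∈ → s (back i∈)) , λ i∈ j∈ → a (back i∈) (back j∈)
      where
      back : ∀ {i} → i ∈ᴸ (i₀ ∷ F) → i ∈ᴸ F
      back (here refl) = i₀∈F
      back (there i∈)  = i∈
    comb {Λ} (i₀ ∷ F) N P (y , _ , l , r) | no i₀∉F = c′ , sides , apart
      where
      IH = comb F N _ r
      γ  = proj₁ IH
      c′ : Λ → Fin m → C
      c′ i with em {P = i ≡ i₀}
      ... | yes _ = y
      ... | no _  = γ i
      c′-root : c′ i₀ ≡ y
      c′-root with em {P = i₀ ≡ i₀}
      ... | yes _ = refl
      ... | no h  = ⊥-elim (h refl)
      c′-rest : ∀ {i} → i ∈ᴸ F → c′ i ≡ γ i
      c′-rest {i} i∈ with em {P = i ≡ i₀}
      ... | yes refl = ⊥-elim (i₀∉F i∈)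
      ... | no _     = refl
      sides : ∀ {i} → i ∈ᴸ (i₀ ∷ F) → Tr N (λ x → P x × cut x (c′ i)) (λ _ → ⊤)
      sides (here refl) = subst (λ y → Tr N (λ x → P x × cut x y) _) (sym c′-root)
        (tr-lower (length F) N l)
      sides (there i∈)  = subst (λ y → Tr N (λ x → P x × cut x y) _) (sym (c′-rest i∈))
        (tr-mono N (λ x ((p , _) , s) → p , s) (λ _ → id) (proj₁ (proj₂ IH) i∈))
      apart : ∀ {i j} → i ∈ᴸ (i₀ ∷ F) → j ∈ᴸ (i₀ ∷ F) → ¬ (i ≡ j) → Apart N P (c′ i) (c′ j)
      apart (here refl) (here refl) d = ⊥-elim (d refl)
      apart (here refl) (there j∈)  d = subst₂ (Apart N P) (sym c′-root) (sym (c′-rest j∈))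
        (inj₂ (tr-mono N (λ x ((p , n) , s) → p , n , s) (λ _ → id) (proj₁ (proj₂ IH) j∈)))
      apart (there i∈) (here refl)  d = subst₂ (Apart N P) (sym (c′-rest i∈)) (sym c′-root)
        (inj₁ (tr-mono N (λ x ((p , n) , s) → p , s , n) (λ _ → id) (proj₁ (proj₂ IH) i∈)))
      apart (there i∈) (there j∈)   d = subst₂ (Apart N P) (sym (c′-rest i∈)) (sym (c′-rest j∈))
        (apart-weaken N 0 (sym (+-identityʳ N)) (λ x → proj₁) (proj₂ (proj₂ IH) i∈ j∈ d))

  ultra-realise : {D : Subset ℭ} (𝒲 : Ultrafilter (Fin n → C)) {x : Fin n → C} → x ⊨ₜ ultra-type D 𝒲 →
                  (ι : Inst (Fin n ⊎ Σ C D)) → 𝒲 ∋ (λ x → ⟦ ι ⟧ [ x , proj₁ ]′) → ⟦ ι ⟧ [ x , proj₁ ]′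
  ultra-realise 𝒲 {x} h ι u = subst id (holds-sort ι x proj₁)
    (h {Sorted.body (sort ι) ⟨ map proj₁ (Sorted.outer (sort ι)) ⟩} (all-proj₁ (Sorted.outer (sort ι)) ,
       lift (∋-mono 𝒲 (λ z → subst id (sym (holds-sort ι z proj₁))) u)))

  module UnstableRank {m : ℕ} (ψ : Inst (Fin n ⊎ Fin m)) where

    open Tree (cut ψ)

    -- Parameters indexed by 2^2^κ are realised pairwise apart. Each pair is told apart by some
    -- extension that is unstable again, and `many-distinct` turns this pairwise separation into `κ`
    -- distinct extensions.
    module Many {x : Fin n → C} {D : Subset ℭ} (D-small : Small D) (unstable : Unstable ψ x D)
                {κ : Set ℓ} (κ-small : κ ≺ κ̄) where

      Λ : Set ℓ
      Λ = Separated κ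

      J : Set ℓ
      J = Λ × Finitary m

      J-small : J ≺ κ̄
      J-small = ×-small (pow-small (pow-small κ-small)) (Lift-small Fin-small)

      point : (J → C) → Λ → Fin m → C
      point e i j = e (i , lift j)

      TrueAt : Set ℓ
      TrueAt = Σ (Inst (Fin n ⊎ Σ C D)) λ θ → ⟦ θ ⟧ [ x , proj₁ ]′

      Demand : Set ℓ
      Demand = TrueAt × ℕ × Σ (Λ × Λ) λ (i , j) → ¬ (i ≡ j)

      Met : Demand → (J → C) → Set ℓ
      Met ((θ , _) , N , (i , j) , _) e = Apart ψ N (λ x → ⟦ θ ⟧ [ x , proj₁ ]′) (point e i) (point e j)

      indices : List Demand → List Λ
      indices []                            = []
      indices ((_ , _ , (i , j) , _) ∷ Ls) = i ∷ j ∷ indices Ls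

      height : List Demand → ℕ
      height []                  = 0
      height ((_ , N , _) ∷ Ls) = N + height Ls

      formulas-of : List Demand → List (Inst (Fin n ⊎ Σ C D))
      formulas-of []                        = []
      formulas-of (((θ , _) , _) ∷ Ls) = θ ∷ formulas-of Ls

      formulas-true : ∀ Ls → All (λ ι → ⟦ ι ⟧ [ x , proj₁ ]′) (formulas-of Ls)
      formulas-true []                   = []
      formulas-true (((_ , t) , _) ∷ Ls) = t ∷ formulas-true Ls

      index-∈ : ∀ {Ls t N i j} {i≢j : ¬ (i ≡ j)} → (t , N , (i , j) , i≢j) ∈ᴸ Ls →
                i ∈ᴸ indices Ls × j ∈ᴸ indices Ls
      index-∈ (here refl) = here refl , there (here refl)
      index-∈ (there d∈)  = let (p , q) = index-∈ d∈ in there (there p) , there (there q)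

      height-∈ : ∀ {Ls t N p} → (t , N , p) ∈ᴸ Ls → ∃ λ h → height Ls ≡ N + h
      height-∈ (here refl) = _ , refl
      height-∈ {(_ , N′ , _) ∷ Ls} {N = N} (there d∈) = let (h , e) = height-∈ d∈ in
        N′ + h , trans (cong (N′ +_) e) (trans (sym (+-assoc N′ N h))
          (trans (cong (_+ h) (+-comm N′ N)) (+-assoc N N′ h)))

      formula-∈ : ∀ {Ls θ t p z} → ((θ , t) , p) ∈ᴸ Ls →
                  All (λ ι → ⟦ ι ⟧ [ z , proj₁ ]′) (formulas-of Ls) → ⟦ θ ⟧ [ z , proj₁ ]′
      formula-∈ (here refl) (s ∷ _)  = s
      formula-∈ (there d∈)  (_ ∷ ss) = formula-∈ d∈ ss

      -- One comb meets all listed demands: the conjunction of their formulas and the sum of their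
      -- heights dominate each of them.
      fip : ∀ Ls → ∃ λ e → All (λ d → Met d e) Ls
      fip Ls = (λ (i , j) → γ i (lower j)) , All-tabulate met
        where
        Θ = ⋀ᴵ (formulas-of Ls)
        found = comb ψ (indices Ls) (height Ls) (λ x → ⟦ Θ ⟧ [ x , proj₁ ]′)
                  (unstable Θ (⋀ᴵ⁺ (formulas-of Ls) (formulas-true Ls)) _)
        γ = proj₁ found
        met : ∀ {d} → d ∈ᴸ Ls → Met d (λ (i , j) → γ i (lower j))
        met {(θ , t) , N , (i , j) , i≢j} d∈ =
          let (i∈ , j∈) = index-∈ d∈
              (h , e)   = height-∈ d∈
          in apart-weaken ψ N h e (λ x s → formula-∈ {θ = θ} {t} {z = x} d∈ (⋀ᴵ⁻ (formulas-of Ls) s))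
               (proj₂ (proj₂ found) i∈ j∈ i≢j)

      abstract

        𝒰 : Ultrafilter (J → C)
        𝒰 = proj₁ (fip⇒ultrafilter Met fip)

        𝒰-met : ∀ d → 𝒰 ∋ Met d
        𝒰-met = proj₂ (fip⇒ultrafilter Met fip)

        e : J → C
        e = Realise.realisation J-small 𝒰 D-small

        realises : e ⊩[ D ] 𝒰
        realises = Realise.realises J-small 𝒰 D-small

      D⁺ : Subset ℭ
      D⁺ = D ∪ Range e

      D⁺-small : Small D⁺
      D⁺-small = ∪-small D-small (range-small J-small e)

      module _ {i j : Λ} (i≢j : ¬ (i ≡ j)) where

        Side : Bool → (J → C) → (Fin n → C) → Set ℓ
        Side true  f x = cut ψ x (point f i) × ¬ cut ψ x (point f j)
        Side false f x = ¬ cut ψ x (point f i) × cut ψ x (point f j)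

        at : Λ → Inst (Fin n ⊎ (J ⊎ Σ C D))
        at k = mapᴵ (map₂ˢ λ j → inj₁ (k , lift j)) ψ

        at-val : ∀ k f x → ⟦ at k ⟧ [ x , [ f , proj₁ ]′ ]′ ⇔ cut ψ x (point f k)
        at-val k f x = mk⇔
          (λ s → ⟦mapᴵ⟧⁻ _ ψ (λ { (inj₁ _) → refl ; (inj₂ _) → refl }) s)
          (λ s → ⟦mapᴵ⟧⁺ _ ψ (λ { (inj₁ _) → refl ; (inj₂ _) → refl }) s)

        side-formula : Bool → Inst (Fin n ⊎ (J ⊎ Σ C D))
        side-formula true  = at i ∧ᴵ ¬ᴵ at j
        side-formula false = (¬ᴵ at i) ∧ᴵ at j

        side-val : ∀ b f x → ⟦ side-formula b ⟧ [ x , [ f , proj₁ ]′ ]′ ⇔ Side b f x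
        side-val true f x = mk⇔
          (λ s → let (t , u) = subst id (⟦∧ᴵ⟧ (at i) (¬ᴵ at j) _) s in
                 to (at-val i f x) t , λ v → u (from (at-val j f x) v))
          (λ (t , u) → subst id (sym (⟦∧ᴵ⟧ (at i) (¬ᴵ at j) _))
                 (from (at-val i f x) t , λ v → u (to (at-val j f x) v)))
        side-val false f x = mk⇔
          (λ s → let (t , u) = subst id (⟦∧ᴵ⟧ (¬ᴵ at i) (at j) _) s in
                 (λ v → t (from (at-val i f x) v)) , to (at-val j f x) u)
          (λ (t , u) → subst id (sym (⟦∧ᴵ⟧ (¬ᴵ at i) (at j) _))
                 ((λ v → t (to (at-val i f x) v)) , from (at-val j f x) u))

        Good : Bool → Inst (Fin n ⊎ Σ C D) → ℕ → (J → C) → Set ℓ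
        Good b θ N f = Tr N (λ x → ⟦ θ ⟧ [ x , proj₁ ]′ × Side b f x) (λ _ → ⊤)

        good-realised : ∀ b θ N → 𝒰 ∋ Good b θ N → Good b θ N e
        good-realised b θ N u = tr-mono N (λ x → to (val e x)) (λ _ → id)
          (tree-formula⁻ ψ N χ _ (realises (tree-formula ψ N χ) (∋-mono 𝒰
            (λ f t → tree-formula⁺ ψ N χ _ (tr-mono N (λ x → from (val f x)) (λ _ → id) t)) u)))
          where
          θ⁺ χ : Inst (Fin n ⊎ (J ⊎ Σ C D))
          θ⁺ = mapᴵ (map₂ˢ inj₂) θ
          χ = θ⁺ ∧ᴵ side-formula b
          val : ∀ f x → ⟦ χ ⟧ [ x , [ f , proj₁ ]′ ]′ ⇔ (⟦ θ ⟧ [ x , proj₁ ]′ × Side b f x)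
          val f x = mk⇔
            (λ s → let (t , u) = subst id (⟦∧ᴵ⟧ θ⁺ (side-formula b) _) s in
               ⟦mapᴵ⟧⁻ _ θ (λ { (inj₁ _) → refl ; (inj₂ _) → refl }) t ,
               to (side-val b f x) u)
            (λ (t , u) → subst id (sym (⟦∧ᴵ⟧ θ⁺ (side-formula b) _))
               (⟦mapᴵ⟧⁺ _ θ (λ { (inj₁ _) → refl ; (inj₂ _) → refl }) t ,
                from (side-val b f x) u))

        good-one : ∀ (θ : TrueAt) N → Good true (proj₁ θ) N e ⊎ Good false (proj₁ θ) N e
        good-one θ N with ∋-split 𝒰 (Good true (proj₁ θ) N)
        ... | inj₁ u = inj₁ (good-realised true (proj₁ θ) N u)
        ... | inj₂ u = inj₂ (good-realised false (proj₁ θ) N (∋-mono 𝒰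
          (λ f (k , h) → [ (λ g → ⊥-elim (k g)) , id ]′ h)
          (∋-× 𝒰 u (𝒰-met (θ , N , (i , j) , i≢j)))))

        good-weaken : ∀ b (θ θ′ : Inst (Fin n ⊎ Σ C D)) M N →
                      (∀ x → ⟦ θ ⟧ [ x , proj₁ ]′ → ⟦ θ′ ⟧ [ x , proj₁ ]′) → Good b θ (M + N) e → Good b θ′ M e
        good-weaken b θ θ′ M N h t = tr-mono M (λ x (p , s) → h x p , s) (λ _ → id) (tr-lowerʳ M N t)

        good-join : ∀ (θ₁ θ₂ : TrueAt) N₁ N₂ →
                    Good true (proj₁ θ₁) N₁ e ⊎ Good false (proj₁ θ₂) N₂ e
        good-join (θ₁ , t₁) (θ₂ , t₂) N₁ N₂ =
          [ (λ g → inj₁ (good-weaken true (θ₁ ∧ᴵ θ₂) θ₁ N₁ N₂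
              (λ x s → proj₁ (subst id (⟦∧ᴵ⟧ θ₁ θ₂ [ x , proj₁ ]′) s)) g))
          , (λ g → inj₂ (good-weaken false (θ₁ ∧ᴵ θ₂) θ₂ N₂ N₁
              (λ x s → proj₂ (subst id (⟦∧ᴵ⟧ θ₁ θ₂ [ x , proj₁ ]′) s))
              (subst (λ H → Good false (θ₁ ∧ᴵ θ₂) H e) (+-comm N₁ N₂) g))) ]′
          (good-one (θ₁ ∧ᴵ θ₂ , subst id (sym (⟦∧ᴵ⟧ θ₁ θ₂ [ x , proj₁ ]′)) (t₁ , t₂)) (N₁ + N₂))

        -- The side must not depend on the formula or the height. If the true side fails for one
        -- pair, `good-join` compares that pair with any other and leaves only the false side.
        good-side : ∃ λ b → ∀ (θ : TrueAt) N → Good b (proj₁ θ) N e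
        good-side with em {P = ∀ (θ : TrueAt) N → Good true (proj₁ θ) N e}
        ... | yes h = true , h
        ... | no h  = false , λ θ N →
          let (θ₁ , h₁) = ¬∀⇒∃¬ h
              (N₁ , h₂) = ¬∀⇒∃¬ h₁
          in [ (λ g → ⊥-elim (h₂ g)) , id ]′ (good-join θ₁ θ N₁ N)

        -- By `tr-leaves` these sets are partition regular. An ultrafilter consisting of them
        -- defines a type over `D⁺` each of whose formulas still carries trees of every height.
        Large : ((Fin n → C) → Bool) → Set ℓ
        Large A = ∀ N → Tr N (λ x → Lift ℓ (A x ≡ true)) (λ _ → ⊤)

        large-isLargeness : IsLargeness Large
        large-isLargeness = record
          { large-mono  = λ h t N → tr-mono N (λ x (lift q) → lift (h x q)) (λ _ → id) (t N)
          ; large-split = split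
          ; large-inh   = λ t → let (x , lift q) = t 0 in x , q
          }
          where
          split : ∀ {A} (B : (Fin n → C) → Bool) → Large A →
                  Large (λ x → A x ∧ᵇ B x) ⊎ Large (λ x → A x ∧ᵇ not (B x))
          split {A} B t with em {P = Large (λ x → A x ∧ᵇ B x)}
          ... | yes h = inj₁ h
          ... | no h  = inj₂ λ N → let (M , k) = ¬∀⇒∃¬ h in
            [ (λ s → ⊥-elim (k s)) , id ]′ (tr-leaves M N (λ x (lift p) → cases x p) (t (M + N)))
            where
            cases : ∀ x → A x ≡ true → Lift ℓ (A x ∧ᵇ B x ≡ true) ⊎
                                       Lift ℓ (A x ∧ᵇ not (B x) ≡ true)
            cases x p with B x in q
            ... | true  = inj₁ (lift (∧-true p refl))
            ... | false = inj₂ (lift (∧-true p refl))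

        β : Bool
        β = proj₁ good-side

        Constraint : TrueAt ⊎ ⊤ {ℓ} → (Fin n → C) → Set ℓ
        Constraint (inj₁ (θ , _)) x = ⟦ θ ⟧ [ x , proj₁ ]′
        Constraint (inj₂ _)       x = Side β e x

        constraints-large : ∀ Ls → Large (λ x → ⌊ All (λ i → Constraint i x) Ls ⌋)
        constraints-large Ls N = tr-mono N (λ x (p , s) → lift (⌊⌋-true (back Ls x s (⋀ᴵ⁻ (fmls Ls) p)))) (λ _ → id)
          (proj₂ good-side (⋀ᴵ (fmls Ls) , ⋀ᴵ⁺ (fmls Ls) (true-at Ls)) N)
          where
          fmls : List (TrueAt ⊎ ⊤ {ℓ}) → List (Inst (Fin n ⊎ Σ C D))
          fmls []                   = []
          fmls (inj₁ (θ , _) ∷ Ls) = θ ∷ fmls Ls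
          fmls (inj₂ _ ∷ Ls)       = fmls Ls
          true-at : ∀ Ls → All (λ ι → ⟦ ι ⟧ [ x , proj₁ ]′) (fmls Ls)
          true-at []                   = []
          true-at (inj₁ (_ , t) ∷ Ls) = t ∷ true-at Ls
          true-at (inj₂ _ ∷ Ls)       = true-at Ls
          back : ∀ Ls z → Side β e z → All (λ ι → ⟦ ι ⟧ [ z , proj₁ ]′) (fmls Ls) →
                 All (λ i → Constraint i z) Ls
          back []            z s []       = []
          back (inj₁ _ ∷ Ls) z s (t ∷ ts) = t ∷ back Ls z s ts
          back (inj₂ _ ∷ Ls) z s ts       = s ∷ back Ls z s ts

        open UltrafilterLemma large-isLargeness Constraint constraints-large
          using (ultrafilter; ultrafilter-∋; ultrafilter-large)

        b′ : ∃ λ z → z ⊨ₜ ultra-type D⁺ ultrafilter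
        b′ = ⊨ₜ-realised D⁺-small (ultra-type D⁺ ultrafilter)

        z : Fin n → C
        z = proj₁ b′

        z-true : (ι : Inst (Fin n ⊎ Σ C D⁺)) → ultrafilter ∋ (λ x → ⟦ ι ⟧ [ x , proj₁ ]′) → ⟦ ι ⟧ [ z , proj₁ ]′
        z-true = ultra-realise ultrafilter (λ {θ} → proj₂ b′ {θ})

        z-≈ : x ≈[ D ] z
        z-≈ ι t = ⟦mapᴵ⟧⁻ up ι (λ { (inj₁ _) → refl ; (inj₂ _) → refl }) (z-true (mapᴵ up ι) (∋-mono ultrafilter (λ x s → ⟦mapᴵ⟧⁺ up ι (λ { (inj₁ _) → refl ; (inj₂ _) → refl }) s) (ultrafilter-∋ (inj₁ (ι , t)))))
          where
          up : Fin n ⊎ Σ C D → Fin n ⊎ Σ C D⁺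
          up = map₂ˢ λ (c , d) → c , inj₁ d

        z-unstable : Unstable ψ z D⁺
        z-unstable θ t N = tr-mono N (λ x (lift q) → ⌊⌋-sound q) (λ _ → id)
          (ultrafilter-large (stable λ k → z-true (¬ᴵ θ) (∋-¬⁺ ultrafilter k) t) N)

        cut-formula : Λ → Inst (Fin n ⊎ Σ C D⁺)
        cut-formula k = mapᴵ (map₂ˢ λ l → e (k , lift l) , inj₂ ((k , lift l) , refl)) ψ

        cut-formula-val : ∀ k x → ⟦ cut-formula k ⟧ [ x , proj₁ ]′ ⇔ cut ψ x (point e k)
        cut-formula-val k x = mk⇔
          (λ s → ⟦mapᴵ⟧⁻ _ ψ (λ { (inj₁ _) → refl ; (inj₂ _) → refl }) s)
          (λ s → ⟦mapᴵ⟧⁺ _ ψ (λ { (inj₁ _) → refl ; (inj₂ _) → refl }) s)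

        z-cut : ∀ k → ultrafilter ∋ (λ x → cut ψ x (point e k)) → cut ψ z (point e k)
        z-cut k u = to (cut-formula-val k z) (z-true (cut-formula k)
          (∋-mono ultrafilter (λ x → from (cut-formula-val k x)) u))

        z-side : ∀ b → β ≡ b → Side b e z
        z-side true  q = let s = subst (λ b → ultrafilter ∋ Side b e) q (ultrafilter-∋ (inj₂ tt)) in
          z-cut i (∋-mono ultrafilter (λ _ → proj₁) s) ,
          λ v → z-true (¬ᴵ cut-formula j) (∋-mono ultrafilter
            (λ x (_ , k) w → k (to (cut-formula-val j x) w)) s) (from (cut-formula-val j z) v)
        z-side false q = let s = subst (λ b → ultrafilter ∋ Side b e) q (ultrafilter-∋ (inj₂ tt)) in
          (λ v → z-true (¬ᴵ cut-formula i) (∋-mono ultrafilter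
            (λ x (k , _) w → k (to (cut-formula-val i x) w)) s) (from (cut-formula-val i z) v)) ,
          z-cut j (∋-mono ultrafilter (λ _ → proj₂) s)

        z-separates : ¬ (⌊ cut ψ z (point e i) ⌋ ≡ ⌊ cut ψ z (point e j) ⌋)
        z-separates q = go β refl
          where
          go : ∀ b → β ≡ b → ⊥
          go true  r = let (s , k) = z-side true r in k (⌊⌋-sound (trans (sym q) (⌊⌋-true s)))
          go false r = let (k , s) = z-side false r in k (⌊⌋-sound (trans q (⌊⌋-true s)))

      Extension : Set ℓ
      Extension = Σ (Fin n → C) λ z → x ≈[ D ] z × Unstable ψ z D⁺

      val : Extension → Λ → Bool
      val (z , _) k = ⌊ cut ψ z (point e k) ⌋

      many = many-distinct val (λ i≢j → (z i≢j , z-≈ i≢j , z-unstable i≢j) , z-separates i≢j)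

      extensions : Σ[ y ∈ (κ → Fin n → C) ] (∀ {k l} → y k ≈[ D⁺ ] y l → k ≡ l) ×
                   (∀ k → x ≈[ D ] y k × Unstable ψ (y k) D⁺)
      extensions = (λ k → proj₁ (proj₁ many k)) ,
        (λ {k} {l} p → proj₂ many (ext λ i → bool-ext (follow p i) (follow (≈-sym p) i))) ,
        λ k → proj₂ (proj₁ many k)
        where
        follow : ∀ {y y′ : Fin n → C} → y ≈[ D⁺ ] y′ → ∀ i →
                 ⌊ cut ψ y (point e i) ⌋ ≡ true → ⌊ cut ψ y′ (point e i) ⌋ ≡ true
        follow p i q = ⌊⌋-true (≈⇒⟦⟧ ψ {D⁺} p (point e i) (λ l → inj₂ ((i , lift l) , refl)) (⌊⌋-sound q))

    unstable⇒∞ : ∀ α {x : Fin n → C} {D} → Small D → Unstable ψ x D → Rk α x D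
    unstable⇒∞ Ord.zero    s h = tt
    unstable⇒∞ (Ord.suc α) s h κ sκ = D⁺ , D⁺-small , inj₁ , proj₁ extensions , proj₁ (proj₂ extensions) ,
      λ k → let (p , u) = proj₂ (proj₂ extensions) k in p , unstable⇒∞ α D⁺-small u
      where open Many s h sκ
    unstable⇒∞ (lim I f)   s h = λ k → unstable⇒∞ (f k) s h

  -- Stability of a single type: the leaves realise tp(x/D), while nodes range over all tuples of
  -- `ℭ`. An arbitrary index set `J` admits infinite tuples as nodes.
  Stable : (Fin n → C) → Subset ℭ → Set (lsuc ℓ)
  Stable {n} x D = ∀ {J : Set ℓ} (ψ : Inst (Fin n ⊎ J)) →
    ∃ λ N → ¬ Tree.Tr (λ x (f : J → C) → ⟦ ψ ⟧ [ x , f ]′) N (λ z → x ≈[ D ] z) (λ _ → ⊤)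

  stable-mono : {x y : Fin n → C} {D D′ : Subset ℭ} → D ⊆ D′ → x ≈[ D ] y → Stable x D → Stable y D′
  stable-mono i p st ψ = let (N , h) = st ψ in
    N , λ t → h (Tree.tr-mono _ N (λ z q → ≈-trans p (≈-mono i q)) (λ _ → id) t)

  -- Trees of every height among realisations of tp(x/D) are trees inside each formula of that type,
  -- so it would be unstable and have every rank. `ψ′` keeps only the finitely many variables from
  -- `J` that occur in `ψ`.
  Rk-bounded⇒stable : ∀ α {x : Fin n → C} {D} → Small D → ¬ Rk α x D → Stable x D
  Rk-bounded⇒stable {n} α {x} {D} s h {J} ψ = stable λ none → h (UnstableRank.unstable⇒∞ ψ′ α s
    λ θ t N → Tree.tr-mono _ N (λ z p → p θ t) (λ _ → id) (to-ψ′ N (stable λ k → none (N , k))))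
    where
    r = sort ψ
    ψ′ : Inst (Fin n ⊎ Fin (Sorted.rest r))
    ψ′ = inst (Sorted.body r) (map inj₁ (allFin n) ++ map inj₂ (allFin _))
    module T = Tree (λ x (f : J → C) → ⟦ ψ ⟧ [ x , f ]′)
    args-≡ : ∀ (z : Fin n → C) (f : J → C) →
             map [ z , lookup (map f (Sorted.outer r)) ]′ (map inj₁ (allFin n) ++ map inj₂ (allFin _))
             ≡ tabulate z ++ map f (Sorted.outer r)
    args-≡ z f = trans (map-++ _ (map inj₁ (allFin n)) _) (cong₂ _++_
      (trans (sym (map-∘ _ inj₁ (allFin n))) (sym (tabulate-allFin z)))
      (trans (sym (map-∘ _ inj₂ (allFin _))) (trans (sym (tabulate-allFin _)) (tabulate∘lookup _))))
    same : ∀ (z : Fin n → C) f → cut ψ′ z (lookup (map f (Sorted.outer r))) ≡ ⟦ ψ ⟧ [ z , f ]′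
    same z f = trans (cong (ℭ ⊨ Sorted.body r [_]) (args-≡ z f)) (holds-sort ψ z f)
    to-ψ′ : ∀ N {P} → T.Tr N P (λ _ → ⊤) → Tree.Tr (cut ψ′) N P (λ _ → ⊤)
    to-ψ′ zero    t                 = t
    to-ψ′ (suc N) (f , _ , l , r′) = lookup (map f (Sorted.outer r)) , tt ,
      Tree.tr-mono _ N (λ z (p , q) → p , subst id (sym (same z f)) q) (λ _ → id) (to-ψ′ N l) ,
      Tree.tr-mono _ N (λ z (p , q) → p , λ v → q (subst id (same z f) v)) (λ _ → id) (to-ψ′ N r′)

  -- Types invariant over models, built from a stable type

  module InvariantType {n : ℕ} {B : Subset ℭ} {x₀ : Fin n → C} (x₀-stable : Stable x₀ B)
                       {J : Set ℓ} (e : J → C) where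

    Pair : Set ℓ
    Pair = Inst (Fin n ⊎ J) × (Fin n → C)

    module Patterns (ψs : List (Inst (Fin n ⊎ J))) (ι : Inst (J ⊎ Σ C B)) (ι-true : ⟦ ι ⟧ [ e , proj₁ ]′) where

      Relevant : Pair → (J → C) → Set ℓ
      Relevant (ψ , w) f = ψ ∈ᴸ ψs × x₀ ≈[ B ] w × ⟦ ψ ⟧ [ w , f ]′

      truth : Pair → (J → C) → Bool
      truth p f = ⌊ Relevant p f ⌋

      Y₀ : (J → C) → Set ℓ
      Y₀ f = ⟦ ι ⟧ [ f , proj₁ ]′

      open CantorBendixson truth Y₀
      open Tree splits

      NodesIn : List (Inst (Fin n ⊎ J)) → Pair → Set ℓ
      NodesIn ψs′ (ψ , w) = ψ ∈ᴸ ψs′ × x₀ ≈[ B ] w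

      NodesOf : Inst (Fin n ⊎ J) → Pair → Set ℓ
      NodesOf ψ′ (ψ , w) = ψ ≡ ψ′ × x₀ ≈[ B ] w

      -- There is a leaf to the left of each node, and truth at that leaf includes relevance of the
      -- node. This is why irrelevant pairs are given the value false.
      restrict-nodes : ∀ N {P} → Tr N P (λ _ → ⊤) → Tr N P (NodesIn ψs)
      restrict-nodes zero    t = t
      restrict-nodes (suc N) (p , _ , l , r) =
        let (_ , _ , lift q) = tr-leaf N l ; (m , v , _) = ⌊⌋-sound q in
        p , (m , v) , restrict-nodes N l , restrict-nodes N r

      module _ (ψ : Inst (Fin n ⊎ J)) (ψ∈ : ψ ∈ᴸ ψs) where

        private
          module O = Tree (λ (f : J → C) w → ⟦ ψ ⟧ [ w , f ]′)

        opposite : ∀ N {P P′ : (J → C) → Set ℓ} → (∀ f → P f → P′ f) → Tr N P (NodesOf ψ) →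
                   O.Tr N P′ (x₀ ≈[ B ]_)
        opposite zero    h (f , p) = f , h f p
        opposite (suc N) h ((_ , w) , (refl , v) , l , r) = w , v ,
          opposite N (λ { f (p , lift q) → h f p , proj₂ (proj₂ (⌊⌋-sound {P = Relevant (ψ , w) f} q)) }) l ,
          opposite N (λ f (p , k) → h f p , λ s → k (lift (⌊⌋-true {P = Relevant (ψ , w) f} (ψ∈ , v , s)))) r

        -- The nodes here realise the type and the leaves are parameters, the reverse of `Stable`;
        -- the symmetry of trees converts one bound into the other.
        bound-one : ∃ λ N → ¬ Tr N Y₀ (NodesOf ψ)
        bound-one = stable λ none → let (N , h) = x₀-stable ψ in
          h (opposite-trees⇒trees (λ x (f : J → C) → ⟦ ψ ⟧ [ x , f ]′)
               (λ M → opposite M {P′ = λ _ → ⊤} (λ _ _ → tt) (stable λ k → none (M , k))) N)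

      bound-list : ∀ ψs′ → (∀ {ψ} → ψ ∈ᴸ ψs′ → ψ ∈ᴸ ψs) → ∃ λ N → ¬ Tr N Y₀ (NodesIn ψs′)
      bound-list []        _ = 1 , λ { (_ , (() , _) , _) }
      bound-list (ψ ∷ ψs′) i =
        let (N₁ , h₁) = bound-one ψ (i (here refl))
            (N₂ , h₂) = bound-list ψs′ (i ∘ there)
        in N₁ + N₂ , λ t → [ h₁ , h₂ ]′ (tr-nodes N₁ N₂
             (λ { _ (here p , v) → inj₁ (p , v) ; _ (there p , v) → inj₂ (p , v) }) t)

      abstract
        derivative : ∃ λ k → ∃ (K k) × ¬ ∃ (K (suc k))
        derivative = let (N , h) = bound-list ψs id in
          last-derivative N (λ t → h (restrict-nodes N t)) (e , ι-true)

      rank : ℕ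
      rank = proj₁ derivative

      automorphism-acts : (σ : Automorphism ℭ) → Fixes σ B → ∀ {π} → K rank π →
                          K rank (λ (ψ , w) → π (ψ , Automorphism.to σ ∘ w))
      automorphism-acts σ fx = K-invariant
        (λ (ψ , w) → ψ , Automorphism.to σ ∘ w) (λ (ψ , w) → ψ , Automorphism.from σ ∘ w)
        (λ (ψ , w) → cong (ψ ,_) (ext λ i → auto-invˡ σ (w i)))
        (λ f → Automorphism.from σ ∘ f)
        (λ {f} s → ≈-auto (σ ⁻¹) (λ {c} d → trans (cong (Automorphism.from σ) (sym (fx d))) (auto-invʳ σ c)) f ι s)
        (λ (ψ , w) f → bool-ext
          (λ q → let (m , v , s) = ⌊⌋-sound {P = Relevant (ψ , w) (Automorphism.from σ ∘ f)} q in
                 ⌊⌋-true {P = Relevant (ψ , Automorphism.to σ ∘ w) f}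
                   (m , ≈-trans v (≈-auto σ fx w) , to (moves ψ w f) s))
          (λ q → let (m , v , s) = ⌊⌋-sound {P = Relevant (ψ , Automorphism.to σ ∘ w) f} q in
                 ⌊⌋-true {P = Relevant (ψ , w) (Automorphism.from σ ∘ f)}
                   (m , ≈-trans v (≈-sym (≈-auto σ fx w)) , from (moves ψ w f) s)))
        rank
        where
        moves : ∀ (ψ : Inst (Fin n ⊎ J)) w f →
                ⟦ ψ ⟧ [ w , Automorphism.from σ ∘ f ]′ ⇔ ⟦ ψ ⟧ [ Automorphism.to σ ∘ w , f ]′
        moves ψ w f = auto⇒⟦⟧ ψ σ λ j → auto-invˡ σ (f j)

      π : Pair → Bool
      π = proj₁ (proj₁ (proj₂ derivative))

      Kπ : K rank π
      Kπ = proj₂ (proj₁ (proj₂ derivative))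

      π-fits : ∀ F → ∃ λ f → Y₀ f × Fits F π f
      π-fits = K-fits rank Kπ

      -- Two points of a coheir sequence over a model are not separated, and
      -- any realisation of the type followed by a coheir realisation looks the same.
      module _ (M : SmallModel B) (ψ : Inst (Fin n ⊎ J)) {w w′ : Fin n → C}
               (w≈w′ : w ≈[ SmallModel.N M ] w′) where

        open SmallModel M

        private
          co = coheir elementary (w ∘ lower)
          module Co = Coheir co
          Λ = Lift ℓ ℕ
          module W = WellOrder (wellOrder Λ)

        open MorleySequence {Finitary n} {Λ} (Lift-small Fin-small) (Lift-small ℕ-small) Co.𝒰 N-small
          using (sequence; Before; sequence-realises)

        c* : Finitary n → C
        c* = Realise.realisation (Lift-small Fin-small) Co.𝒰
          (∪-small N-small (∪-small (tuple-small w) (tuple-small w′)))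

        c*-realises : c* ⊩[ N ∪ (Range w ∪ Range w′) ] Co.𝒰
        c*-realises = Realise.realises (Lift-small Fin-small) Co.𝒰
          (∪-small N-small (∪-small (tuple-small w) (tuple-small w′)))

        point : Λ → Fin n → C
        point k = sequence k ∘ lift

        point-base : ∀ k → w ≈[ N ] point k
        point-base k = ≈-∘ lift (Co.base-≈ (⊩-mono Co.𝒰 inj₁ (sequence-realises k)))

        same-pair : ∀ {v : Fin n → C} → w ≈[ N ] v → Range v ⊆ Range w ∪ Range w′ → ∀ {k l} → k W.< l →
                    [ sequence k , sequence l ]′ ≈[ N ] [ v ∘ lower , c* ]′
        same-pair {v} p i {k} {l} k<l = coheir-swap co
          (≈-trans (≈-sym (≈-∘ lower (point-base k))) (≈-∘ lower p))
          (⊩-mono Co.𝒰 (λ { (inj₁ d) → inj₁ d ; (inj₂ (j , q)) → inj₂ (k , k<l , j , q) }) (sequence-realises l))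
          (⊩-mono Co.𝒰 (λ { (inj₁ d) → inj₁ d ; (inj₂ (j , q)) → inj₂ (i (lower j , q)) }) c*-realises)

        -- An automorphism over `N` carries the pair from the sequence to the pair `v`, `c*`, but it
        -- moves `π` to another member of the last derivative. Hence agreement is required for all
        -- its members and not for `π` alone.
        π-same : ∀ {v : Fin n → C} → w ≈[ N ] v → Range v ⊆ Range w ∪ Range w′ → ∀ {k l} → k W.< l →
                 (∀ π → K rank π → π (ψ , point k) ≡ π (ψ , point l)) → π (ψ , v) ≡ π (ψ , c* ∘ lift)
        π-same {v} p i {k} {l} k<l rep =
          let (σ , h , fx) = homogeneous {J = Finitary n ⊎ Finitary n}
                               (⊎-small (Lift-small Fin-small) (Lift-small Fin-small)) N-small (same-pair p i k<l)
              moved : ∀ {u u′ : Fin n → C} → (∀ j → Automorphism.to σ (u j) ≡ u′ j) →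
                      π (ψ , Automorphism.to σ ∘ u) ≡ π (ψ , u′)
              moved q = cong (λ u → π (ψ , u)) (ext q)
          in trans (sym (moved (λ j → h (inj₁ (lift j)))))
            (trans (rep _ (automorphism-acts σ (λ d → fx (includes d)) {π} Kπ)) (moved (λ j → h (inj₂ (lift j)))))

        SamePattern : Λ → Λ → Set ℓ
        SamePattern k l = ∀ π → K rank π → π (ψ , point k) ≡ π (ψ , point l)

        -- The well-order on `Λ` need not be the usual order of the natural numbers, so the two
        -- indices may come in either order.
        orient : ∀ {i j} → ¬ (i ≡ j) → SamePattern (lift i) (lift j) →
                 lift i W.< lift j ⊎ _≡_ {A = Λ} (lift i) (lift j) ⊎ lift j W.< lift i →
                 ∃ λ k → ∃ λ l → k W.< l × SamePattern k l
        orient d rep (inj₁ lt)          = _ , _ , lt , rep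
        orient d rep (inj₂ (inj₁ refl)) = ⊥-elim (d refl)
        orient d rep (inj₂ (inj₂ lt))   = _ , _ , lt , λ π k → sym (rep π k)

        abstract
          repeated : ∃ λ k → ∃ λ l → k W.< l × SamePattern k l
          repeated =
            let (i , j , i<j , rep) = repetition {rank} (proj₂ (proj₂ derivative)) λ i → ψ , point (lift i)
            in orient {i} {j} (<⇒≢ i<j) (λ π → rep {π}) (W.total (lift i) (lift j))

        -- Both points are compared with `c*`, which realises the coheir over the two of them
        -- together.
        π-invariant : π (ψ , w) ≡ π (ψ , w′)
        π-invariant = let (k , l , k<l , rep) = repeated in
          trans (π-same ≈-refl inj₁ k<l rep) (sym (π-same w≈w′ inj₂ k<l rep))

    record Twins : Set (lsuc ℓ) where
      constructor twins
      field
        ψ        : Inst (Fin n ⊎ J)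
        {w w′}   : Fin n → C
        over-B   : x₀ ≈[ B ] w
        model    : SmallModel B
        w≈w′     : w ≈[ SmallModel.N model ] w′

    True : Set ℓ
    True = Σ (Inst (J ⊎ Σ C B)) λ ι → ⟦ ι ⟧ [ e , proj₁ ]′

    Met : True ⊎ Twins → (J → C) → Set ℓ
    Met (inj₁ (ι , _)) f = ⟦ ι ⟧ [ f , proj₁ ]′
    Met (inj₂ t)       f = ⟦ Twins.ψ t ⟧ [ Twins.w t , f ]′ → ⟦ Twins.ψ t ⟧ [ Twins.w′ t , f ]′

    base-formulas : List (True ⊎ Twins) → List (Inst (J ⊎ Σ C B))
    base-formulas []                   = []
    base-formulas (inj₁ (ι , _) ∷ Ls) = ι ∷ base-formulas Ls
    base-formulas (inj₂ _ ∷ Ls)       = base-formulas Ls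

    base-true : ∀ Ls → All (λ ι → ⟦ ι ⟧ [ e , proj₁ ]′) (base-formulas Ls)
    base-true []                   = []
    base-true (inj₁ (_ , s) ∷ Ls) = s ∷ base-true Ls
    base-true (inj₂ _ ∷ Ls)       = base-true Ls

    twin-formulas : List (True ⊎ Twins) → List (Inst (Fin n ⊎ J))
    twin-formulas []            = []
    twin-formulas (inj₁ _ ∷ Ls) = twin-formulas Ls
    twin-formulas (inj₂ t ∷ Ls) = Twins.ψ t ∷ twin-formulas Ls

    points : List (True ⊎ Twins) → List Pair
    points []            = []
    points (inj₁ _ ∷ Ls) = points Ls
    points (inj₂ t ∷ Ls) = (Twins.ψ t , Twins.w t) ∷ (Twins.ψ t , Twins.w′ t) ∷ points Ls

    -- Finitely many demands mention finitely many formulas and points; a tuple that fits the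
    -- pattern `π` at these points inherits its invariance.
    fip : ∀ Ls → ∃ λ f → All (λ d → Met d f) Ls
    fip Ls = f , meet Ls id (⋀ᴵ⁻ (base-formulas Ls) (proj₁ (proj₂ found))) (proj₂ (proj₂ found))
      where
      open Patterns (twin-formulas Ls) (⋀ᴵ (base-formulas Ls)) (⋀ᴵ⁺ (base-formulas Ls) (base-true Ls))
      open CantorBendixson truth Y₀ using (Fits)
      found = π-fits (points Ls)
      f = proj₁ found
      meet : ∀ Ms → (∀ {ψ} → ψ ∈ᴸ twin-formulas Ms → ψ ∈ᴸ twin-formulas Ls) →
             All (λ ι → ⟦ ι ⟧ [ f , proj₁ ]′) (base-formulas Ms) → Fits (points Ms) π f → All (λ d → Met d f) Ms
      meet []            i []       []           = []
      meet (inj₁ _ ∷ Ms) i (s ∷ ss) ps           = s ∷ meet Ms i ss ps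
      meet (inj₂ (twins ψ {w} {w′} v M p) ∷ Ms) i ss (q ∷ q′ ∷ ps) =
        (λ s → proj₂ (proj₂ (⌊⌋-sound {P = Relevant (ψ , w′) f} (trans q′
          (trans (sym (π-invariant M ψ p)) (trans (sym q)
            (⌊⌋-true {P = Relevant (ψ , w) f} (i (here refl) , v , s)))))))) ∷
        meet Ms (i ∘ there) ss ps

    abstract
      invariantType : Ultrafilter (J → C)
      invariantType = proj₁ (fip⇒ultrafilter Met fip)

      invariantType-met : ∀ d → invariantType ∋ Met d
      invariantType-met = proj₂ (fip⇒ultrafilter Met fip)

  -- Agreement with a member of a long Morley sequence

  Σ-↣ : {S : Set a} {F : S → Set b} {G : S → Set c} → (∀ s → F s ↣ G s) → Σ S F ↣ Σ S G
  Σ-↣ {S = S} {F} f = inject (λ (s , p) → s , Injection.to (f s) p) (λ {p} {q} e → go p q (Σ-≡,≡←≡ e))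
    where
    go : ∀ (p q : Σ S F) → (Σ[ e ∈ proj₁ p ≡ proj₁ q ] subst _ e (Injection.to (f (proj₁ p)) (proj₂ p))
           ≡ Injection.to (f (proj₁ q)) (proj₂ q)) → p ≡ q
    go (s , p) (_ , q) (refl , e) = cong (s ,_) (Injection.injective (f s) e)

  inst-block-small : {J : Set ℓ} → J ≺ κ̄ → Inst (Fin n ⊎ J) ≺ κ̄
  inst-block-small {n} {J} s = surj-small {X = Inst (Finitary n ⊎ J)} (mapᴵ (map₁ˢ lower))
    (λ { (inst φ i) → inst φ (map (map₁ˢ lift) i) , cong (inst φ) (trans (sym (map-∘ (map₁ˢ lower) (map₁ˢ lift) i))
      (trans (map-cong (λ { (inj₁ _) → refl ; (inj₂ _) → refl }) i) (map-id i))) })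
    (inst-small (⊎-small (Lift-small Fin-small) s))

  ⊥-small : Small (λ _ → ⊥ᵖ)
  ⊥-small = ⊥ᵖ , ↣-small (inject (λ ()) λ { {()} }) ℕ-small , (λ ()) , λ _ ()

  entries : List (Fin n → C) → Subset ℭ
  entries []      = λ _ → ⊥ᵖ
  entries (z ∷ L) = Range z ∪ entries L

  entries-small : (L : List (Fin n → C)) → Small (entries L)
  entries-small []      = ⊥-small
  entries-small (z ∷ L) = ∪-small (tuple-small z) (entries-small L)

  module _ {J : Set ℓ} (ψ : Inst (Fin n ⊎ J)) (σ : Automorphism ℭ) where

    open Tree (λ x (f : J → C) → ⟦ ψ ⟧ [ x , f ]′)

    tree-auto : ∀ N {P P′} → (∀ z → P z → P′ (Automorphism.to σ ∘ z)) → Tr N P (λ _ → ⊤) → Tr N P′ (λ _ → ⊤)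
    tree-auto zero    h (z , p) = _ , h z p
    tree-auto (suc N) h (f , _ , l , r) = Automorphism.to σ ∘ f , tt ,
      tree-auto N (λ z (p , s) → h z p , to (moves z) s) l ,
      tree-auto N (λ z (p , k) → h z p , λ s → k (from (moves z) s)) r
      where
      moves : ∀ z → ⟦ ψ ⟧ [ z , f ]′ ⇔ ⟦ ψ ⟧ [ Automorphism.to σ ∘ z , Automorphism.to σ ∘ f ]′
      moves z = auto⇒⟦⟧ ψ σ λ _ → refl

  module Generic {B : Subset ℭ} {y : Fin n → C} (y-stable : Stable y B)
                 {J : Set ℓ} (J-small : J ≺ κ̄) (e : J → C) (M : SmallModel B) where

    open InvariantType y-stable e using (invariantType; invariantType-met; twins)
    open SmallModel M

    private
      t = invariantType

    Fm : Set ℓ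
    Fm = Inst (Fin n ⊎ J)

    -- The power set of the set of pairs of a formula and a height, too large to be injected into
    -- that set; `agreement` relies on this.
    Λ : Set ℓ
    Λ = Fm × Lift ℓ ℕ → Bool

    Λ-small : Λ ≺ κ̄
    Λ-small = pow-small (×-small (inst-block-small J-small) (Lift-small ℕ-small))

    open MorleySequence J-small Λ-small t N-small public using (sequence; Before; before-small; sequence-realises)

    private
      W = wellOrder Λ
      module W = WellOrder W

    transfer : (ψ : Fm) → t ∋ (λ f → ⟦ ψ ⟧ [ y , f ]′) → ∀ {z} → y ≈[ N ] z → t ∋ (λ f → ⟦ ψ ⟧ [ z , f ]′)
    transfer ψ u p = ∋-mono t (λ f (s , h) → h s) (∋-× t u (invariantType-met (inj₂ (twins ψ ≈-refl M p))))

    module _ {a : Fin n → C} (y≈a : y ≈[ N ] a) where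

      module _ (ψ : Fm) where

        open Tree (λ x (f : J → C) → ⟦ ψ ⟧ [ x , f ]′)

        Like : Λ → (Fin n → C) → Set ℓ
        Like k z = a ≈[ Before k ] z

        like⇒≈N : ∀ k {z} → Like k z → y ≈[ N ] z
        like⇒≈N k p = ≈-trans y≈a (≈-mono {D = N} {D′ = Before k} inj₁ p)

        Height : Λ → ℕ → Set ℓ
        Height k h = Tr h (Like k) (λ _ → ⊤)

        last-height : ∀ {P : ℕ → Set ℓ} H → P 0 → ¬ P H → ∃ λ h → P h × ¬ P (suc h)
        last-height zero    p np = ⊥-elim (np p)
        last-height {P} (suc H) p np = [ (λ h → H , h , np) , last-height {P} H p ]′ (decide (P H))
          where
          decide : (Q : Set ℓ) → Q ⊎ ¬ Q
          decide Q = case em of λ { (yes q) → inj₁ q ; (no q) → inj₂ q }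

        bounded : ∀ k → ∃ λ H → ¬ Height k H
        bounded k = proj₁ (y-stable ψ) , λ u → proj₂ (y-stable ψ) (tr-mono (proj₁ (y-stable ψ))
          {P = Like k} {P′ = λ z → y ≈[ B ] z} (λ z p → ≈-mono {D = B} {D′ = N} includes (like⇒≈N k p)) (λ _ → id) u)

        maximal : ∀ k → ∃ λ h → Height k h × ¬ Height k (suc h)
        maximal k = last-height {Height k} (proj₁ (bounded k)) (a , ≈-refl) (proj₂ (bounded k))

        -- A tree uses only finitely many leaves, so a tuple `f` in the required relation to these
        -- keeps the whole tree; such an `f` is later taken to realise `t` over them.
        leaves : ∀ h {P P′ : (Fin n → C) → Set ℓ} → (∀ z → P′ z → P z) → Tr h P′ (λ _ → ⊤) →
                 ∃ λ L → All P L × ∀ f → All (λ z → ⟦ ψ ⟧ [ z , f ]′) L → Tr h (λ z → P′ z × ⟦ ψ ⟧ [ z , f ]′) (λ _ → ⊤)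
        leaves zero    i (z , p) = z ∷ [] , i z p ∷ [] , λ { f (s ∷ []) → z , p , s }
        leaves (suc h) i (g , _ , l , r) =
          let (L₁ , p₁ , k₁) = leaves h (λ z (p , _) → i z p) l
              (L₂ , p₂ , k₂) = leaves h (λ z (p , _) → i z p) r
          in L₁ ++ᴸ L₂ , ++⁺ p₁ p₂ , λ f ss → g , tt ,
             tr-mono h (λ z ((p , s) , u) → (p , u) , s) (λ _ → id) (k₁ f (++⁻ˡ L₁ ss)) ,
             tr-mono h (λ z ((p , s) , u) → (p , u) , s) (λ _ → id) (k₂ f (++⁻ʳ L₁ ss))

        module _ (u : t ∋ (λ f → ⟦ ψ ⟧ [ y , f ]′)) where

          Half : Λ → (J → C) → (Fin n → C) → Set ℓ
          Half k f z = Like k z × ⟦ ψ ⟧ [ z , f ]′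

          move-half : ∀ k (σ : Automorphism ℭ) → Fixes σ (Before k) → ∀ {f} →
                      (∀ j → Automorphism.to σ (f j) ≡ sequence k j) →
                      ∀ z → Half k f z → Half k (sequence k) (Automorphism.to σ ∘ z)
          move-half k σ fx {f} moved z (p , s) =
            ≈-trans {D = Before k} {a} {z} p (≈-auto {D = Before k} σ fx z) ,
            to (auto⇒⟦⟧ ψ σ moved) s

          module _ (k : Λ) (L : List (Fin n → C)) where

            private
              D = Before k ∪ entries L

            D-small : Small D
            D-small = ∪-small (before-small k) (entries-small L)

            f : J → C
            f = Realise.realisation J-small t D-small

            f-realises : f ⊩[ D ] t
            f-realises = Realise.realises J-small t D-small

            holds-at : ∀ z → (∀ i → entries L (z i)) → y ≈[ N ] z → ⟦ ψ ⟧ [ z , f ]′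
            holds-at z d p = ⟦mapᴵ⟧⁻ q ψ (λ v → sym (val f v)) (f-realises (mapᴵ q ψ) (∋-mono t {Q = λ g → ⟦ ψ ⟧ [ z , g ]′}
                (λ g s → ⟦mapᴵ⟧⁺ q ψ (val g) s) (transfer ψ u p)))
              where
              q : Fin n ⊎ J → J ⊎ Σ C D
              q (inj₁ i) = inj₂ (z i , inj₂ (d i))
              q (inj₂ j) = inj₁ j
              val : ∀ g v → [ z , g ]′ v ≡ [ g , proj₁ ]′ (q v)
              val g (inj₁ _) = refl
              val g (inj₂ _) = refl

            all-hold : ∀ L′ → (∀ {c} → entries L′ c → entries L c) → All (Like k) L′ →
                       All (λ z → ⟦ ψ ⟧ [ z , f ]′) L′
            all-hold []       i []       = []
            all-hold (z ∷ L′) i (p ∷ ps) = holds-at z (λ j → i (inj₁ (j , refl))) (like⇒≈N k p) ∷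
                                           all-hold L′ (λ d → i (inj₂ d)) ps

            f≈sequence : f ≈[ Before k ] sequence k
            f≈sequence = ⊩-≈ t (⊩-mono t {D = Before k} {D′ = D} inj₁ f-realises) (sequence-realises k)

          -- By invariance every leaf z of the tree satisfies ψ(z, f) for f realising t.
          positive-half : ∀ k h → Height k h → Tr h (Half k (sequence k)) (λ _ → ⊤)
          positive-half k h tree =
            let (L , ps , build) = leaves h {P = Like k} {P′ = Like k} (λ z p → p) tree
                (σ , moved , fx) = homogeneous J-small (before-small k) (f≈sequence k L)
            in tree-auto ψ σ h {P = Half k (f k L)} {P′ = Half k (sequence k)} (move-half k σ fx moved)
                 (build (f k L) (all-hold k L L id ps))

          negative-half : ∀ {k l} → k W.< l → ¬ ⟦ ψ ⟧ [ a , sequence k ]′ → ∀ h → Height l h →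
                          Tr h (λ z → Like k z × ¬ ⟦ ψ ⟧ [ z , sequence k ]′) (λ _ → ⊤)
          negative-half {k} {l} k<l ns h = tr-mono h {P = Like l} {P′ = λ z → Like k z × ¬ ⟦ ψ ⟧ [ z , sequence k ]′}
            (λ z p → ≈-mono {D = Before k} {D′ = Before l} earlier p , fails z p) (λ _ → id)
            where
            earlier : Before k ⊆ Before l
            earlier (inj₁ d)                 = inj₁ d
            earlier (inj₂ (m , m<k , j , p)) = inj₂ (m , W.<-trans m<k k<l , j , p)
            fails : ∀ z → Like l z → ¬ ⟦ ψ ⟧ [ z , sequence k ]′
            fails z p s = ns (≈⇒⟦⟧ ψ {Before l} {z} {a} (≈-sym {D = Before l} {a} {z} p) (sequence k)
              (λ j → inj₂ (k , k<l , j , refl)) s)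

          -- The term `sequence k` becomes a new root with a tree of height `h` on either side: on
          -- the right because the leaves share the failure of `a` there, on the left by
          -- `positive-half`.
          height-drops : ∀ {k l} → k W.< l → ¬ ⟦ ψ ⟧ [ a , sequence k ]′ → ∀ h → Height l h → Height k (suc h)
          height-drops {k} {l} k<l ns h tree = sequence k , tt ,
            positive-half k h (tr-mono h {P = λ z → Like k z × ¬ ⟦ ψ ⟧ [ z , sequence k ]′} {P′ = Like k}
              (λ z → proj₁) (λ _ → id) (negative-half k<l ns h tree)) , negative-half k<l ns h tree

      -- Otherwise k ↦ (ψ, h) is injective, where ψ is a formula on which aₖ
      -- disagrees with t and h the height of the largest ψ-tree in tp(a/Before k).
      agreement : ∃ λ k → ∀ ψ → t ∋ (λ f → ⟦ ψ ⟧ [ y , f ]′) → ⟦ ψ ⟧ [ a , sequence k ]′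
      agreement = stable λ none → cantor (inject (index none)
        (injective-if-increasing W (index none) (λ {k} {l} → distinct none {k} {l})))
        where
        module _ (none : ¬ ∃ λ (k : Λ) → ∀ (ψ : Fm) → t ∋ (λ f → ⟦ ψ ⟧ [ y , f ]′) → ⟦ ψ ⟧ [ a , sequence k ]′) where
          bad : ∀ k → ∃ λ ψ → t ∋ (λ f → ⟦ ψ ⟧ [ y , f ]′) × ¬ ⟦ ψ ⟧ [ a , sequence k ]′
          bad k = stable λ h → none (k , λ ψ u → stable λ ns → h (ψ , u , ns))
          index : Λ → Fm × Lift ℓ ℕ
          index k = proj₁ (bad k) , lift (proj₁ (maximal (proj₁ (bad k)) k))
          distinct : ∀ {k l} → k W.< l → ¬ (index k ≡ index l)
          distinct {k} {l} k<l q = proj₂ (proj₂ (maximal (proj₁ (bad k)) k))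
            (height-drops (proj₁ (bad k)) (proj₁ (proj₂ (bad k))) k<l (proj₂ (proj₂ (bad k))) _
              (subst₂ (λ ψ h → Height ψ l h) (sym (cong proj₁ q)) (sym (cong (lower ∘ proj₂) q))
                (proj₁ (proj₂ (maximal (proj₁ (bad l)) l)))))

  -- Extensions that preserve the rank

  move-model : {B : Subset ℭ} (τ : Automorphism ℭ) → Fixes τ B → SmallModel B → SmallModel B
  move-model {B} τ fx M = record
    { N          = τ · N
    ; N-small    = ·-small τ N-small
    ; elementary = el
    ; includes   = λ {c} d → includes (subst B (trans (sym (auto-invʳ τ c)) (cong (Automorphism.from τ) (fx d))) d)
    }
    where
    open SmallModel M
    el : Elementary (τ · N)
    el ι x s = let (c , d , s′) = elementary (mapᴵ q ι) (Automorphism.from τ ∘ x) (down x s) in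
      Automorphism.to τ c , subst N (sym (auto-invʳ τ c)) d , up c s′
      where
      q : Fin 1 ⊎ Σ C (τ · N) → Fin 1 ⊎ Σ C N
      q = map₂ˢ λ (c , d) → Automorphism.from τ c , d
      val : ∀ (x : Fin 1 → C) v → Automorphism.to τ ([ x , proj₁ ]′ (q v)) ≡ [ Automorphism.to τ ∘ x , proj₁ ]′ v
      val x (inj₁ _) = refl
      val x (inj₂ _) = auto-invˡ τ _
      down : ∀ x → ⟦ ι ⟧ [ x , proj₁ ]′ → ⟦ mapᴵ q ι ⟧ [ Automorphism.from τ ∘ x , proj₁ ]′
      down x s = subst id (sym (⟦mapᴵ⟧ q ι _)) (from (⟦⟧-auto τ ι _) (⟦⟧-cong ι
        (λ v → trans (fix-x v) (sym (val (Automorphism.from τ ∘ x) v))) s))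
        where
        fix-x : ∀ v → [ x , proj₁ ]′ v ≡ [ Automorphism.to τ ∘ Automorphism.from τ ∘ x , proj₁ ]′ v
        fix-x (inj₁ i) = sym (auto-invˡ τ (x i))
        fix-x (inj₂ _) = refl
      up : ∀ c → ⟦ mapᴵ q ι ⟧ [ (λ _ → c) , proj₁ ]′ → ⟦ ι ⟧ [ (λ _ → Automorphism.to τ c) , proj₁ ]′
      up c s = ⟦⟧-cong ι (val (λ _ → c)) (to (⟦⟧-auto τ ι _) (subst id (⟦mapᴵ⟧ q ι _) s))

  Extendible : Ord (lsuc ℓ) → ℕ → Set (lsuc ℓ)
  Extendible α n = ∀ {y : Fin n → C} {B} → Small B → Stable y B → Rk α y B →
                   ∀ {D} → Small D → B ⊆ D → ∃ λ z → y ≈[ B ] z × Rk α z D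

  -- An extension of tp(y/B) to D whose rank is at least every β for which the
  -- extension property is known.
  module FreeExtension {y : Fin n → C} {B : Subset ℭ} (B-small : Small B) (y-stable : Stable y B)
                       {D : Subset ℭ} (D-small : Small D) where

    open Enumeration (enumerate D-small) renaming (Index to J; small to J-small)
    open InvariantType y-stable (proj₁ ∘ elem) using (invariantType; invariantType-met)

    private
      t = invariantType

    e : J → C
    e = proj₁ ∘ elem

    By-small : Small (B ∪ Range y)
    By-small = ∪-small B-small (tuple-small y)

    f : J → C
    f = Realise.realisation J-small t By-small

    f-realises : f ⊩[ B ∪ Range y ] t
    f-realises = Realise.realises J-small t By-small

    base : {g : J → C} → g ⊩[ B ] t → e ≈[ B ] g
    base h ι s = h ι (invariantType-met (inj₁ (ι , s)))

    abstract
      to-f : Σ[ σ ∈ Automorphism ℭ ] (∀ j → Automorphism.to σ (e j) ≡ f j) × Fixes σ B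
      to-f = homogeneous J-small B-small (base (⊩-mono t inj₁ f-realises))

    σ : Automorphism ℭ
    σ = proj₁ to-f

    -- Chosen so that `z` stands to `e` as `y` stands to `f`, a realisation of `t` over `B` and `y`.
    -- No rank enters the choice.
    z : Fin n → C
    z = Automorphism.from σ ∘ y

    y≈z : y ≈[ B ] z
    y≈z = ≈-auto (σ ⁻¹) (λ {c} d → trans (cong (Automorphism.from σ) (sym (proj₂ (proj₂ to-f) d))) (auto-invʳ σ c)) y

    in-t : (ψ : Inst (Fin n ⊎ J)) → ⟦ ψ ⟧ [ z , e ]′ → t ∋ (λ g → ⟦ ψ ⟧ [ y , g ]′)
    in-t ψ s = stable λ k → f-realises (mapᴵ q (¬ᴵ ψ)) (∋-mono t (λ g ns → subst id (sym (⟦mapᴵ⟧ q (¬ᴵ ψ) _))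
        (λ v → ns (⟦⟧-cong ψ (λ v → sym (q-val g v)) v))) (∋-¬⁺ t k))
      (⟦mapᴵ⟧⁺ q ψ (λ v → trans (val v) (q-val f v)) (to (⟦⟧-auto σ ψ _) s))
      where
      q : Fin n ⊎ J → J ⊎ Σ C (B ∪ Range y)
      q (inj₁ i) = inj₂ (y i , inj₂ (i , refl))
      q (inj₂ j) = inj₁ j
      q-val : ∀ g v → [ y , g ]′ v ≡ [ g , proj₁ ]′ (q v)
      q-val g (inj₁ _) = refl
      q-val g (inj₂ _) = refl
      val : ∀ v → Automorphism.to σ ([ z , e ]′ v) ≡ [ y , f ]′ v
      val (inj₁ i) = auto-invˡ σ (y i)
      val (inj₂ j) = proj₁ (proj₂ to-f) j

    module _ {β : Ord (lsuc ℓ)} (extendible : Extendible β n) (rank : Rk β y B) where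

      private
        M = löwenheim-skolem B-small
        first = extendible B-small y-stable rank (SmallModel.N-small M) (SmallModel.includes M)
        abstract
          back : Σ[ τ ∈ Automorphism ℭ ] (∀ (j : Finitary n) → Automorphism.to τ (proj₁ first (lower j)) ≡ y (lower j)) × Fixes τ B
          back = homogeneous {J = Finitary n} (Lift-small Fin-small) B-small (≈-∘ lower (≈-sym (proj₁ (proj₂ first))))
        τ = proj₁ back

      -- Passing to a model must not cost rank: an extension of rank `β` over some model is
      -- conjugated back to `y` over `B`, and the model is moved along.
      M₀ : SmallModel B
      M₀ = move-model τ (proj₂ (proj₂ back)) M

      open SmallModel M₀

      rank-N : Rk β y N
      rank-N = Rk-≈ β (≈-pointwise λ j → proj₁ (proj₂ back) (lift j)) (Rk-auto β τ (proj₂ (proj₂ first)))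

      open Generic y-stable J-small e M₀ using (Λ; Λ-small; sequence; Before; sequence-realises; agreement)

      All-terms : Subset ℭ
      All-terms = N ∪ Range {I = Λ × J} λ (k , j) → sequence k j

      -- All terms of the sequence are adjoined at once, because the term at which `agreement` holds
      -- depends on the realisation found here.
      second : ∃ λ a → y ≈[ N ] a × Rk β a All-terms
      second = extendible N-small (stable-mono includes ≈-refl y-stable) rank-N
        (∪-small N-small (range-small (×-small Λ-small J-small) _)) inj₁

      x₁ : Fin n → C
      x₁ = proj₁ second

      generic : ∃ λ k → ∀ ψ → t ∋ (λ f → ⟦ ψ ⟧ [ y , f ]′) → ⟦ ψ ⟧ [ x₁ , sequence k ]′
      generic = agreement (proj₁ (proj₂ second))

      g : J → C
      g = sequence (proj₁ generic)

      abstract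
        to-g : Σ[ η ∈ Automorphism ℭ ] (∀ j → Automorphism.to η (e j) ≡ g j) × Fixes η B
        to-g = homogeneous J-small B-small (base (⊩-mono t (λ d → inj₁ (includes d)) (sequence-realises (proj₁ generic))))

      η : Automorphism ℭ
      η = proj₁ to-g

      g-covers : ∀ {c} (d : (η · D) c) → g (proj₁ (covers d)) ≡ c
      g-covers {c} d = trans (sym (proj₁ (proj₂ to-g) _))
        (trans (cong (Automorphism.to η) (proj₂ (covers d))) (auto-invˡ η c))

      -- By `in-t` every formula true of `z` and `e` is one that `t` prescribes at `y`, and
      -- `generic` makes it true of `x₁` and `g`. Thus the rank of `x₁` can be carried back to `z`
      -- over `D`.
      ηz≈x₁ : (Automorphism.to η ∘ z) ≈[ η · D ] x₁
      ηz≈x₁ ι s = ⟦mapᴵ⟧⁻ q ι (λ v → sym (q-val x₁ v)) (proj₂ generic (mapᴵ q ι) (in-t (mapᴵ q ι) (from (⟦⟧-auto η (mapᴵ q ι) _)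
          (⟦⟧-cong (mapᴵ q ι) η-val (⟦mapᴵ⟧⁺ q ι (q-val _) s)))))
        where
        q : Fin n ⊎ Σ C (η · D) → Fin n ⊎ J
        q = map₂ˢ λ (c , d) → proj₁ (covers d)
        q-val : ∀ (x : Fin n → C) v → [ x , proj₁ ]′ v ≡ [ x , g ]′ (q v)
        q-val x (inj₁ _)       = refl
        q-val x (inj₂ (c , d)) = sym (g-covers d)
        η-val : ∀ v → [ Automorphism.to η ∘ z , g ]′ v ≡ Automorphism.to η ([ z , e ]′ v)
        η-val (inj₁ _) = refl
        η-val (inj₂ j) = sym (proj₁ (proj₂ to-g) j)

      ηD⊆terms : (η · D) ⊆ All-terms
      ηD⊆terms d = inj₂ ((proj₁ generic , proj₁ (covers d)) , g-covers d)

      rank-x₁ : Rk β x₁ (η · D)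
      rank-x₁ = Rk-antitone β {x₁} {All-terms} {η · D} ηD⊆terms (proj₂ (proj₂ second))

      rank-z : Rk β z D
      rank-z = Rk-auto⁻ β η {z} {D} (Rk-≈ β {x₁} {Automorphism.to η ∘ z} {η · D} (≈-sym {D = η · D} ηz≈x₁) rank-x₁)

  -- If no extension to `D` had rank α+1, each type over `D` would have, over any larger small set,
  -- fewer than some small number of extensions of rank α. Their sum is small, and more than that
  -- many extensions of tp(y/B), carried over to a set containing `D`, cannot be distributed among
  -- these types.
  module SuccessorExtension {α : Ord (lsuc ℓ)} (extendible : Extendible α n) {y : Fin n → C} {B : Subset ℭ}
                            (y-stable : Stable y B) (rank : Rk (Ord.suc α) y B)
                            {D : Subset ℭ} (D-small : Small D) (B⊆D : B ⊆ D)
                            (none : ¬ ∃ λ z → y ≈[ B ] z × Rk (Ord.suc α) z D) where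

    open Enumeration (enumerate D-small) renaming (Index to J; small to J-small)

    Code : Set ℓ
    Code = Inst (Fin n ⊎ J) → Bool

    code : (Fin n → C) → Code
    code z ι = ⌊ ⟦ ι ⟧ [ z , proj₁ ∘ elem ]′ ⌋

    same-code : ∀ {z z′} → code z ≡ code z′ → z ≈[ D ] z′
    same-code {z} {z′} p ι s = ⟦mapᴵ⟧⁻ q ι (λ v → sym (val z′ v)) (⌊⌋-sound (trans (sym (cong (λ g → g (mapᴵ q ι)) p))
        (⌊⌋-true (⟦mapᴵ⟧⁺ q ι (val z) s))))
      where
      q : Fin n ⊎ Σ C D → Fin n ⊎ J
      q = map₂ˢ λ (c , d) → proj₁ (covers d)
      val : ∀ (z : Fin n → C) v → [ z , proj₁ ]′ v ≡ [ z , proj₁ ∘ elem ]′ (q v)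
      val z (inj₁ _)       = refl
      val z (inj₂ (c , d)) = sym (proj₂ (covers d))

    Family : (Fin n → C) → Set ℓ → Set (lsuc ℓ)
    Family z κ = Σ[ E ∈ Subset ℭ ] Small E × D ⊆ E × Σ[ x ∈ (κ → Fin n → C) ]
      (∀ {i j} → x i ≈[ E ] x j → i ≡ j) × (∀ i → z ≈[ D ] x i × Rk α (x i) E)

    Limited : Code → Set ℓ → Set (lsuc ℓ)
    Limited s κ = κ ≺ κ̄ × ∀ {z} → y ≈[ B ] z → code z ≡ s → ¬ Family z κ

    abstract
      limit-of : ∀ s → ∃ (Limited s)
      limit-of s with em {P = ∃ λ z → y ≈[ B ] z × code z ≡ s}
      -- No realisation of tp(y/B) has this code, so any small cardinal may serve as its bound.
      ... | no h = Lift ℓ ℕ , Lift-small ℕ-small , λ p q → ⊥-elim (h (_ , p , q))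
      ... | yes (z , p , refl) = stable λ h → none (z , p , λ κ sκ → stable λ nf →
        h (κ , sκ , λ { p′ q (E , sE , i , x , inj , g) → nf (E , sE , i , x , inj ,
             λ k → ≈-trans (same-code (sym q)) (proj₁ (g k)) , proj₂ (g k)) }))

    bound : Code → Set ℓ
    bound s = proj₁ (limit-of s)

    Total : Set ℓ
    Total = Σ Code bound

    total-small : Total ≺ κ̄
    total-small = Σ-small (pow-small (inst-block-small J-small)) λ s → proj₁ (proj₂ (limit-of s))

    -- More extensions of rank α than the sum of all the bounds.
    given = rank (Total → Bool) (pow-small total-small)
    B₁ = proj₁ given
    B₁-small = proj₁ (proj₂ given)
    B⊆B₁ : B ⊆ B₁
    B⊆B₁ = proj₁ (proj₂ (proj₂ given))
    x = proj₁ (proj₂ (proj₂ (proj₂ given)))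
    x-inj : ∀ {i j} → x i ≈[ B₁ ] x j → i ≡ j
    x-inj = proj₁ (proj₂ (proj₂ (proj₂ (proj₂ given))))
    x-rank = proj₂ (proj₂ (proj₂ (proj₂ (proj₂ given))))

    E : Subset ℭ
    E = B₁ ∪ D

    E-small : Small E
    E-small = ∪-small B₁-small D-small

    abstract
      extended : ∀ k → ∃ λ z → x k ≈[ B₁ ] z × Rk α z E
      extended k = extendible B₁-small (stable-mono B⊆B₁ (proj₁ (x-rank k)) y-stable) (proj₂ (x-rank k)) E-small inj₁

    z : (Total → Bool) → Fin n → C
    z k = proj₁ (extended k)

    z-inj : ∀ {i j} → z i ≈[ E ] z j → i ≡ j
    z-inj {i} {j} p = x-inj (≈-trans (proj₁ (proj₂ (extended i)))
      (≈-trans (≈-mono inj₁ p) (≈-sym (proj₁ (proj₂ (extended j))))))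

    y≈z : ∀ k → y ≈[ B ] z k
    y≈z k = ≈-trans (proj₁ (x-rank k)) (≈-mono B⊆B₁ (proj₁ (proj₂ (extended k))))

    Fibre : Code → Set ℓ
    Fibre s = Σ (Total → Bool) λ k → code (z k) ≡ s

    fibre-≡ : ∀ {s} {p q : Fibre s} → proj₁ p ≡ proj₁ q → p ≡ q
    fibre-≡ {p = k , refl} {_ , refl} refl = refl

    family : ∀ s (h : bound s ↣ Fibre s) k → code (z k) ≡ s → Family (z k) (bound s)
    family s h k p = E , E-small , inj₂ , z ∘ proj₁ ∘ to′ ,
      (λ {i} {j} q → injective (fibre-≡ {s} (z-inj {proj₁ (to′ i)} {proj₁ (to′ j)} q))) ,
      λ i → same-code {z k} {z (proj₁ (to′ i))} (trans p (sym (proj₂ (to′ i)))) ,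
            proj₂ (proj₂ (extended (proj₁ (to′ i))))
      where open Injection h using (injective) renaming (to to to′)

    unbounded-absurd : ∀ s → Fibre s → ¬ (bound s ↣ Fibre s)
    unbounded-absurd s (k , p) h = proj₂ (proj₂ (limit-of s)) {z k} (y≈z k) p (family s h k p)

    fibre-bounded : ∀ s → Fibre s ↣ bound s
    fibre-bounded s = [ (λ h → inject (λ p → ⊥-elim (unbounded-absurd s p h))
                                      λ {p} → ⊥-elim (unbounded-absurd s p h)) , id ]′
      (comparability (bound s) (Fibre s))

    contradiction : ⊥
    contradiction = cantor (inject {X = Total → Bool} {Y = Σ Code Fibre} (λ k → code (z k) , k , refl)
      (cong (λ p → proj₁ (proj₂ p))) ↣-∘ Σ-↣ fibre-bounded)

  all-extendible : ∀ α → Extendible α n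
  all-extendible Ord.zero    sB st h sD i = _ , ≈-refl , tt
  all-extendible (Ord.suc α) sB st h sD i = stable λ none →
    ⊥-elim (SuccessorExtension.contradiction (all-extendible α) st h sD i none)
  -- One `z` serves for every `k`; only the proof of its rank uses the induction hypothesis for
  -- `f k`.
  all-extendible (lim I f)   sB st h sD i = z , y≈z , λ k → rank-z (all-extendible (f k)) (h k)
    where open FreeExtension sB st sD using (z; y≈z; rank-z)

  -- Splitting raises the rank

  module _ (φ : Formula L (n + m)) where

    as-inst : Inst (Fin n ⊎ Finitary m)
    as-inst = inst φ (map inj₁ (allFin n) ++ map inj₂ (map lift (allFin m)))

    ⟦as-inst⟧ : (z : Fin n → C) (a : Vec C m) → ⟦ as-inst ⟧ [ z , lookup a ∘ lower ]′ ≡ (ℭ ⊨ φ [ tabulate z ++ a ])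
    ⟦as-inst⟧ z a = cong (ℭ ⊨ φ [_]) (trans (map-++ _ (map inj₁ (allFin n)) _) (cong₂ _++_
      (trans (sym (map-∘ _ inj₁ (allFin n))) (sym (tabulate-allFin z)))
      (trans (sym (map-∘ _ inj₂ (map lift (allFin m)))) (trans (sym (map-∘ _ lift (allFin m)))
        (trans (sym (tabulate-allFin (lookup a))) (tabulate∘lookup a))))))

  -- Whether a realisation of tp(z/D) satisfies ψ(x, w) and ψ(x, c) depends on
  -- whether the pair (w, c) starts a coheir sequence over N ⊇ A; the conjugates
  -- over N then separate the members of an arbitrarily long coheir sequence.
  module Spread {α : Ord (lsuc ℓ)} {A D : Subset ℭ} (A-small : Small A) (D-small : Small D)
                {z : Fin n → C} (z-stable : Stable z A) (rank : Rk α z D) (A⊆D : A ⊆ D)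
                (M : SmallModel A) {u w c : Finitary m → C}
                (co : Coheir {N = SmallModel.N M} u) (u≈w : u ≈[ SmallModel.N M ] w)
                (c-coheir : c ⊩[ SmallModel.N M ∪ Range w ] Coheir.𝒰 co)
                (w∈D : ∀ j → D (w j)) (c∈D : ∀ j → D (c j))
                (ψ : Inst (Fin n ⊎ Finitary m))
                (differ : ¬ (⌊ ⟦ ψ ⟧ [ z , w ]′ ⌋ ≡ ⌊ ⟦ ψ ⟧ [ z , c ]′ ⌋))
                {κ : Set ℓ} (κ-small : κ ≺ κ̄) where

    open SmallModel M

    Λ : Set ℓ
    Λ = Separated κ

    Λ-small : Λ ≺ κ̄
    Λ-small = pow-small (pow-small κ-small)

    private
      module W = WellOrder (wellOrder Λ)

    open MorleySequence {Finitary m} (Lift-small Fin-small) Λ-small (Coheir.𝒰 co) N-small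
      using (sequence; Before; sequence-realises)

    E : Subset ℭ
    E = A ∪ Range {I = Λ × Finitary m} λ (k , j) → sequence k j

    E-small : Small E
    E-small = ∪-small A-small (range-small (×-small Λ-small (Lift-small Fin-small)) _)

    in-E : ∀ k j → E (sequence k j)
    in-E k j = inj₂ ((k , j) , refl)

    pair-≈ : ∀ {k l} → k W.< l → [ w , c ]′ ≈[ N ] [ sequence k , sequence l ]′
    pair-≈ {k} {l} k<l = coheir-swap co
      (≈-trans {D = N} {w} {u} (≈-sym {D = N} {u} u≈w)
        (Coheir.base-≈ co (⊩-mono (Coheir.𝒰 co) {D = N} {D′ = Before k} inj₁ (sequence-realises k))))
      c-coheir
      (⊩-mono (Coheir.𝒰 co) {D = N ∪ Range (sequence k)} {D′ = Before l}
        (λ { (inj₁ d) → inj₁ d ; (inj₂ (j , q)) → inj₂ (k , k<l , j , q) }) (sequence-realises l))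

    module _ {k l : Λ} (k<l : k W.< l) where

      abstract
        conjugation : Σ[ σ ∈ Automorphism ℭ ]
          (∀ v → Automorphism.to σ ([ w , c ]′ v) ≡ [ sequence k , sequence l ]′ v) × Fixes σ N
        conjugation = homogeneous {J = Finitary m ⊎ Finitary m}
          (⊎-small (Lift-small Fin-small) (Lift-small Fin-small)) N-small (pair-≈ k<l)

      σ : Automorphism ℭ
      σ = proj₁ conjugation

      σz : Fin n → C
      σz = Automorphism.to σ ∘ z

      moved-w : ∀ j → Automorphism.to σ (w j) ≡ sequence k j
      moved-w j = proj₁ (proj₂ conjugation) (inj₁ j)

      moved-c : ∀ j → Automorphism.to σ (c j) ≡ sequence l j
      moved-c j = proj₁ (proj₂ conjugation) (inj₂ j)

      in-σD : ∀ {d d′} → D d → Automorphism.to σ d ≡ d′ → (σ · D) d′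
      in-σD {d} d∈ refl = subst D (sym (auto-invʳ σ d)) d∈

      A⊆σD : A ⊆ (σ · D)
      A⊆σD a = in-σD (A⊆D a) (proj₂ (proj₂ conjugation) (includes a))

      z≈σz : z ≈[ A ] σz
      z≈σz = ≈-auto {D = A} σ (λ a → proj₂ (proj₂ conjugation) (includes a)) z

      abstract
        -- The conjugates live over different sets `σ · D`. Extending each of them to include `E`
        -- and then restricting to `E` gives all of them a common domain without loss of rank.
        extended : ∃ λ x → σz ≈[ σ · D ] x × Rk α x ((σ · D) ∪ E)
        extended = all-extendible α {σz} {σ · D} (·-small σ D-small)
          (stable-mono {x = z} {σz} {A} {σ · D} A⊆σD z≈σz z-stable) (Rk-auto α σ {z} {D} rank)
          (∪-small (·-small σ D-small) E-small) inj₁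

      x : Fin n → C
      x = proj₁ extended

      z≈x : z ≈[ A ] x
      z≈x = ≈-trans {D = A} {z} {σz} {x} z≈σz (≈-mono {D = A} {D′ = σ · D} {σz} {x} A⊆σD (proj₁ (proj₂ extended)))

      rank-x : Rk α x E
      rank-x = Rk-antitone α {x} {(σ · D) ∪ E} {E} inj₂ (proj₂ (proj₂ extended))

      follows : ∀ {d s} → (∀ j → D (d j)) → (∀ j → Automorphism.to σ (d j) ≡ s j) →
                ⟦ ψ ⟧ [ z , d ]′ ⇔ ⟦ ψ ⟧ [ x , s ]′
      follows {d} {s} d∈ e = mk⇔
        (λ t → ≈⇒⟦⟧ ψ {σ · D} {σz} {x} (proj₁ (proj₂ extended)) s s∈ (to (auto⇒⟦⟧ ψ σ e) t))
        (λ t → from (auto⇒⟦⟧ ψ σ e) (≈⇒⟦⟧ ψ {σ · D} {x} {σz}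
          (≈-sym {D = σ · D} {σz} {x} (proj₁ (proj₂ extended))) s s∈ t))
        where
        s∈ : ∀ j → (σ · D) (s j)
        s∈ j = in-σD (d∈ j) (e j)

      x-differs : ¬ (⌊ ⟦ ψ ⟧ [ x , sequence k ]′ ⌋ ≡ ⌊ ⟦ ψ ⟧ [ x , sequence l ]′ ⌋)
      x-differs e = differ (trans (same w∈D moved-w) (trans e (sym (same c∈D moved-c))))
        where
        same : ∀ {d s} → (∀ j → D (d j)) → (∀ j → Automorphism.to σ (d j) ≡ s j) →
               ⌊ ⟦ ψ ⟧ [ z , d ]′ ⌋ ≡ ⌊ ⟦ ψ ⟧ [ x , s ]′ ⌋
        same {d} {s} d∈ e = bool-ext
          (λ t → ⌊⌋-true (to (follows {d} {s} d∈ e) (⌊⌋-sound t)))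
          (λ t → ⌊⌋-true (from (follows {d} {s} d∈ e) (⌊⌋-sound t)))

    Conjugate : Set (lsuc ℓ)
    Conjugate = Σ (Fin n → C) λ x → z ≈[ A ] x × Rk α x E

    val : Conjugate → Λ → Bool
    val (x , _) k = ⌊ ⟦ ψ ⟧ [ x , sequence k ]′ ⌋

    separate : ∀ {i j} → ¬ (i ≡ j) → ∃ λ x → ¬ (val x i ≡ val x j)
    separate {i} {j} i≢j = choose (W.total i j)
      where
      choose : i W.< j ⊎ i ≡ j ⊎ j W.< i → ∃ λ x → ¬ (val x i ≡ val x j)
      choose (inj₁ lt)        = (x lt , z≈x lt , rank-x lt) , x-differs lt
      choose (inj₂ (inj₁ e))  = ⊥-elim (i≢j e)
      choose (inj₂ (inj₂ lt)) = (x lt , z≈x lt , rank-x lt) , λ e → x-differs lt (sym e)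

    abstract
      distinct : ∃ λ (g : κ → Conjugate) → ∀ {k l} → val (g k) ≡ val (g l) → k ≡ l
      distinct = many-distinct val separate

    family : Σ[ y ∈ (κ → Fin n → C) ] (∀ {i j} → y i ≈[ E ] y j → i ≡ j) × (∀ i → z ≈[ A ] y i × Rk α (y i) E)
    family = (λ k → proj₁ (proj₁ distinct k)) ,
      (λ {i} {j} p → proj₂ distinct (ext λ k → bool-ext
        (λ t → ⌊⌋-true (≈⇒⟦⟧ ψ {E} p (sequence k) (in-E k) (⌊⌋-sound t)))
        (λ t → ⌊⌋-true (≈⇒⟦⟧ ψ {E} (≈-sym {D = E} p) (sequence k) (in-E k) (⌊⌋-sound t))))) ,
      λ k → proj₂ (proj₁ distinct k)

  ¬All⇒∃¬ : {I : Set a} {P : I → Set b} (L : List I) → ¬ All P L → ∃ λ i → i ∈ᴸ L × ¬ P i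
  ¬All⇒∃¬ L h = stable λ none → h (All-tabulate λ {i} i∈ → stable λ np → none (i , i∈ , np))

  record SplitPair (A : Subset ℭ) (n : ℕ) : Set (lsuc ℓ) where
    field
      model : SmallModel A
      {len} : ℕ
      φ     : Formula L (n + len)
      left  : Vec C len
      right : Vec C len
      same  : lookup left ≈[ SmallModel.N model ] lookup right

  module Splitting {A B : Subset ℭ} {y : Fin n → C}
                   (splits : ∀ (r : S ℭ n (whole ℭ)) → tp {D = B} y ⊑ r → LascarSplitsOver A r) where

    open SplitPair

    TrueAt : Set ℓ
    TrueAt = Σ (Inst (Fin n ⊎ Σ C B)) λ ι → ⟦ ι ⟧ [ y , proj₁ ]′

    Satisfied : TrueAt ⊎ SplitPair A n → (Fin n → C) → Set ℓ
    Satisfied (inj₁ (ι , _)) x = ⟦ ι ⟧ [ x , proj₁ ]′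
    Satisfied (inj₂ s)       x = ℭ ⊨ φ s [ tabulate x ++ left s ] → ℭ ⊨ φ s [ tabulate x ++ right s ]

    -- An ultrafilter meeting all these conditions would be a global extension of tp(y/B) that
    -- splits over no small model containing `A`, and so does not Lascar-split over `A`.
    no-fip : ¬ (∀ Ls → ∃ λ x → All (λ i → Satisfied i x) Ls)
    no-fip fip = contradict (lascar-splits⇒splits {A = A} r (splits r (λ {θ} → includes {θ})))
      where
      abstract
        𝒲 : Ultrafilter (Fin n → C)
        𝒲 = proj₁ (fip⇒ultrafilter Satisfied fip)
        𝒲-∋ : ∀ i → 𝒲 ∋ Satisfied i
        𝒲-∋ = proj₂ (fip⇒ultrafilter Satisfied fip)
      r : S ℭ n (whole ℭ)
      r = ultra-type (whole ℭ) 𝒲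
      includes : tp {D = B} y ⊑ r
      includes {φ ⟨ a ⟩} (d , s) = all-whole a , lift (∋-mono 𝒲 (λ x → subst id (⟦block⟧ φ d x))
        (𝒲-∋ (inj₁ (block φ d , subst id (sym (⟦block⟧ φ d y)) s))))
      contradict : ¬ ∃ (SplitsOverModel {A = A} r)
      contradict (M , _ , φ , a , b , p , (_ , lift s) , (_ , lift t)) =
        ∋-¬ 𝒲 t (∋-mono 𝒲 (λ x (h , i) → h i) (∋-× 𝒲 (𝒲-∋ (inj₂ pair)) s))
        where
        pair : SplitPair A n
        pair = record { model = M ; φ = φ ; left = a ; right = b ; same = p }

    abstract
      -- By compactness finitely many pairs suffice: every realisation of tp(y/B) splits along one
      -- of them, so an extension to a small set containing their parameters already shows the
      -- splitting.
      obstruction : ∃ λ Ls → ∀ x → ¬ All (λ i → Satisfied i x) Ls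
      obstruction = let (Ls , h) = ¬∀⇒∃¬ no-fip in Ls , λ x k → h (x , k)

    params : List (TrueAt ⊎ SplitPair A n) → Subset ℭ
    params []            = B
    params (inj₁ _ ∷ Ls) = params Ls
    params (inj₂ s ∷ Ls) = (Range (lookup (left s)) ∪ Range (lookup (right s))) ∪ params Ls

    params-small : Small B → ∀ Ls → Small (params Ls)
    params-small sB []            = sB
    params-small sB (inj₁ _ ∷ Ls) = params-small sB Ls
    params-small sB (inj₂ s ∷ Ls) = ∪-small (∪-small (tuple-small _) (tuple-small _)) (params-small sB Ls)

    B⊆params : ∀ Ls → B ⊆ params Ls
    B⊆params []            b = b
    B⊆params (inj₁ _ ∷ Ls) b = B⊆params Ls b
    B⊆params (inj₂ _ ∷ Ls) b = inj₂ (B⊆params Ls b)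

    ∈-params : ∀ {Ls s} → inj₂ s ∈ᴸ Ls →
               (∀ j → params Ls (lookup (left s) j)) × (∀ j → params Ls (lookup (right s) j))
    ∈-params (here refl) = (λ j → inj₁ (inj₁ (j , refl))) , λ j → inj₁ (inj₂ (j , refl))
    ∈-params {inj₁ _ ∷ Ls} (there s∈) = ∈-params s∈
    ∈-params {inj₂ _ ∷ Ls} (there s∈) = let (p , q) = ∈-params s∈ in (λ j → inj₂ (p j)) , λ j → inj₂ (q j)

    SplitAt : (Fin n → C) → Set (lsuc ℓ)
    SplitAt z = ∃ λ s → inj₂ s ∈ᴸ proj₁ obstruction ×
                ℭ ⊨ φ s [ tabulate z ++ left s ] × ¬ (ℭ ⊨ φ s [ tabulate z ++ right s ])

    split-at : {z : Fin n → C} → y ≈[ B ] z → SplitAt z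
    split-at {z} p = failure (¬All⇒∃¬ (proj₁ obstruction) (proj₂ obstruction z))
      where
      failure : (∃ λ i → i ∈ᴸ proj₁ obstruction × ¬ Satisfied i z) → SplitAt z
      failure (inj₁ (ι , s) , _ , h) = ⊥-elim (h (p ι s))
      failure (inj₂ s , s∈ , h)      = s , s∈ , stable (λ k → h λ t → ⊥-elim (k t)) , λ t → h λ _ → t

  module SplittingRaisesRank {α : Ord (lsuc ℓ)} {A B : Subset ℭ} (A-small : Small A) (B-small : Small B) (A⊆B : A ⊆ B)
         {y : Fin n → C} (rank : Rk α y B)
         (splits : ∀ (r : S ℭ n (whole ℭ)) → tp {D = B} y ⊑ r → LascarSplitsOver A r)
         (y-stable : Stable y A) where

    open Splitting {A = A} {B} {y} splits

    D₁ : Subset ℭ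
    D₁ = params (proj₁ obstruction)

    D₁-small : Small D₁
    D₁-small = params-small B-small (proj₁ obstruction)

    abstract
      first : ∃ λ z → y ≈[ B ] z × Rk α z D₁
      first = all-extendible α {y} {B} B-small (stable-mono {x = y} {y} {A} {B} A⊆B (≈-refl {D = A}) y-stable) rank
                D₁-small (B⊆params (proj₁ obstruction))

    z₁ : Fin n → C
    z₁ = proj₁ first

    y≈z₁ : y ≈[ A ] z₁
    y≈z₁ = ≈-mono {D = A} {D′ = B} {y} {z₁} A⊆B (proj₁ (proj₂ first))

    A⊆D₁ : A ⊆ D₁
    A⊆D₁ a = B⊆params (proj₁ obstruction) (A⊆B a)

    abstract
      split : SplitAt z₁
      split = split-at {z₁} (proj₁ (proj₂ first))

    open SplitPair (proj₁ split)
    open SmallModel model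

    u v : Finitary len → C
    u = lookup left ∘ lower
    v = lookup right ∘ lower

    u∈D₁ : ∀ j → D₁ (u j)
    u∈D₁ j = proj₁ (∈-params (proj₁ (proj₂ split))) (lower j)

    v∈D₁ : ∀ j → D₁ (v j)
    v∈D₁ j = proj₂ (∈-params (proj₁ (proj₂ split))) (lower j)

    ψ : Inst (Fin n ⊎ Finitary len)
    ψ = as-inst φ

    co : Coheir {N = N} u
    co = coheir elementary u

    Nuv-small : Small (N ∪ (Range u ∪ Range v))
    Nuv-small = ∪-small N-small (∪-small (range-small (Lift-small Fin-small) u) (range-small (Lift-small Fin-small) v))

    γ : Finitary len → C
    γ = Realise.realisation (Lift-small Fin-small) (Coheir.𝒰 co) Nuv-small

    γ-realises : γ ⊩[ N ∪ (Range u ∪ Range v) ] Coheir.𝒰 co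
    γ-realises = Realise.realises (Lift-small Fin-small) (Coheir.𝒰 co) Nuv-small

    D₂ : Subset ℭ
    D₂ = D₁ ∪ Range γ

    D₂-small : Small D₂
    D₂-small = ∪-small D₁-small (range-small (Lift-small Fin-small) γ)

    abstract
      -- The tuple `γ` depends on the pair along which `z₁` splits, so it can only be adjoined by a
      -- further extension.
      second : ∃ λ z → z₁ ≈[ D₁ ] z × Rk α z D₂
      second = all-extendible α {z₁} {D₁} D₁-small
        (stable-mono {x = y} {z₁} {A} {D₁} A⊆D₁ y≈z₁ y-stable) (proj₂ (proj₂ first)) D₂-small inj₁

    z₂ : Fin n → C
    z₂ = proj₁ second

    y≈z₂ : y ≈[ A ] z₂
    y≈z₂ = ≈-trans {D = A} {y} {z₁} {z₂} y≈z₁ (≈-mono {D = A} {D′ = D₁} {z₁} {z₂} A⊆D₁ (proj₁ (proj₂ second)))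

    at-u : ⟦ ψ ⟧ [ z₂ , u ]′
    at-u = ≈⇒⟦⟧ ψ {D₁} {z₁} {z₂} (proj₁ (proj₂ second)) u u∈D₁
      (subst id (sym (⟦as-inst⟧ φ z₁ left)) (proj₁ (proj₂ (proj₂ split))))

    at-v : ¬ ⟦ ψ ⟧ [ z₂ , v ]′
    at-v t = proj₂ (proj₂ (proj₂ split)) (subst id (⟦as-inst⟧ φ z₁ right)
      (≈⇒⟦⟧ ψ {D₁} {z₂} {z₁} (≈-sym {D = D₁} {z₁} {z₂} (proj₁ (proj₂ second))) v v∈D₁ t))

    Family : Set ℓ → Set (lsuc ℓ)
    Family κ = Σ[ E ∈ Subset ℭ ] Small E × A ⊆ E × Σ[ x ∈ (κ → Fin n → C) ]
      (∀ {i j} → x i ≈[ E ] x j → i ≡ j) × (∀ i → z₂ ≈[ A ] x i × Rk α (x i) E)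

    module _ {κ : Set ℓ} (κ-small : κ ≺ κ̄) where

      spread : {w : Finitary len → C} → u ≈[ N ] w → Range w ⊆ Range u ∪ Range v → (∀ j → D₁ (w j)) →
               ¬ (⌊ ⟦ ψ ⟧ [ z₂ , w ]′ ⌋ ≡ ⌊ ⟦ ψ ⟧ [ z₂ , γ ]′ ⌋) → Family κ
      spread {w} u≈w i w∈D₁ d = Sp.E , Sp.E-small , inj₁ , Sp.family
        where
        γ-over-w : γ ⊩[ N ∪ Range w ] Coheir.𝒰 co
        γ-over-w = ⊩-mono (Coheir.𝒰 co) {D = N ∪ Range w} {D′ = N ∪ (Range u ∪ Range v)}
          (λ { (inj₁ e) → inj₁ e ; (inj₂ r) → inj₂ (i r) }) γ-realises
        module Sp = Spread {α = α} {A} {D₂} A-small D₂-small {z₂} (stable-mono {x = y} {z₂} {A} {A} id y≈z₂ y-stable)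
          (proj₂ (proj₂ second)) (λ a → inj₁ (A⊆D₁ a)) model {u} {w} {γ} co u≈w
          γ-over-w
          (λ j → inj₁ (w∈D₁ j)) (λ j → inj₂ (j , refl)) ψ d κ-small

      family : Family κ
      -- `ψ` holds at `u` and fails at `v`, so its value at `γ` differs from one of these; that one
      -- begins the coheir pair.
      family = choose (em {P = ⟦ ψ ⟧ [ z₂ , γ ]′})
        where
        choose : Dec (⟦ ψ ⟧ [ z₂ , γ ]′) → Family κ
        choose (yes s) = spread {v} (≈-∘ {D = N} lower same) inj₂ v∈D₁
          (λ e → at-v (⌊⌋-sound (trans e (⌊⌋-true s))))
        choose (no s)  = spread {u} (≈-refl {D = N}) inj₁ u∈D₁
          (λ e → s (⌊⌋-sound (trans (sym e) (⌊⌋-true at-u))))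

    raised : Rk (Ord.suc α) y A
    raised κ sκ = let (E , sE , i , x , inj , g) = family sκ in
      E , sE , i , x , inj , λ k → ≈-trans {D = A} {y} {z₂} y≈z₂ (proj₁ (g k)) , proj₂ (g k)

  -- The construction needs a stable type. Arguing by contradiction provides one: if the conclusion
  -- fails, the rank of tp(y/A) is bounded.
  splitting-raises-rank : ∀ α {A B : Subset ℭ} → Small A → Small B → A ⊆ B → {y : Fin n → C} → Rk α y B →
    (∀ (r : S ℭ n (whole ℭ)) → tp {D = B} y ⊑ r → LascarSplitsOver A r) → Rk (Ord.suc α) y A
  splitting-raises-rank α sA sB i {y} rank splits = stable λ bounded →
    bounded (SplittingRaisesRank.raised {α = α} sA sB i {y} rank (λ r h → splits r h)
              (Rk-bounded⇒stable (Ord.suc α) sA bounded))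

  -- Equality of the two ranks

  ⊑⇒⊆ : {A B : Subset ℭ} {p : S ℭ n A} {q : S ℭ n B} → p ⊑ q → A ⊆ B
  ⊑⇒⊆ {n} {A} {B} {p} {q} h {c} d with S.complete p self (c ∷ []) (d ∷ [])
    where
    self : Formula L (n + 1)
    -- The formula `c = c`: its presence in a type shows that `c` is among the parameters.
    self = var (n ↑ʳ zero) ≗ var (n ↑ʳ zero)
  ... | inj₁ m = head-all (S.over q (h m))
    where
    head-all : Allⱽ B (c ∷ []) → B c
    head-all (e ∷ []) = e
  ... | inj₂ m with S.satisfiable p (_ ∷ []) (m ∷ [])
  ...   | x , k ∷ [] = ⊥-elim (k refl)

  SU⇒Rk : ∀ α {A : Subset ℭ} {p : S ℭ n A} {x : Fin n → C} → Small A → x ⊨ₜ p → SUⁱ≥ α p → Rk α x A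
  SU⇒Rk Ord.zero    sA h u = tt
  SU⇒Rk (Ord.suc α) {A} {p} {x} sA h (B , sB , q , (p⊑q , splits) , u) =
    let (y , g) = ⊨ₜ-realised sB q
        y⊨p : y ⊨ₜ p
        y⊨p = λ {θ} m → g {θ} (p⊑q {θ} m)
    in Rk-≈ (Ord.suc α) {y} {x} {A} (⊨ₜ-unique {p = p} (λ {θ} → y⊨p {θ}) (λ {θ} → h {θ}))
         (splitting-raises-rank α sA sB (⊑⇒⊆ {p = p} {q} (λ {θ} → p⊑q {θ})) (SU⇒Rk α {p = q} sB (λ {θ} → g {θ}) u)
           λ r tp⊑r → splits r λ {θ} m → tp⊑r {θ} (S.over q m , g {θ} m))
  SU⇒Rk (lim I f) {p = p} sA h u = λ i → SU⇒Rk (f i) {p = p} sA (λ {θ} → h {θ}) (u i)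

  U⇔SU : ∀ α {A : Subset ℭ} → Small A → (p : S ℭ n A) → U≥ α p ⇔ SUⁱ≥ α p
  U⇔SU α sA p = let (x , h) = ⊨ₜ-realised sA p in mk⇔
    (λ u → Rk⇒SU α {p = p} sA (λ {θ} → h {θ}) (U⇒Rk α {p = p} (λ {θ} → h {θ}) u))
    (λ s → Rk⇒U α {p = p} (λ {θ} → h {θ}) (SU⇒Rk α {p = p} sA (λ {θ} → h {θ}) s))

HasValue-⇔ : ∀ {o} {P Q : Pred (Ord o) o} → (∀ α → P α ⇔ Q α) → ∀ v → HasValue P v → HasValue Q v
HasValue-⇔ {o} {P} {Q} h = value
  where
  open Equivalence using (to; from)
  supremum : ∀ {P Q : Pred (Ord o) o} {α} → (∀ β → Q β → P β) → (∀ β → P β → Q β) →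
             IsSupremum P α → IsSupremum Q α
  supremum f g (upper , least) = (λ β q → upper β (f β q)) , λ γ bd → least γ λ β p → bd β (g β p)
  value : ∀ v → HasValue P v → HasValue Q v
  value (ord α) s = supremum (λ β → from (h β)) (λ β → to (h β)) s
  value ∞       n = λ (α , s) → n (α , supremum (λ β → to (h β)) (λ β → from (h β)) s)

corollary2p26 : (∀ {a} → ExcludedMiddle a) →
    (∀ {a b} → Extensionality a b) →
    ∀ {ℓ : Level} (L : Language ℓ) (T : Theory L) → Complete T →
    (κ̄ : Set ℓ) (ℭ : Structure L) → IsMonster T κ̄ ℭ →
    let open Monster κ̄ ℭ in
    (n : ℕ) (A : Subset ℭ) → Small A → (p : S ℭ n A) →
    (v : Ord∞ (lsuc ℓ)) → (U[ p ]≡ v) ⇔ (SUⁱ[ p ]≡ v)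
corollary2p26 em ext L T _ κ̄ ℭ isMonster n A sA p v = mk⇔
  (HasValue-⇔ same v)
  (HasValue-⇔ (λ α → mk⇔ (Equivalence.from (same α)) (Equivalence.to (same α))) v)
  where
  same = λ α → Model.U⇔SU em ext L T κ̄ ℭ isMonster α sA p
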